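{- There exist an absolute constant $C>0$ and a single online algorithm, which is not given $\varepsilon$ as input, such that for every $\varepsilon\in(0,\tfrac12]$ and every instance of the $\varepsilon$-signaling model on a single machine, the schedule produced by the algorithm has total flow time at most $\frac{C}{\varepsilon^2}\cdot \mathrm{OPT}$, where $\mathrm{OPT}$ is the minimum total flow time of any feasible offline schedule for the instance.
   Context: Scheduling problem: a finite set of jobs is given; job $j$ has a release time $r_j\in\mathbb Z_{\ge 0}$ and a processing time $p_j\in\mathbb Z_{\ge 1}$. A feasible schedule on a single machine processes, during each unit interval $[t,t+1]$, $t\in\mathbb Z_{\ge0}$, at most one job $j$, which must satisfy $r_j\le t$ and be unfinished; preemption is allowed. The elapsed time $e_j(t)$ is the number of unit intervals before time $t$ in which $j$ was processed; $p_j(t)=p_j-e_j(t)$; the completion time is $C_j=\min\{t: p_j(t)=0\}$, the flow time is $F_j=C_j-r_j$, and the total flow time is $\sum_j F_j$. $\varepsilon$-signaling model: for each job $j$ the adversary chooses, besides $r_j$ and $p_j$, an integer signal threshold $q_j$ with $\varepsilon p_j\le q_j\le(1-\varepsilon)p_j$. The online algorithm is informed of the existence of job $j$ at time $r_j$ (and of nothing else about $j$); it receives a signal for job $j$ (containing no numerical information) at the first time when $j$ has been processed for $q_j$ units; and it is informed when $j$ completes. The algorithm can keep track of the elapsed times itself. No other information is revealed, and decisions at time $t$ may depend only on information revealed up to time $t$. -}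

module Defs where

open import Data.Fin using (Fin)
import Data.Fin.Properties as Fin
open import Data.Integer using (+_)
open import Data.List using (List; length; filter; map; downFrom; applyDownFrom; allFin)
open import Data.Maybe as Maybe using (Maybe; just)
open import Data.Maybe.Properties using (≡-dec)
open import Data.Nat as ℕ using (ℕ; suc; _∸_; _≟_)
open import Data.Nat.Properties using (+-0-commutativeMonoid; allUpTo?)
open import Data.Product using (_×_; ∃-syntax; Σ-syntax)
open import Data.Rational using (ℚ; 0ℚ; 1ℚ; _≤_; _<_; _*_; _-_; _÷_; _/_; NonZero; Positive; positive)
open import Data.Rational.Properties using (pos⇒nonZero; pos*pos⇒pos)
open import Function.Bundles using (_↣_; Injection)
open import Relation.Binary.PropositionalEquality using (_≡_; _≢_)
open import Relation.Nullary using (¬_)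
open import Relation.Nullary.Decidable using (_×-dec_; ¬?)
open import Relation.Unary using (Pred; Decidable)
open import Algebra.Properties.CommutativeMonoid.Sum +-0-commutativeMonoid using (sum-syntax)
open import Level using (0ℓ)

fromℕ : ℕ → ℚ
fromℕ k = + k / 1

-- The guarantee C / ε².
ratio : (C ε : ℚ) → 0ℚ < ε → ℚ
ratio C ε 0<ε = C ÷ (ε * ε)
  where instance
    ε>0 : Positive ε
    ε>0 = positive 0<ε
    ε²≠0 : NonZero (ε * ε)
    ε²≠0 = pos⇒nonZero (ε * ε) {{pos*pos⇒pos ε ε}}

FirstTime : Pred ℕ 0ℓ → Pred ℕ 0ℓ
FirstTime P t = P t × (∀ {s} → s ℕ.< t → ¬ P s)

firstTime? : {P : Pred ℕ 0ℓ} → Decidable P → Decidable (FirstTime P)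
firstTime? P? t = P? t ×-dec allUpTo? (λ s → ¬? (P? s)) t

record Instance : Set where
  field
    n   : ℕ
    r   : Fin n → ℕ
    p   : Fin n → ℕ
    p≥1 : ∀ j → 1 ℕ.≤ p j
    q   : Fin n → ℕ

  Job : Set
  Job = Fin n

  -- S t is the job processed during [t , t + 1]; nothing means idling.
  Schedule : Set
  Schedule = ℕ → Maybe Job

  elapsed : Schedule → Job → ℕ → ℕ
  elapsed S j t = length (filter (λ s → ≡-dec Fin._≟_ (S s) (just j)) (downFrom t))

  -- A feasible schedule never processes a finished job, so the truncated
  -- subtraction is exact there.
  remaining : Schedule → Job → ℕ → ℕ
  remaining S j t = p j ∸ elapsed S j t

  Feasible : Schedule → Set
  Feasible S = ∀ t j → S t ≡ just j → r j ℕ.≤ t × remaining S j t ≢ 0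

  IsCompletionTime : Schedule → Job → ℕ → Set
  IsCompletionTime S j = FirstTime (λ t → remaining S j t ≡ 0)

  -- Only schedules completing every job have a total flow time. If S is
  -- feasible, then c j > r j, so again truncation is harmless.
  IsTotalFlowTime : Schedule → ℕ → Set
  IsTotalFlowTime S F =
    Σ[ c ∈ (Job → ℕ) ] (∀ j → IsCompletionTime S j (c j)) × F ≡ ∑[ j < n ] (c j ∸ r j)

  -- Offline optimum; the thresholds q play no role.
  IsOPT : ℕ → Set
  IsOPT v =
      (∃[ S ] Feasible S × IsTotalFlowTime S v)
    × (∀ S w → Feasible S → IsTotalFlowTime S w → v ℕ.≤ w)

  EpsSignaling : ℚ → Set
  EpsSignaling ε =
    ∀ j → ε * fromℕ (p j) ≤ fromℕ (q j) × fromℕ (q j) ≤ (1ℚ - ε) * fromℕ (p j)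

-- The names of the jobs that are released, emit their signal, and complete at
-- one point in time.
record Observation : Set where
  constructor observation
  field
    released  : List ℕ
    signaled  : List ℕ
    completed : List ℕ

-- An online algorithm maps the observations made at times t , t - 1 , … , 0
-- (latest first) to the name of the job to process during [t , t + 1], if any.
-- It is deterministic, so its past decisions, and hence the elapsed times, are
-- determined by this list.
OnlineAlgorithm : Set
OnlineAlgorithm = List Observation → Maybe ℕ

-- The algorithm refers to jobs by arbitrary distinct names. They are not under
-- its control and are unrelated to n, r, p and q, so that identifying a job
-- reveals nothing about the instance.
module Online (I : Instance) (name : Instance.Job I ↣ ℕ) where
  open Instance I
  open Injection name using (to)

  namesOf : {P : Pred Job 0ℓ} → Decidable P → List ℕ
  namesOf P? = map to (filter P? (allFin n))

  observe : Schedule → ℕ → Observation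
  observe S t = observation
    (namesOf (λ j → r j ≟ t))
    (namesOf (λ j → firstTime? (λ s → elapsed S j s ≟ q j) t))
    (namesOf (λ j → firstTime? (λ s → remaining S j s ≟ 0) t))

  -- The observations at times t , … , 0 depend only on S s for s < t, so this
  -- condition determines S uniquely.
  ProducedBy : OnlineAlgorithm → Schedule → Set
  ProducedBy A S = ∀ t → Maybe.map to (S t) ≡ A (applyDownFrom (observe S) (suc t))

{-# OPTIONS --safe #-}

-- Let the value of a job be its elapsed time, frozen when the signal is emitted.
-- The algorithm processes an alive job of least value. A job that emits its signal
-- becomes "guarded" if another fresh (unsignaled) job has a value below those of
-- all guarded jobs, and "lone" otherwise. There is one exception to the rule: if
-- the job of least value is the only fresh one below the guarded jobs, and there
-- is also a lone job below them, then the lone job is processed instead.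
--
-- Guarded jobs inject into fresh ones and lone jobs alternate with guarded ones,
-- so at any time the alive jobs number at most 3 U + 1, with U fresh jobs. Fresh
-- jobs of value v have remaining time at least ε v, and jobs of value v have
-- elapsed time at most v / ε. For a threshold x, since the last time a value ≥ x
-- was processed only jobs of value < x were processed, and these were released
-- afterwards; so another schedule cannot be ahead on them, and the values of fresh
-- jobs below x that are finished in the other schedule sum to at most 1 / ε² times
-- the values of those below x that it has not finished. Summation by parts over x
-- turns this into a comparison of numbers, so the algorithm has O(1 / ε²) times as
-- many alive jobs as any schedule at every time. An exception spoils the window at
-- x by one job only, and between x and the next guarded value y there is no other
-- fresh job; as the window at y is intact, the error matters only if the other
-- schedule has an unfinished job with a value in between, and is charged to it.

module Submission where

open import Defs
open import Data.Bool.Base using (Bool; true; false; _∧_; _∨_; not; if_then_else_)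
import Data.Bool.Properties as Bool
open import Data.Fin.Base using (Fin; zero; suc)
import Data.Fin.Properties as Fin
import Data.Integer.Base as ℤ
import Data.Integer.Properties as ℤ
open import Data.List.Base using (List; []; _∷_; map; _++_; filter; allFin; tabulate; applyDownFrom)
open import Data.List.Membership.Propositional using (_∈_)
open import Data.List.Membership.Propositional.Properties
  using (∈-map⁺; ∈-map⁻; ∈-filter⁺; ∈-filter⁻; ∈-allFin; ∈-++⁺ˡ; ∈-++⁺ʳ)
open import Data.List.Properties using (map-++)
open import Data.List.Relation.Unary.Any using (here; there)
open import Data.Maybe.Base as Maybe using (Maybe; just; nothing; fromMaybe; is-just; _<∣>_)
open import Data.Maybe.Properties using (≡-dec; just-injective)
import Data.Nat.Base as ℕ
import Data.Nat.Properties as ℕ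
open import Data.Nat using (ℕ)
open import Data.Nat.Tactic.RingSolver using (solve-∀)
open import Data.Product using (_×_; _,_; proj₁; proj₂; map₁; ∃-syntax)
import Data.Rational.Properties as ℚ
open import Data.Rational.Unnormalised.Base as ℚᵘ using (mkℚᵘ; _≃_)
import Data.Rational.Unnormalised.Properties as ℚᵘ
open import Data.Sum.Base using (_⊎_; inj₁; inj₂)
open import Function.Base using (_∘_; id)
open import Function.Bundles using (_↣_; Injection)
open import Level using (0ℓ)
open import Relation.Binary.Definitions using (tri<; tri≈; tri>)
open import Relation.Binary.PropositionalEquality
open import Relation.Nullary using (Dec; does; contradiction; ofʸ; ofⁿ; ¬_; yes; no)
open import Relation.Nullary.Decidable using (dec-true; dec-false; _×-dec_)
open import Relation.Nullary.Reflects using (Reflects)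
open import Relation.Unary using (Pred; Decidable)

-- Signaled jobs resist a direct comparison: such a job may have a single unit left whatever its
-- value, so a schedule that has finished it need not be ahead by anything proportional to that
-- value. Hence only fresh jobs are compared, and the signaled ones have to be counted by fresh
-- ones. This forces the exception. If the only fresh job below the guarded ones emitted its signal
-- while a lone job lay there too, two lone jobs would be adjacent, and repetition would pile up
-- signaled jobs with no fresh ones to pay for them. The price is that the least value is not always
-- the one processed. The additive `1` in `3 U + 1` is harmless because the algorithm has no alive
-- job whenever the other schedule has no unfinished one. All estimates are over natural numbers:
-- `ε` is `m / d`, and inequalities are multiplied by `d * d`, so that factors `m * m`, `m * d` and
-- `d * d` stand for `ε²`, `ε` and `1`. The schedule is built with full knowledge of the instance;
-- that `algorithm` produces it from observations alone is shown separately.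

module Scheduling where

  open import Data.Nat.Base
    using (zero; suc; _+_; _*_; _∸_; _⊓_; _⊔_; _≤_; _<_; _≤ᵇ_; _<ᵇ_; z≤n; s≤s)
  open import Data.Nat.Properties
  open import Algebra.Properties.CommutativeMonoid.Sum +-0-commutativeMonoid
    using (sum; ∑-distrib-+; sum-cong-≗; sum-replicate-zero)
  open import Algebra.Properties.Semiring.Sum +-*-semiring using (*-distribˡ-sum)
  open import Data.List.Membership.DecPropositional _≟_ using (_∈?_)

  -- Sums and indicators

  infixr 8 _·_
  _·_ : Bool → ℕ → ℕ
  b · x = if b then x else 0

  sum-mono : ∀ {n} {f g : Fin n → ℕ} → (∀ j → f j ≤ g j) → sum f ≤ sum g
  sum-mono {zero}  le = z≤n
  sum-mono {suc n} le = +-mono-≤ (le zero) (sum-mono (λ j → le (suc j)))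

  term≤sum : ∀ {n} (f : Fin n → ℕ) w → f w ≤ sum f
  term≤sum f zero    = m≤m+n _ _
  term≤sum f (suc w) = ≤-trans (term≤sum (λ j → f (suc j)) w) (m≤n+m _ (f zero))

  sum-zero : ∀ {n} {f : Fin n → ℕ} → (∀ j → f j ≡ 0) → sum f ≡ 0
  sum-zero {n} eq = trans (sum-cong-≗ eq) (sum-replicate-zero n)

  is : ∀ {n} → Maybe (Fin n) → Fin n → Bool
  is m j = does (≡-dec Fin._≟_ m (just j))

  sum-is : ∀ {n} w (f : Fin n → ℕ) → sum (λ j → is (just w) j · f j) ≡ f w
  sum-is {suc n} zero f = trans (cong (f zero +_) (sum-zero {n} (λ _ → refl))) (+-identityʳ _)
  sum-is (suc w) f = sum-is w (λ j → f (suc j))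

  below cap over : ℕ → ℕ → ℕ
  below w x = (w ≤ᵇ x) · w
  cap   w x = w ⊓ x
  over  w x = (x <ᵇ w) · 1

  cap-split : ∀ w x → cap w x ≡ below w x + x * over w x
  cap-split w x with w ≤ᵇ x | ≤ᵇ-reflects-≤ w x | x <ᵇ w | <ᵇ-reflects-< x w
  ... | true | ofʸ w≤x | true | ofʸ x<w = contradiction x<w (≤⇒≯ w≤x)
  ... | true | ofʸ w≤x | false | _  = trans (m≤n⇒m⊓n≡m w≤x) (sym (trans (cong (w +_) (*-zeroʳ x)) (+-identityʳ w)))
  ... | false | _ | true | ofʸ x<w = trans (m≥n⇒m⊓n≡n (<⇒≤ x<w)) (sym (*-identityʳ x))
  ... | false | ofⁿ w≰x | false | ofⁿ x≮w = contradiction (≰⇒> w≰x) x≮w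

  -- An upper estimate, for the side of the summation by parts whose threshold moves in steps of 3;
  -- `cap-suc` is the lower estimate for the other side.
  cap-+ : ∀ w x k → cap w (x + k) ≤ cap w x + k * over w x
  cap-+ w x k with x <ᵇ w | <ᵇ-reflects-< x w
  ... | true | ofʸ x<w = ≤-trans (m⊓n≤n w (x + k)) (≤-reflexive (cong₂ _+_ (sym (m≥n⇒m⊓n≡n (<⇒≤ x<w))) (sym (*-identityʳ k))))
  ... | false | ofⁿ x≮w = ≤-trans (m⊓n≤m w (x + k)) (≤-trans (≤-reflexive (sym (m≤n⇒m⊓n≡m (≮⇒≥ x≮w)))) (m≤m+n _ _))

  cap-suc : ∀ w x → cap w x + over w x ≤ cap w (suc x)
  cap-suc w x with x <ᵇ w | <ᵇ-reflects-< x w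
  ... | true | ofʸ x<w = ≤-trans (≤-reflexive (trans (+-comm _ 1) (cong suc (m≥n⇒m⊓n≡n (<⇒≤ x<w))))) (≤-reflexive (sym (m≥n⇒m⊓n≡n x<w)))
  ... | false | ofⁿ x≮w = ≤-trans (≤-reflexive (+-identityʳ _)) (⊓-monoʳ-≤ w (n≤1+n x))

  -- Summation by parts without subtraction. With f and g truncated sums, S and T
  -- sums over the small weights, u and h numbers of large weights: as x decreases,
  -- either f drops faster than g or the large weights are already paid for.
  byParts : ∀ M₁ M₂ (f u S g h T : ℕ → ℕ) →
    (∀ x → f x ≡ S x + x * u x) → (∀ x → f x + u x ≤ f (suc x)) →
    (∀ x → g x ≡ T x + 3 * x * h x) → (∀ x → g (suc x) ≤ g x + 3 * h x) →
    (∀ x → M₁ * S x ≤ M₂ * T x) →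
    ∀ X → u X ≡ 0 → ∀ k x → x + k ≡ X → M₁ * f x ≤ M₂ * g x
  byParts M₁ M₂ f u S g h T fS f+ gT g+ ST X uX zero x eq = begin
    M₁ * f x                    ≡⟨ cong (M₁ *_) (fS x) ⟩
    M₁ * (S x + x * u x)        ≡⟨ cong (λ z → M₁ * (S x + x * z)) (trans (cong u (trans (sym (+-identityʳ x)) eq)) uX) ⟩
    M₁ * (S x + x * 0)          ≡⟨ cong (λ z → M₁ * (S x + z)) (*-zeroʳ x) ⟩
    M₁ * (S x + 0)              ≡⟨ cong (M₁ *_) (+-identityʳ (S x)) ⟩
    M₁ * S x                    ≤⟨ ST x ⟩
    M₂ * T x                    ≤⟨ *-monoʳ-≤ M₂ (m≤m+n (T x) _) ⟩
    M₂ * (T x + 3 * x * h x)    ≡⟨ cong (M₂ *_) (gT x) ⟨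
    M₂ * g x                    ∎
    where open ≤-Reasoning
  byParts M₁ M₂ f u S g h T fS f+ gT g+ ST X uX (suc k) x eq
    with byParts M₁ M₂ f u S g h T fS f+ gT g+ ST X uX k (suc x) (trans (sym (+-suc x k)) eq)
       | ≤-total (M₂ * (3 * h x)) (M₁ * u x)
  ... | rec | inj₁ drop = +-cancelʳ-≤ (M₁ * u x) (M₁ * f x) (M₂ * g x) (begin
    M₁ * f x + M₁ * u x         ≡⟨ *-distribˡ-+ M₁ (f x) (u x) ⟨
    M₁ * (f x + u x)            ≤⟨ *-monoʳ-≤ M₁ (f+ x) ⟩
    M₁ * f (suc x)              ≤⟨ rec ⟩
    M₂ * g (suc x)              ≤⟨ *-monoʳ-≤ M₂ (g+ x) ⟩
    M₂ * (g x + 3 * h x)        ≡⟨ *-distribˡ-+ M₂ (g x) (3 * h x) ⟩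
    M₂ * g x + M₂ * (3 * h x)   ≤⟨ +-monoʳ-≤ (M₂ * g x) drop ⟩
    M₂ * g x + M₁ * u x         ∎)
    where open ≤-Reasoning
  ... | _ | inj₂ paid = begin
    M₁ * f x                              ≡⟨ cong (M₁ *_) (fS x) ⟩
    M₁ * (S x + x * u x)                  ≡⟨ split M₁ (S x) x (u x) ⟩
    M₁ * S x + x * (M₁ * u x)             ≤⟨ +-mono-≤ (ST x) (*-monoʳ-≤ x paid) ⟩
    M₂ * T x + x * (M₂ * (3 * h x))       ≡⟨ join M₂ (T x) x (h x) ⟩
    M₂ * (T x + 3 * x * h x)              ≡⟨ cong (M₂ *_) (gT x) ⟨
    M₂ * g x                              ∎
    where
    open ≤-Reasoning
    split : ∀ a b c d → a * (b + c * d) ≡ a * b + c * (a * d)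
    split = solve-∀
    join : ∀ a b c d → a * b + c * (a * (3 * d)) ≡ a * (b + 3 * c * d)
    join = solve-∀

  ·-* : ∀ b c x → b · (c * x) ≡ c * b · x
  ·-* true  c x = refl
  ·-* false c x = sym (*-zeroʳ c)

  ·-+ : ∀ b x y → b · (x + y) ≡ b · x + b · y
  ·-+ true  x y = refl
  ·-+ false x y = refl

  ·-mono : ∀ b {x y} → x ≤ y → b · x ≤ b · y
  ·-mono true  le = le
  ·-mono false le = z≤n

  ·-≤ : ∀ b {x} → b · x ≤ x
  ·-≤ true  = ≤-refl
  ·-≤ false = z≤n

  -- An ω-item counts three times, with the weights w, w′ and w′.
  weights⇒numbers : ∀ {n} M₁ M₂ (χ ω : Fin n → Bool) (a w w′ : Fin n → ℕ) →
    (∀ j → 1 ≤ a j) →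
    (∀ x → M₁ * sum (λ j → χ j · below (a j) x)
         ≤ M₂ * sum (λ j → ω j · (below (w j) (3 * x) + 2 * below (w′ j) (3 * x)))) →
    M₁ * sum (λ j → χ j · 1) ≤ M₂ * (9 * sum (λ j → ω j · 1))
  weights⇒numbers {n} M₁ M₂ χ ω a w w′ a≥1 ST = begin
    -- All weights are at least 1, so sums truncated at 1 are numbers.
    M₁ * sum (λ j → χ j · 1)        ≤⟨ *-monoʳ-≤ M₁ (sum-mono (λ j → ·-mono (χ j) (⊓-glb (a≥1 j) ≤-refl))) ⟩
    M₁ * f 1                        ≤⟨ byParts M₁ M₂ f u S g h T fS f+ gT g+ ST (suc X) uX X 1 refl ⟩
    -- Three weights, each truncated at `3 * 1`: the origin of the factor 9.
    M₂ * g 1                        ≤⟨ *-monoʳ-≤ M₂ (sum-mono (λ j → ·-mono (ω j) (+-mono-≤ (m⊓n≤n (w j) 3) (*-monoʳ-≤ 2 (m⊓n≤n (w′ j) 3))))) ⟩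
    M₂ * sum (λ j → ω j · (9 * 1))  ≡⟨ cong (M₂ *_) (trans (sum-cong-≗ (λ j → ·-* (ω j) 9 1)) (sym (*-distribˡ-sum 9 (λ j → ω j · 1)))) ⟩
    M₂ * (9 * sum (λ j → ω j · 1))  ∎
    where
    open ≤-Reasoning
    X = sum a
    f u S g h T : ℕ → ℕ
    f x = sum (λ j → χ j · cap (a j) x)
    u x = sum (λ j → χ j · over (a j) x)
    S x = sum (λ j → χ j · below (a j) x)
    g x = sum (λ j → ω j · (cap (w j) (3 * x) + 2 * cap (w′ j) (3 * x)))
    h x = sum (λ j → ω j · (over (w j) (3 * x) + 2 * over (w′ j) (3 * x)))
    T x = sum (λ j → ω j · (below (w j) (3 * x) + 2 * below (w′ j) (3 * x)))
    linear : ∀ (c d : Fin n → ℕ) (χ : Fin n → Bool) k →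
      sum (λ j → χ j · c j) + k * sum (λ j → χ j · d j) ≡ sum (λ j → χ j · (c j + k * d j))
    linear c d χ k = trans (cong (_ +_) (*-distribˡ-sum k (λ j → χ j · d j)))
      (trans (sym (∑-distrib-+ (λ j → χ j · c j) (λ j → k * χ j · d j)))
        (sum-cong-≗ (λ j → sym (trans (·-+ (χ j) (c j) (k * d j)) (cong (χ j · c j +_) (·-* (χ j) k (d j)))))))
    fS : ∀ x → f x ≡ S x + x * u x
    fS x = trans (sum-cong-≗ (λ j → cong (χ j ·_) (cap-split (a j) x))) (sym (linear _ _ χ x))
    f+ : ∀ x → f x + u x ≤ f (suc x)
    f+ x = ≤-trans (≤-reflexive (trans (cong (f x +_) (sym (*-identityˡ (u x)))) (linear _ _ χ 1)))
      (sum-mono (λ j → ·-mono (χ j) (≤-trans (≤-reflexive (cong (cap (a j) x +_) (*-identityˡ _))) (cap-suc (a j) x))))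
    rearrange : ∀ a b c d k → (a + k * b) + 2 * (c + k * d) ≡ (a + 2 * c) + k * (b + 2 * d)
    rearrange = solve-∀
    gT : ∀ x → g x ≡ T x + 3 * x * h x
    gT x = trans (sum-cong-≗ (λ j → cong (ω j ·_) (trans
        (cong₂ (λ p q → p + 2 * q) (cap-split (w j) (3 * x)) (cap-split (w′ j) (3 * x)))
        (rearrange (below (w j) (3 * x)) (over (w j) (3 * x)) (below (w′ j) (3 * x)) (over (w′ j) (3 * x)) (3 * x)))))
      (sym (linear _ _ ω (3 * x)))
    g+ : ∀ x → g (suc x) ≤ g x + 3 * h x
    g+ x = ≤-trans (sum-mono (λ j → ·-mono (ω j) (≤-trans
        (+-mono-≤ (cap3 (w j)) (*-monoʳ-≤ 2 (cap3 (w′ j))))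
        (≤-reflexive (rearrange (cap (w j) (3 * x)) (over (w j) (3 * x)) (cap (w′ j) (3 * x)) (over (w′ j) (3 * x)) 3)))))
      (≤-reflexive (sym (linear _ _ ω 3)))
      where
      cap3 : ∀ v → cap v (3 * suc x) ≤ cap v (3 * x) + 3 * over v (3 * x)
      cap3 v = ≤-trans (≤-reflexive (cong (cap v) (trans (*-suc 3 x) (+-comm 3 (3 * x))))) (cap-+ v (3 * x) 3)
    uX : u (suc X) ≡ 0
    uX = sum-zero none
      where
      none : ∀ j → χ j · over (a j) (suc X) ≡ 0
      none j with suc X <ᵇ a j | <ᵇ-reflects-< (suc X) (a j)
      ... | true | ofʸ X<a = contradiction (≤-trans (n≤1+n _) X<a) (≤⇒≯ (term≤sum a j))
      ... | false | _ with χ j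
      ...   | true  = refl
      ...   | false = refl

  -- The algorithm

  data Kind : Set where
    guarded lone : Kind

  -- The argument of fresh is the elapsed time; signaled jobs keep the value that
  -- it had before the unit of processing that triggered the signal.
  data Status : Set where
    pending finished : Status
    fresh            : ℕ → Status
    signaled         : Kind → ℕ → Status

  freshLevel guardedLevel loneLevel : Status → Maybe ℕ
  freshLevel   (fresh x)            = just x
  freshLevel   _                    = nothing
  guardedLevel (signaled guarded x) = just x
  guardedLevel _                    = nothing
  loneLevel    (signaled lone x)    = just x
  loneLevel    _                    = nothing

  module _ {K : Set} where

    keepLower : K → Maybe ℕ → Maybe (K × ℕ) → Maybe (K × ℕ)
    keepLower k nothing  m              = m
    keepLower k (just x) nothing        = just (k , x)
    keepLower k (just x) (just (l , y)) = if x ≤ᵇ y then just (k , x) else just (l , y)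

    lowest : (Status → Maybe ℕ) → List (K × Status) → Maybe (K × ℕ)
    lowest level []             = nothing
    lowest level ((k , s) ∷ es) = keepLower k (level s) (lowest level es)

    _isBelow_ : ℕ → Maybe (K × ℕ) → Bool
    x isBelow nothing        = true
    x isBelow (just (_ , y)) = x <ᵇ y

    isFreshBelow : Maybe (K × ℕ) → Status → Bool
    isFreshBelow m (fresh x) = x isBelow m
    isFreshBelow m _         = false

    number : (Status → Bool) → List (K × Status) → ℕ
    number P []             = 0
    number P ((k , s) ∷ es) = P s · 1 + number P es

    -- Here `b` and `a` are the lowest lone and the lowest guarded job. A lone job below all guarded
    -- ones is one next to which no further lone job may be placed.
    active : Maybe (K × ℕ) → Maybe (K × ℕ) → Maybe K
    active nothing        a = nothing
    active (just (k , y)) a = if y isBelow a then just k else nothing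

    signaledChoice : Maybe (K × ℕ) → Maybe (K × ℕ) → Maybe (K × Kind)
    signaledChoice b a = Maybe.map (_, guarded) (active b a <∣> Maybe.map proj₁ a)

    -- Ties between a fresh and a signaled job go to the signaled one. Hence a job that emits its
    -- signal lies strictly below all signaled jobs, which keeps the values of guarded jobs
    -- distinct.
    freshChoice : Maybe (K × ℕ) → Maybe (K × ℕ) → ℕ → K → ℕ → Maybe (K × Kind)
    freshChoice b a c w x =
      if x isBelow b ∧ x isBelow a
      then (if 2 ≤ᵇ c then just (w , guarded)
                      else Maybe.map (_, lone) (active b a <∣> just w))
      else signaledChoice b a

    combine : Maybe (K × ℕ) → Maybe (K × ℕ) → ℕ → Maybe (K × ℕ) → Maybe (K × Kind)
    combine b a c nothing        = signaledChoice b a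
    combine b a c (just (w , x)) = freshChoice b a c w x

    -- The chosen job, and the kind it gets in case it emits its signal now.
    decide : List (K × Status) → Maybe (K × Kind)
    decide es = combine b a (number (isFreshBelow a) es) (lowest freshLevel es)
      where
      b = lowest loneLevel es
      a = lowest guardedLevel es

  advance : Bool → Kind → Status → Status
  advance sig κ (fresh x) = if sig then signaled κ x else fresh (suc x)
  advance sig κ s         = s

  update : (completed released signal : Bool) → Maybe Kind → Status → Status
  update true  _     _   _        s = finished
  update false true  _   _        s = fresh 0
  update false false sig nothing  s = s
  update false false sig (just κ) s = advance sig κ s

  kindFor : ∀ {K : Set} → (K → Bool) → Maybe (K × Kind) → Maybe Kind
  kindFor eq nothing        = nothing
  kindFor eq (just (w , κ)) = if eq w then just κ else nothing

  record State : Set where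
    constructor state
    field
      names  : List ℕ
      status : ℕ → Status
  open State

  entries : ∀ {K : Set} → List K → (K → Status) → List (K × Status)
  entries ks st = map (λ k → k , st k) ks

  -- Observations do not tell which job was processed, so the previous decision is recomputed from
  -- the previous state.
  step : Observation → State → State
  step (observation rs ss cs) σ = state (names σ ++ rs) λ k →
    update (does (k ∈? cs)) (does (k ∈? rs)) (does (k ∈? ss))
      (kindFor (λ w → does (w ≟ k)) (decide (entries (names σ) (status σ))))
      (status σ k)

  run : List Observation → State
  run []       = state [] (λ _ → pending)
  run (o ∷ os) = step o (run os)

  algorithm : OnlineAlgorithm
  algorithm os = Maybe.map proj₁ (decide (entries (names (run os)) (status (run os))))

  -- Equivariance under renaming of jobs

  module _ {K L : Set} (f : K → L) where

    ren : Maybe (K × ℕ) → Maybe (L × ℕ)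
    ren = Maybe.map (map₁ f)

    keepLower-ren : ∀ k l m → ren (keepLower k l m) ≡ keepLower (f k) l (ren m)
    keepLower-ren k nothing  m              = refl
    keepLower-ren k (just x) nothing        = refl
    keepLower-ren k (just x) (just (l , y)) with x ≤ᵇ y
    ... | true  = refl
    ... | false = refl

    lowest-ren : ∀ level es → lowest level (map (map₁ f) es) ≡ ren (lowest level es)
    lowest-ren level []             = refl
    lowest-ren level ((k , s) ∷ es) =
      trans (cong (keepLower (f k) (level s)) (lowest-ren level es))
            (sym (keepLower-ren k (level s) (lowest level es)))

    isBelow-ren : ∀ x m → x isBelow ren m ≡ x isBelow m
    isBelow-ren x nothing  = refl
    isBelow-ren x (just _) = refl

    number-ren : ∀ m es → number (isFreshBelow (ren m)) (map (map₁ f) es) ≡ number (isFreshBelow m) es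
    number-ren m []                         = refl
    number-ren m ((_ , pending) ∷ es)       = number-ren m es
    number-ren m ((_ , finished) ∷ es)      = number-ren m es
    number-ren m ((_ , fresh x) ∷ es)       = cong₂ (λ b c → b · 1 + c) (isBelow-ren x m) (number-ren m es)
    number-ren m ((_ , signaled _ _) ∷ es)  = number-ren m es

    active-ren : ∀ b a → active (ren b) (ren a) ≡ Maybe.map f (active b a)
    active-ren nothing        a = refl
    active-ren (just (k , y)) a rewrite isBelow-ren y a with y isBelow a
    ... | true  = refl
    ... | false = refl

    signaledChoice-ren : ∀ b a → signaledChoice (ren b) (ren a) ≡ Maybe.map (map₁ f) (signaledChoice b a)
    signaledChoice-ren b a rewrite active-ren b a = orElse-ren (active b a) a
      where
      orElse-ren : ∀ m a → Maybe.map (_, guarded) (Maybe.map f m <∣> Maybe.map proj₁ (ren a))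
                         ≡ Maybe.map (map₁ f) (Maybe.map (_, guarded) (m <∣> Maybe.map proj₁ a))
      orElse-ren (just _) _        = refl
      orElse-ren nothing  (just _) = refl
      orElse-ren nothing  nothing  = refl

    combine-ren : ∀ b a c m → combine (ren b) (ren a) c (ren m) ≡ Maybe.map (map₁ f) (combine b a c m)
    combine-ren b a c nothing = signaledChoice-ren b a
    combine-ren b a c (just (w , x)) rewrite isBelow-ren x b | isBelow-ren x a
      with x isBelow b ∧ x isBelow a | 2 ≤ᵇ c
    ... | false | _    = signaledChoice-ren b a
    ... | true  | true = refl
    ... | true  | false rewrite active-ren b a with active b a
    ...   | just _  = refl
    ...   | nothing = refl

    -- Holds for arbitrary `f`, as `decide` never compares keys. Injectivity of names matters only
    -- where a name is tested for equality or membership.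
    decide-ren : ∀ es → decide (map (map₁ f) es) ≡ Maybe.map (map₁ f) (decide es)
    decide-ren es
      rewrite lowest-ren loneLevel es | lowest-ren guardedLevel es | lowest-ren freshLevel es
            | number-ren (lowest guardedLevel es) es
      = combine-ren (lowest loneLevel es) (lowest guardedLevel es) _ (lowest freshLevel es)

  -- Specification of the chosen job

  level : Status → Maybe ℕ
  level (fresh x)      = just x
  level (signaled _ x) = just x
  level _              = nothing

  fresh⁻ : ∀ s {x} → freshLevel s ≡ just x → s ≡ fresh x
  fresh⁻ (fresh x) refl = refl

  guarded⁻ : ∀ s {x} → guardedLevel s ≡ just x → s ≡ signaled guarded x
  guarded⁻ (signaled guarded x) refl = refl

  lone⁻ : ∀ s {x} → loneLevel s ≡ just x → s ≡ signaled lone x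
  lone⁻ (signaled lone x) refl = refl

  data Lowest {K : Set} (ℓ : Status → Maybe ℕ) (st : K → Status) : Maybe (K × ℕ) → Set where
    none : (∀ k → ℓ (st k) ≡ nothing) → Lowest ℓ st nothing
    some : ∀ {k x} → ℓ (st k) ≡ just x → (∀ l {y} → ℓ (st l) ≡ just y → x ≤ y) → Lowest ℓ st (just (k , x))

  -- One constructor per reason for a choice, with the facts that the counting invariant and the
  -- windows need; `num` hides the list of entries behind the numbers it yields.
  data Choice {K : Set} (st : K → Status) (num : (Status → Bool) → ℕ) : Maybe (K × Kind) → Set where
    idle  : (∀ k {y} → level (st k) ≢ just y) → Choice st num nothing
    old   : ∀ {w κ κ′ x} → st w ≡ signaled κ′ x → (∀ k {y} → level (st k) ≡ just y → x ≤ y) →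
            Choice st num (just (w , κ))
    crowd : ∀ {w x a} → st w ≡ fresh x → (∀ k {y} → level (st k) ≡ just y → x ≤ y) →
            (∀ k {κ y} → st k ≡ signaled κ y → x < y) →
            Lowest guardedLevel st a → 2 ≤ num (isFreshBelow a) → Choice st num (just (w , guarded))
    hold  : ∀ {b y κ g x a} → st b ≡ signaled lone y → (∀ k {κ z} → st k ≡ signaled κ z → y ≤ z) →
            st g ≡ fresh x → (∀ k {z} → level (st k) ≡ just z → x ≤ z) → x < y →
            Lowest guardedLevel st a → y isBelow a ≡ true → num (isFreshBelow a) < 2 →
            Choice st num (just (b , κ))
    alone : ∀ {w x a} → st w ≡ fresh x → (∀ k {y} → level (st k) ≡ just y → x ≤ y) →
            (∀ k {κ y} → st k ≡ signaled κ y → x < y) →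
            Lowest guardedLevel st a → (∀ k {y} → st k ≡ signaled lone y → y isBelow a ≡ false) →
            Choice st num (just (w , lone))

  isBelow⇒< : ∀ {K : Set} {x y : ℕ} {k : K} → x isBelow just (k , y) ≡ true → x < y
  isBelow⇒< {x = x} {y} eq with x <ᵇ y | <ᵇ-reflects-< x y
  ... | true | ofʸ lt = lt

  notBelow⇒≥ : ∀ {K : Set} {x y : ℕ} {k : K} → x isBelow just (k , y) ≡ false → y ≤ x
  notBelow⇒≥ {x = x} {y} eq with x <ᵇ y | <ᵇ-reflects-< x y
  ... | false | ofⁿ nlt = ≮⇒≥ nlt

  <⇒isBelow : ∀ {K : Set} {x y : ℕ} {k : K} → x < y → x isBelow just (k , y) ≡ true
  <⇒isBelow {x = x} {y} lt with x <ᵇ y | <ᵇ-reflects-< x y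
  ... | true  | _        = refl
  ... | false | ofⁿ nlt = contradiction lt nlt

  belowAll : ∀ {K : Set} {ℓ} {st : K → Status} {x m} → Lowest ℓ st m → x isBelow m ≡ true →
    ∀ k {y} → ℓ (st k) ≡ just y → x < y
  belowAll (none empty) _ k eq with () ← trans (sym (empty k)) eq
  belowAll (some {k = l} _ lo) lt k eq = <-≤-trans (isBelow⇒< {k = l} lt) (lo k eq)

  module _ {K : Set} (ks : List K) (st : K → Status) (covers : ∀ k → st k ≢ pending → k ∈ ks) where

    private
      es = entries ks st

      lowest-none : ∀ ℓ ls → lowest ℓ (entries ls st) ≡ nothing → ∀ {k} → k ∈ ls → ℓ (st k) ≡ nothing
      lowest-none ℓ (l ∷ ls) eq k∈ with ℓ (st l) in eqₗ | lowest ℓ (entries ls st) in eqₘ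
      lowest-none ℓ (l ∷ ls) eq (here refl) | nothing | nothing = eqₗ
      lowest-none ℓ (l ∷ ls) eq (there k∈)  | nothing | nothing = lowest-none ℓ ls eqₘ k∈
      lowest-none ℓ (l ∷ ls) () k∈          | just x  | nothing
      lowest-none ℓ (l ∷ ls) eq k∈          | just x  | just (_ , y) with x ≤ᵇ y
      lowest-none ℓ (l ∷ ls) () k∈          | just x  | just (_ , y) | true
      lowest-none ℓ (l ∷ ls) () k∈          | just x  | just (_ , y) | false

      lowest-some : ∀ ℓ ls {w x} → lowest ℓ (entries ls st) ≡ just (w , x) →
        ℓ (st w) ≡ just x × (∀ {k} → k ∈ ls → ∀ {y} → ℓ (st k) ≡ just y → x ≤ y)
      lowest-some ℓ (l ∷ ls) eq with ℓ (st l) in eqₗ | lowest ℓ (entries ls st) in eqₘ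
      lowest-some ℓ (l ∷ ls) refl | nothing | just _ with lowest-some ℓ ls eqₘ
      ... | eqw , lo = eqw , λ { (here refl) eq → contradiction (trans (sym eqₗ) eq) λ () ; (there k∈) eq → lo k∈ eq }
      lowest-some ℓ (l ∷ ls) refl | just x | nothing =
        eqₗ , λ { (here refl) eq → ≤-reflexive (just-injective (trans (sym eqₗ) eq))
                ; (there k∈) eq → contradiction (trans (sym (lowest-none ℓ ls eqₘ k∈)) eq) λ () }
      lowest-some ℓ (l ∷ ls) eq | just x | just (v , y) with lowest-some ℓ ls eqₘ | x ≤ᵇ y | ≤ᵇ-reflects-≤ x y
      lowest-some ℓ (l ∷ ls) refl | just x | just (v , y) | eqv , lo | true | ofʸ x≤y =
        eqₗ , λ { (here refl) eq → ≤-reflexive (just-injective (trans (sym eqₗ) eq))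
                ; (there k∈) eq → ≤-trans x≤y (lo k∈ eq) }
      lowest-some ℓ (l ∷ ls) refl | just x | just (v , y) | eqv , lo | false | ofⁿ x≰y =
        eqv , λ { (here refl) eq → ≤-trans (<⇒≤ (≰⇒> x≰y)) (≤-reflexive (just-injective (trans (sym eqₗ) eq)))
                ; (there k∈) eq → lo k∈ eq }

      -- Keys missing from the list are pending and have no level, so a minimum over the list is one
      -- over all keys.
      lowest-spec : ∀ ℓ → ℓ pending ≡ nothing → Lowest ℓ st (lowest ℓ es)
      lowest-spec ℓ ℓp with lowest ℓ es in eq
      ... | just _  with lowest-some ℓ ks eq
      ...   | eqw , lo = some eqw λ l eqₗ → lo (inside l eqₗ) eqₗ
        where
        inside : ∀ l {y} → ℓ (st l) ≡ just y → l ∈ ks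
        inside l eqₗ = covers l λ p → contradiction (trans (sym eqₗ) (trans (cong ℓ p) ℓp)) λ ()
      lowest-spec ℓ ℓp | nothing = none out
        where
        out : ∀ k → ℓ (st k) ≡ nothing
        out k with ℓ (st k) in eqₖ
        ... | nothing = refl
        ... | just _  = trans (sym eqₖ) (lowest-none ℓ ks eq
                          (covers k λ p → contradiction (trans (sym eqₖ) (trans (cong ℓ p) ℓp)) λ ()))

      byKind : (P : ℕ → Set) →
        (∀ k {y} → freshLevel (st k) ≡ just y → P y) →
        (∀ k {y} → loneLevel (st k) ≡ just y → P y) →
        (∀ k {y} → guardedLevel (st k) ≡ just y → P y) →
        ∀ k {y} → level (st k) ≡ just y → P y
      byKind P f b a k eq with st k | f k | b k | a k
      byKind P f b a k refl | fresh x            | fk | _  | _  = fk refl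
      byKind P f b a k refl | signaled lone x    | _  | bk | _  = bk refl
      byKind P f b a k refl | signaled guarded x | _  | _  | ak = ak refl

      bySignal : (P : ℕ → Set) →
        (∀ k {y} → loneLevel (st k) ≡ just y → P y) →
        (∀ k {y} → guardedLevel (st k) ≡ just y → P y) →
        ∀ k {κ y} → st k ≡ signaled κ y → P y
      bySignal P b a k {lone}    eq = b k (cong loneLevel eq)
      bySignal P b a k {guarded} eq = a k (cong guardedLevel eq)

      num : (Status → Bool) → ℕ
      num P = number P es

      signaledChoice-spec : ∀ b a → Lowest loneLevel st b → Lowest guardedLevel st a →
        (∀ k {x} → freshLevel (st k) ≡ just x → x isBelow b ∧ x isBelow a ≡ false) →
        Choice st num (signaledChoice b a)
      signaledChoice-spec nothing nothing (none nb) (none na) nf =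
        idle λ k eq → byKind (λ _ → _) (λ k eq → contradiction (nf k eq) λ ())
          (λ k eq → contradiction (trans (sym (nb k)) eq) λ ()) (λ k eq → contradiction (trans (sym (na k)) eq) λ ()) k eq
      signaledChoice-spec nothing (just (w , z)) (none nb) (some eqw lo) nf =
        old (guarded⁻ (st w) eqw) (byKind (z ≤_) (λ k eq → notBelow⇒≥ {k = w} (nf k eq))
          (λ k eq → contradiction (trans (sym (nb k)) eq) λ ()) lo)
      signaledChoice-spec (just (w , y)) nothing (some eqw lo) (none na) nf =
        old (lone⁻ (st w) eqw) (byKind (y ≤_) (λ k {x} eq → notBelow⇒≥ {k = w} (left x (nf k eq)))
          lo (λ k eq → contradiction (trans (sym (na k)) eq) λ ()))
        where
        left : ∀ x → (x <ᵇ y) ∧ true ≡ false → (x <ᵇ y) ≡ false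
        left x eq with x <ᵇ y
        ... | false = refl
      signaledChoice-spec (just (w , y)) (just (u , z)) (some eqw lo) (some equ lou) nf
        with y <ᵇ z | <ᵇ-reflects-< y z
      ... | true | ofʸ y<z = old (lone⁻ (st w) eqw) (byKind (y ≤_) (λ k {x} eq → le x (nf k eq))
              lo (λ k eq → ≤-trans (<⇒≤ y<z) (lou k eq)))
        where
        le : ∀ x → (x <ᵇ y) ∧ (x <ᵇ z) ≡ false → y ≤ x
        le x eq with x <ᵇ y | <ᵇ-reflects-< x y | x <ᵇ z | <ᵇ-reflects-< x z
        ... | false | ofⁿ nlt | _ | _ = ≮⇒≥ nlt
        ... | true | ofʸ lt | false | ofⁿ nlt = contradiction (<-trans lt y<z) nlt
      ... | false | ofⁿ y≮z = old (guarded⁻ (st u) equ) (byKind (z ≤_) (λ k {x} eq → le x (nf k eq))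
              (λ k eq → ≤-trans (≮⇒≥ y≮z) (lo k eq)) lou)
        where
        le : ∀ x → (x <ᵇ y) ∧ (x <ᵇ z) ≡ false → z ≤ x
        le x eq with x <ᵇ y | <ᵇ-reflects-< x y | x <ᵇ z | <ᵇ-reflects-< x z
        ... | _ | _ | false | ofⁿ nlt = ≮⇒≥ nlt
        ... | false | ofⁿ nlt | true | ofʸ lt = contradiction (<-≤-trans lt (≮⇒≥ y≮z)) nlt

      still : ∀ (a : Maybe (K × ℕ)) {y z} → y isBelow a ≡ false → y ≤ z → z isBelow a ≡ false
      still (just (u , t)) {y} {z} y≮a y≤z with z <ᵇ t | <ᵇ-reflects-< z t
      ... | true  | ofʸ z<t = contradiction (trans (sym y≮a) (<⇒isBelow {k = u} (≤-<-trans y≤z z<t))) λ ()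
      ... | false | _       = refl

      minimal-spec : ∀ b a w x → Lowest loneLevel st b → Lowest guardedLevel st a →
        freshLevel (st w) ≡ just x → (∀ k {y} → freshLevel (st k) ≡ just y → x ≤ y) →
        x isBelow b ≡ true → x isBelow a ≡ true →
        Choice st num (if 2 ≤ᵇ num (isFreshBelow a) then just (w , guarded)
                       else Maybe.map (_, lone) (active b a <∣> just w))
      minimal-spec b a w x lb la eqw lo x<b x<a
        with 2 ≤ᵇ num (isFreshBelow a) | ≤ᵇ-reflects-≤ 2 (num (isFreshBelow a))
      ... | true  | ofʸ two = crowd (fresh⁻ (st w) eqw)
        (byKind (x ≤_) lo (λ k eq → <⇒≤ (belowAll lb x<b k eq)) (λ k eq → <⇒≤ (belowAll la x<a k eq)))
        (bySignal (x <_) (belowAll lb x<b) (belowAll la x<a)) la two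
      ... | false | ofⁿ one = rest b lb x<b
        where
        minimal : ∀ b → Lowest loneLevel st b → x isBelow b ≡ true → ∀ k {y} → level (st k) ≡ just y → x ≤ y
        minimal b lb x<b = byKind (x ≤_) lo (λ k eq → <⇒≤ (belowAll lb x<b k eq)) (λ k eq → <⇒≤ (belowAll la x<a k eq))
        rest : ∀ b → Lowest loneLevel st b → x isBelow b ≡ true →
          Choice st num (Maybe.map (_, lone) (active b a <∣> just w))
        rest nothing (none nb) x<b = alone (fresh⁻ (st w) eqw) (minimal nothing (none nb) x<b)
          (bySignal (x <_) (λ k eq → contradiction (trans (sym (nb k)) eq) λ ()) (belowAll la x<a)) la
          λ k eq → contradiction (trans (sym (nb k)) (cong loneLevel eq)) λ ()
        rest (just (v , y)) lb@(some eqv lov) x<b with y isBelow a in y<a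
        ... | true  = hold (lone⁻ (st v) eqv) (bySignal (y ≤_) lov (λ k eq → <⇒≤ (belowAll la y<a k eq)))
          (fresh⁻ (st w) eqw) (minimal (just (v , y)) lb x<b) (isBelow⇒< {k = v} x<b) la y<a (≰⇒> one)
        ... | false = alone (fresh⁻ (st w) eqw) (minimal (just (v , y)) lb x<b)
          (bySignal (x <_) (belowAll lb x<b) (belowAll la x<a)) la
          λ k eq → still a y<a (lov k (cong loneLevel eq))

      combine-spec : ∀ b a f → Lowest loneLevel st b → Lowest guardedLevel st a → Lowest freshLevel st f →
        Choice st num (combine b a (num (isFreshBelow a)) f)
      combine-spec b a nothing lb la (none nf) =
        signaledChoice-spec b a lb la λ k eq → contradiction (trans (sym (nf k)) eq) λ ()
      combine-spec b a (just (w , x)) lb la (some eqw lo)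
        with x isBelow b in x<b | x isBelow a in x<a
      ... | true | false = signaledChoice-spec b a lb la λ k {y} eq → lift b a y (lo k eq) x<a
        where
        lift : ∀ b a y → x ≤ y → x isBelow a ≡ false → y isBelow b ∧ y isBelow a ≡ false
        lift b (just (u , z)) y x≤y x≮a with y <ᵇ z | <ᵇ-reflects-< y z | y isBelow b
        ... | true  | ofʸ y<z | _     = contradiction (trans (sym x≮a) (<⇒isBelow {k = u} (≤-<-trans x≤y y<z))) λ ()
        ... | false | _       | true  = refl
        ... | false | _       | false = refl
      ... | false | _ = signaledChoice-spec b a lb la λ k {y} eq → lift b a y (lo k eq) x<b
        where
        lift : ∀ b a y → x ≤ y → x isBelow b ≡ false → y isBelow b ∧ y isBelow a ≡ false
        lift (just (u , z)) a y x≤y x≮b with y <ᵇ z | <ᵇ-reflects-< y z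
        ... | true  | ofʸ y<z = contradiction (trans (sym x≮b) (<⇒isBelow {k = u} (≤-<-trans x≤y y<z))) λ ()
        ... | false | _       = refl
      ... | true | true = minimal-spec b a w x lb la eqw lo x<b x<a

    decide-spec : Choice st (λ P → number P (entries ks st)) (decide (entries ks st))
    decide-spec = combine-spec _ _ _ (lowest-spec loneLevel refl) (lowest-spec guardedLevel refl) (lowest-spec freshLevel refl)

  classify : (unreleased unsignaled unfinished : Bool) → ℕ → Kind → ℕ → Status
  classify true  _     _     e κ x = pending
  classify false true  _     e κ x = fresh e
  classify false false true  e κ x = signaled κ x
  classify false false false e κ x = finished

  <⇒<ᵇ≡ : ∀ {x y} → x < y → (x <ᵇ y) ≡ true
  <⇒<ᵇ≡ {x} {y} lt = dec-true (x <? y) lt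

  ≥⇒<ᵇ≡ : ∀ {x y} → y ≤ x → (x <ᵇ y) ≡ false
  ≥⇒<ᵇ≡ {x} {y} ge = dec-false (x <? y) (≤⇒≯ ge)

  number-++ : ∀ {K : Set} P (es fs : List (K × Status)) → number P (es ++ fs) ≡ number P es + number P fs
  number-++ P []       fs = refl
  number-++ P ((_ , s) ∷ es) fs = trans (cong (P s · 1 +_) (number-++ P es fs)) (sym (+-assoc (P s · 1) _ _))

  number-filter : ∀ {K : Set} P (g : K → Status) {Q : Pred K 0ℓ} (Q? : Decidable Q) {n} (f : Fin n → K) →
    number P (entries (filter Q? (tabulate f)) g) ≡ sum (λ i → does (Q? (f i)) · (P (g (f i)) · 1))
  number-filter P g Q? {zero}  f = refl
  number-filter P g Q? {suc n} f with does (Q? (f zero))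
  ... | true  = cong (P (g (f zero)) · 1 +_) (number-filter P g Q? (f ∘ suc))
  ... | false = number-filter P g Q? (f ∘ suc)

  elapsed-suc : ∀ I T j t → Instance.elapsed I T j (suc t) ≡ is (T t) j · 1 + Instance.elapsed I T j t
  elapsed-suc I T j t with does (≡-dec Fin._≟_ (T t) (just j))
  ... | true  = refl
  ... | false = refl

  -- The run of the algorithm

  module Run (I : Instance) (q≥1 : ∀ j → 1 ≤ Instance.q I j) (q<p : ∀ j → Instance.q I j < Instance.p I j) where
    open Instance I

    keys : ℕ → List Job
    keys zero    = filter (λ j → r j ≟ zero) (allFin n)
    keys (suc t) = keys t ++ filter (λ j → r j ≟ suc t) (allFin n)

    mutual
      e : ℕ → Job → ℕ
      e zero    j = 0
      e (suc t) j = is (S t) j · 1 + e t j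

      -- Overwritten at every unit processed before the signal, and constant afterwards; what
      -- remains is the kind proposed for the unit that triggers the signal.
      kind : ℕ → Job → Kind
      kind zero    j = lone
      kind (suc t) j = if e t j <ᵇ q j then fromMaybe (kind t j) (kindFor (λ w → does (w Fin.≟ j)) (choice t)) else kind t j

      -- A closed form in terms of elapsed time and thresholds, which makes the inequalities behind
      -- each status available at once; `status-suc` shows that it obeys the algorithm's `update`.
      st : ℕ → Job → Status
      st t j = classify (t <ᵇ r j) (e t j <ᵇ q j) (e t j <ᵇ p j) (e t j) (kind t j) (q j ∸ 1)

      choice : ℕ → Maybe (Job × Kind)
      choice t = decide (entries (keys t) (st t))

      S : Schedule
      S t = Maybe.map proj₁ (choice t)

    newKind : ℕ → Job → Maybe Kind
    newKind t j = kindFor (λ w → does (w Fin.≟ j)) (choice t)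

    elapsed≡e : ∀ j t → elapsed S j t ≡ e t j
    elapsed≡e j zero    = refl
    elapsed≡e j (suc t) = trans (elapsed-suc I S j t) (cong (is (S t) j · 1 +_) (elapsed≡e j t))

    data Stage (t : ℕ) (j : Job) : Status → Set where
      pending  : t < r j → Stage t j pending
      fresh    : r j ≤ t → e t j < q j → Stage t j (fresh (e t j))
      signaled : r j ≤ t → q j ≤ e t j → e t j < p j → Stage t j (signaled (kind t j) (q j ∸ 1))
      finished : r j ≤ t → p j ≤ e t j → Stage t j finished

    stage : ∀ t j → Stage t j (st t j)
    stage t j with t <ᵇ r j | <ᵇ-reflects-< t (r j) | e t j <ᵇ q j | <ᵇ-reflects-< (e t j) (q j)
                  | e t j <ᵇ p j | <ᵇ-reflects-< (e t j) (p j)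
    ... | true  | ofʸ t<r | _     | _       | _     | _       = pending t<r
    ... | false | ofⁿ t≮r | true  | ofʸ e<q | _     | _       = fresh (≮⇒≥ t≮r) e<q
    ... | false | ofⁿ t≮r | false | ofⁿ e≮q | true  | ofʸ e<p = signaled (≮⇒≥ t≮r) (≮⇒≥ e≮q) e<p
    ... | false | ofⁿ t≮r | false | _       | false | ofⁿ e≮p = finished (≮⇒≥ t≮r) (≮⇒≥ e≮p)

    st-pending : ∀ {t j} → t < r j → st t j ≡ pending
    st-pending t<r rewrite <⇒<ᵇ≡ t<r = refl

    st-fresh : ∀ {t j} → r j ≤ t → e t j < q j → st t j ≡ fresh (e t j)
    st-fresh r≤t e<q rewrite ≥⇒<ᵇ≡ r≤t | <⇒<ᵇ≡ e<q = refl

    st-signaled : ∀ {t j} → r j ≤ t → q j ≤ e t j → e t j < p j → st t j ≡ signaled (kind t j) (q j ∸ 1)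
    st-signaled r≤t q≤e e<p rewrite ≥⇒<ᵇ≡ r≤t | ≥⇒<ᵇ≡ q≤e | <⇒<ᵇ≡ e<p = refl

    st-finished : ∀ {t j} → r j ≤ t → p j ≤ e t j → st t j ≡ finished
    st-finished {t} {j} r≤t p≤e
      rewrite ≥⇒<ᵇ≡ r≤t | ≥⇒<ᵇ≡ (≤-trans (<⇒≤ (q<p j)) p≤e) | ≥⇒<ᵇ≡ p≤e = refl

    keys-complete : ∀ t {j} → r j ≤ t → j ∈ keys t
    keys-complete zero    {j} r≤t = ∈-filter⁺ (λ j → r j ≟ zero) (∈-allFin j) (n≤0⇒n≡0 r≤t)
    keys-complete (suc t) {j} r≤t with m≤n⇒m<n∨m≡n r≤t
    ... | inj₁ (s≤s r≤t) = ∈-++⁺ˡ (keys-complete t r≤t)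
    ... | inj₂ r≡t       = ∈-++⁺ʳ (keys t) (∈-filter⁺ (λ j → r j ≟ suc t) (∈-allFin j) r≡t)

    number-keys : ∀ P g t → number P (entries (keys t) g) ≡ sum (λ j → (r j ≤ᵇ t) · (P (g j) · 1))
    number-keys P g zero = trans (number-filter P g (λ j → r j ≟ zero) id) (sum-cong-≗ same)
      where
      same : ∀ j → does (r j ≟ zero) · (P (g j) · 1) ≡ (r j ≤ᵇ zero) · (P (g j) · 1)
      same j with r j
      ... | zero  = refl
      ... | suc _ = refl
    number-keys P g (suc t) = begin
      number P (map _ (keys t ++ new))                                   ≡⟨ cong (number P) (map-++ _ (keys t) new) ⟩
      number P (entries (keys t) g ++ entries new g)                     ≡⟨ number-++ P (entries (keys t) g) (entries new g) ⟩
      number P (entries (keys t) g) + number P (entries new g)           ≡⟨ cong₂ _+_ (number-keys P g t) (number-filter P g (λ j → r j ≟ suc t) id) ⟩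
      sum (λ j → (r j ≤ᵇ t) · x j) + sum (λ j → does (r j ≟ suc t) · x j) ≡⟨ ∑-distrib-+ (λ j → (r j ≤ᵇ t) · x j) (λ j → does (r j ≟ suc t) · x j) ⟨
      sum (λ j → (r j ≤ᵇ t) · x j + does (r j ≟ suc t) · x j)            ≡⟨ sum-cong-≗ same ⟩
      sum (λ j → (r j ≤ᵇ suc t) · x j)                                   ∎
      where
      open ≡-Reasoning
      new = filter (λ j → r j ≟ suc t) (allFin n)
      x : Job → ℕ
      x j = P (g j) · 1
      same : ∀ j → (r j ≤ᵇ t) · x j + does (r j ≟ suc t) · x j ≡ (r j ≤ᵇ suc t) · x j
      same j with <-cmp (r j) (suc t)
      ... | tri< (s≤s r≤t) r≢ _ rewrite dec-true (r j ≤? t) r≤t | dec-false (r j ≟ suc t) r≢ | dec-true (r j ≤? suc t) (m≤n⇒m≤1+n r≤t) = +-identityʳ (x j)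
      ... | tri≈ r≮ r≡ _ rewrite dec-false (r j ≤? t) (r≮ ∘ s≤s) | dec-true (r j ≟ suc t) r≡ | dec-true (r j ≤? suc t) (≤-reflexive r≡) = refl
      ... | tri> r≮ r≢ r> rewrite dec-false (r j ≤? t) (r≮ ∘ s≤s) | dec-false (r j ≟ suc t) r≢ | dec-false (r j ≤? suc t) (<⇒≱ r>) = refl

    count : ℕ → (Status → Bool) → ℕ
    count t P = sum (λ j → P (st t j) · 1)

    number≡count : ∀ t P → P pending ≡ false → number P (entries (keys t) (st t)) ≡ count t P
    number≡count t P Pp = trans (number-keys P (st t) t) (sum-cong-≗ same)
      where
      same : ∀ j → (r j ≤ᵇ t) · (P (st t j) · 1) ≡ P (st t j) · 1
      same j with r j ≤? t
      ... | yes r≤t rewrite dec-true (r j ≤? t) r≤t = refl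
      ... | no r≰t rewrite dec-false (r j ≤? t) r≰t | st-pending (≰⇒> r≰t) | Pp = refl

    choice-spec : ∀ t → Choice (st t) (λ P → number P (entries (keys t) (st t))) (choice t)
    choice-spec t = decide-spec (keys t) (st t) covers
      where
      covers : ∀ j → st t j ≢ pending → j ∈ keys t
      covers j np with r j ≤? t
      ... | yes r≤t = keys-complete t r≤t
      ... | no r≰t  = contradiction (st-pending (≰⇒> r≰t)) np

    Alive : ℕ → Job → Set
    Alive t j = r j ≤ t × e t j < p j

    level⇒alive : ∀ {t j x} → level (st t j) ≡ just x → Alive t j
    level⇒alive {t} {j} eq with st t j | stage t j
    ... | _ | fresh r≤t e<q        = r≤t , <-trans e<q (q<p j)
    ... | _ | signaled r≤t q≤e e<p = r≤t , e<p

    chosen-alive : ∀ t {w κ} → choice t ≡ just (w , κ) → Alive t w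
    chosen-alive t eq with choice t | choice-spec t
    chosen-alive t refl | _ | old st≡ _               = level⇒alive (cong level st≡)
    chosen-alive t refl | _ | crowd st≡ _ _ _ _       = level⇒alive (cong level st≡)
    chosen-alive t refl | _ | hold st≡ _ _ _ _ _ _ _  = level⇒alive (cong level st≡)
    chosen-alive t refl | _ | alone st≡ _ _ _ _       = level⇒alive (cong level st≡)

    data Work (t : ℕ) (j : Job) : Maybe Kind → Set where
      rests : e (suc t) j ≡ e t j → kind (suc t) j ≡ kind t j → Work t j nothing
      works : ∀ κ → Alive t j → e (suc t) j ≡ suc (e t j) →
              (e t j < q j → kind (suc t) j ≡ κ) → (q j ≤ e t j → kind (suc t) j ≡ kind t j) → Work t j (just κ)

    if-same : ∀ {A : Set} b {x : A} → (if b then x else x) ≡ x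
    if-same true  = refl
    if-same false = refl

    work : ∀ t j → Work t j (newKind t j)
    work t j = byChoice (choice t) refl
      where
      forKind : Maybe (Job × Kind) → Maybe Kind
      forKind = kindFor (λ w → does (w Fin.≟ j))
      byChoice : ∀ m → choice t ≡ m → Work t j (forKind m)
      byChoice nothing eq = rests
        (cong (λ m → is (Maybe.map proj₁ m) j · 1 + e t j) eq)
        (trans (cong (λ m → if e t j <ᵇ q j then fromMaybe (kind t j) (forKind m) else kind t j) eq) (if-same (e t j <ᵇ q j)))
      byChoice (just (w , κ)) eq with cong (λ m → is (Maybe.map proj₁ m) j · 1 + e t j) eq
                                    | cong (λ m → if e t j <ᵇ q j then fromMaybe (kind t j) (forKind m) else kind t j) eq
                                    | w Fin.≟ j
      ... | eqₑ | eqₖ | no w≢j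
        rewrite dec-false (w Fin.≟ j) w≢j = rests eqₑ (trans eqₖ (if-same (e t j <ᵇ q j)))
      ... | eqₑ | eqₖ | yes refl rewrite dec-true (w Fin.≟ w) refl =
        works κ (chosen-alive t eq) eqₑ
          (λ e<q → trans eqₖ (cong (λ b → if b then κ else kind t w) (<⇒<ᵇ≡ e<q)))
          (λ q≤e → trans eqₖ (cong (λ b → if b then κ else kind t w) (≥⇒<ᵇ≡ q≤e)))

    e-mono : ∀ t j → e t j ≤ e (suc t) j
    e-mono t j = m≤n+m _ _

    e-mono-≤ : ∀ {s t} j → s ≤ t → e s j ≤ e t j
    e-mono-≤ {t = zero}  j z≤n = ≤-refl
    e-mono-≤ {t = suc t} j s≤t with m≤n⇒m<n∨m≡n s≤t
    ... | inj₁ (s≤s s≤t) = ≤-trans (e-mono-≤ j s≤t) (e-mono t j)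
    ... | inj₂ refl      = ≤-refl

    e≤p : ∀ t j → e t j ≤ p j
    e≤p zero    j = z≤n
    e≤p (suc t) j with newKind t j | work t j
    ... | _ | rests eq _                 = ≤-trans (≤-reflexive eq) (e≤p t j)
    ... | _ | works _ (_ , e<p) eq _ _   = ≤-trans (≤-reflexive eq) e<p

    e-unreleased : ∀ t j → t ≤ r j → e t j ≡ 0
    e-unreleased zero    j _   = refl
    e-unreleased (suc t) j t<r with newKind t j | work t j
    ... | _ | rests eq _               = trans eq (e-unreleased t j (<⇒≤ t<r))
    ... | _ | works _ (r≤t , _) _ _ _  = contradiction r≤t (<⇒≱ t<r)

    feasible : Feasible S
    feasible t j eq with choice t in eqc
    feasible t j refl | just (_ , κ) with chosen-alive t eqc
    ... | r≤t , e<p = r≤t , λ done → <⇒≱ e<p (≤-trans (m∸n≡0⇒m≤n done) (≤-reflexive (elapsed≡e j t)))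

    completed? : Job → ℕ → Bool
    completed? j t = does (firstTime? (λ s → remaining S j s ≟ 0) t)

    signals? : Job → ℕ → Bool
    signals? j t = does (firstTime? (λ s → elapsed S j s ≟ q j) t)

    not-completed : ∀ j t → e t j < p j → completed? j t ≡ false
    not-completed j t e<p = dec-false (firstTime? (λ s → remaining S j s ≟ 0) t)
      λ { (done , _) → <⇒≱ e<p (≤-trans (m∸n≡0⇒m≤n done) (≤-reflexive (elapsed≡e j t))) }

    not-again : ∀ j t → p j ≤ e t j → completed? j (suc t) ≡ false
    not-again j t p≤e = dec-false (firstTime? (λ s → remaining S j s ≟ 0) (suc t))
      λ { (_ , earlier) → earlier (n<1+n t) (m≤n⇒m∸n≡0 (≤-trans p≤e (≤-reflexive (sym (elapsed≡e j t))))) }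

    completed-now : ∀ j t → e t j < p j → p j ≤ e (suc t) j → completed? j (suc t) ≡ true
    completed-now j t e<p p≤e = dec-true (firstTime? (λ s → remaining S j s ≟ 0) (suc t))
      (m≤n⇒m∸n≡0 (≤-trans p≤e (≤-reflexive (sym (elapsed≡e j (suc t))))) ,
       λ { {s} (s≤s s≤t) done → <⇒≱ e<p (≤-trans (m∸n≡0⇒m≤n done) (≤-trans (≤-reflexive (elapsed≡e j s)) (e-mono-≤ j s≤t))) })

    no-signal : ∀ j t → e t j < q j → signals? j t ≡ false
    no-signal j t e<q = dec-false (firstTime? (λ s → elapsed S j s ≟ q j) t)
      λ { (eq , _) → <⇒≢ e<q (trans (sym (elapsed≡e j t)) eq) }

    signal-now : ∀ j t → e t j < q j → e (suc t) j ≡ q j → signals? j (suc t) ≡ true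
    signal-now j t e<q eq = dec-true (firstTime? (λ s → elapsed S j s ≟ q j) (suc t))
      (trans (elapsed≡e j (suc t)) eq ,
       λ { {s} (s≤s s≤t) same → <⇒≱ e<q (≤-trans (≤-reflexive (trans (sym same) (elapsed≡e j s))) (e-mono-≤ j s≤t)) })

    update-cong : ∀ {c c′ b b′ s s′} κ x → c ≡ c′ → b ≡ b′ → s ≡ s′ → update c b s κ x ≡ update c′ b′ s′ κ x
    update-cong κ x refl refl refl = refl

    status-next : ∀ t j {s m} → Stage t j s → Work t j m → st (suc t) j ≡
      update (completed? j (suc t)) (does (r j ≟ suc t)) (signals? j (suc t)) m s
    status-next t j (pending t<r) (works _ (r≤t , _) _ _ _) = contradiction r≤t (<⇒≱ t<r)
    status-next t j (pending t<r) (rests eq _) = byRelease (r j ≟ suc t)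
      where
      e≡0 = e-unreleased (suc t) j t<r
      byRelease : Dec (r j ≡ suc t) → st (suc t) j ≡
        update (completed? j (suc t)) (does (r j ≟ suc t)) (signals? j (suc t)) nothing pending
      byRelease (yes r≡) = trans
        (trans (st-fresh (≤-reflexive r≡) (≤-<-trans (≤-reflexive e≡0) (q≥1 j))) (cong fresh e≡0))
        (sym (update-cong nothing pending (not-completed j (suc t) (≤-<-trans (≤-reflexive e≡0) (p≥1 j))) (dec-true (r j ≟ suc t) r≡) refl))
      byRelease (no r≢) = trans (st-pending (≤∧≢⇒< t<r (r≢ ∘ sym)))
        (sym (update-cong nothing pending (not-completed j (suc t) (≤-<-trans (≤-reflexive e≡0) (p≥1 j))) (dec-false (r j ≟ suc t) r≢) refl))
    status-next t j (fresh r≤t e<q) (rests eq _) =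
      trans (trans (st-fresh (m≤n⇒m≤1+n r≤t) (≤-<-trans (≤-reflexive eq) e<q)) (cong fresh eq))
        (sym (update-cong nothing (fresh (e t j)) (not-completed j (suc t) (≤-<-trans (≤-reflexive eq) (<-trans e<q (q<p j))))
          (dec-false (r j ≟ suc t) (<⇒≢ (s≤s r≤t))) refl))
    status-next t j (fresh r≤t e<q) (works κ _ eq kq _) = bySignal (m≤n⇒m<n∨m≡n e<q)
      where
      -- Since `q j < p j`, the unit that triggers the signal cannot complete the job as well.
      unfinished = not-completed j (suc t) (≤-<-trans (≤-reflexive eq) (≤-<-trans e<q (q<p j)))
      released = dec-false (r j ≟ suc t) (<⇒≢ (s≤s r≤t))
      bySignal : suc (e t j) < q j ⊎ suc (e t j) ≡ q j → st (suc t) j ≡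
        update (completed? j (suc t)) (does (r j ≟ suc t)) (signals? j (suc t)) (just κ) (fresh (e t j))
      bySignal (inj₁ e+1<q) =
        trans (trans (st-fresh (m≤n⇒m≤1+n r≤t) (≤-<-trans (≤-reflexive eq) e+1<q)) (cong fresh eq))
          (sym (update-cong (just κ) (fresh (e t j)) unfinished released (no-signal j (suc t) (≤-<-trans (≤-reflexive eq) e+1<q))))
      bySignal (inj₂ e+1≡q) =
        trans (trans (st-signaled (m≤n⇒m≤1+n r≤t) (≤-reflexive (sym (trans eq e+1≡q)))
                        (≤-<-trans (≤-reflexive (trans eq e+1≡q)) (q<p j)))
                     (cong₂ signaled (kq e<q) (sym (cong (_∸ 1) e+1≡q))))
          (sym (update-cong (just κ) (fresh (e t j)) unfinished released (signal-now j t e<q (trans eq e+1≡q))))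
    status-next t j (signaled r≤t q≤e e<p) (rests eq kq) =
      trans (trans (st-signaled (m≤n⇒m≤1+n r≤t) (≤-trans q≤e (≤-reflexive (sym eq))) (≤-<-trans (≤-reflexive eq) e<p))
                   (cong (λ κ → signaled κ (q j ∸ 1)) kq))
        (sym (update-cong nothing (signaled (kind t j) (q j ∸ 1)) (not-completed j (suc t) (≤-<-trans (≤-reflexive eq) e<p))
          (dec-false (r j ≟ suc t) (<⇒≢ (s≤s r≤t))) refl))
    status-next t j (signaled r≤t q≤e e<p) (works κ _ eq _ kq) = byCompletion (m≤n⇒m<n∨m≡n e<p)
      where
      byCompletion : suc (e t j) < p j ⊎ suc (e t j) ≡ p j → st (suc t) j ≡
        update (completed? j (suc t)) (does (r j ≟ suc t)) (signals? j (suc t)) (just κ) (signaled (kind t j) (q j ∸ 1))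
      byCompletion (inj₁ e+1<p) =
        trans (trans (st-signaled (m≤n⇒m≤1+n r≤t) (≤-trans q≤e (e-mono t j)) (≤-<-trans (≤-reflexive eq) e+1<p))
                     (cong (λ κ → signaled κ (q j ∸ 1)) (kq q≤e)))
          (sym (update-cong (just κ) (signaled (kind t j) (q j ∸ 1)) (not-completed j (suc t) (≤-<-trans (≤-reflexive eq) e+1<p))
            (dec-false (r j ≟ suc t) (<⇒≢ (s≤s r≤t))) refl))
      byCompletion (inj₂ e+1≡p) =
        trans (st-finished (m≤n⇒m≤1+n r≤t) (≤-reflexive (sym (trans eq e+1≡p))))
          (sym (update-cong (just κ) (signaled (kind t j) (q j ∸ 1)) (completed-now j t e<p (≤-reflexive (sym (trans eq e+1≡p)))) refl refl))
    status-next t j (finished r≤t p≤e) (works _ (_ , e<p) _ _ _) = contradiction e<p (≤⇒≯ p≤e)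
    status-next t j (finished r≤t p≤e) (rests eq _) =
      trans (st-finished (m≤n⇒m≤1+n r≤t) (≤-trans p≤e (e-mono t j)))
        (sym (update-cong nothing finished (not-again j t p≤e) (dec-false (r j ≟ suc t) (<⇒≢ (s≤s r≤t))) refl))

    status-suc : ∀ t j → st (suc t) j ≡
      update (completed? j (suc t)) (does (r j ≟ suc t)) (signals? j (suc t)) (newKind t j) (st t j)
    status-suc t j = status-next t j (stage t j) (work t j)

    module _ (name : Job ↣ ℕ) where
      open Online I name
      open Injection name using (to; injective)
      open State using (names; status)

      does-≟ : ∀ w j → does (to w ≟ to j) ≡ does (w Fin.≟ j)
      does-≟ w j = byDec (w Fin.≟ j)
        where
        byDec : Dec (w ≡ j) → does (to w ≟ to j) ≡ does (w Fin.≟ j)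
        byDec (yes w≡j) = trans (dec-true (to w ≟ to j) (cong to w≡j)) (sym (dec-true (w Fin.≟ j) w≡j))
        byDec (no w≢j)  = trans (dec-false (to w ≟ to j) (w≢j ∘ injective)) (sym (dec-false (w Fin.≟ j) w≢j))

      does-∈? : ∀ {P : Pred Job 0ℓ} (P? : Decidable P) j → does (to j ∈? namesOf P?) ≡ does (P? j)
      does-∈? {P} P? j = byDec (P? j)
        where
        absent : ¬ P j → ¬ to j ∈ namesOf P?
        absent ¬Pj j∈ with ∈-map⁻ to j∈
        ... | i , i∈ , eq with injective eq
        ...   | refl = ¬Pj (proj₂ (∈-filter⁻ P? {xs = allFin n} i∈))
        byDec : Dec (P j) → does (to j ∈? namesOf P?) ≡ does (P? j)
        byDec (yes Pj) = trans (dec-true (to j ∈? namesOf P?) (∈-map⁺ to (∈-filter⁺ P? (∈-allFin j) Pj))) (sym (dec-true (P? j) Pj))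
        byDec (no ¬Pj) = trans (dec-false (to j ∈? namesOf P?) (absent ¬Pj)) (sym (dec-false (P? j) ¬Pj))

      kindFor-to : ∀ j m → kindFor (λ w → does (w ≟ to j)) (Maybe.map (map₁ to) m) ≡ kindFor (λ w → does (w Fin.≟ j)) m
      kindFor-to j nothing        = refl
      kindFor-to j (just (w , κ)) = cong (λ b → if b then just κ else nothing) (does-≟ w j)

      entries-to : ∀ ks {st′ : ℕ → Status} {st : Job → Status} → (∀ j → st′ (to j) ≡ st j) →
        entries (map to ks) st′ ≡ map (map₁ to) (entries ks st)
      entries-to []       eq = refl
      entries-to (k ∷ ks) eq = cong₂ _∷_ (cong (to k ,_) (eq k)) (entries-to ks eq)

      σ : ℕ → State
      σ t = run (applyDownFrom (observe S) (suc t))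

      mutual
        -- An equality of lists, order included: among jobs of equal value the choice depends on the
        -- order of the entries.
        names-σ : ∀ t → names (σ t) ≡ map to (keys t)
        names-σ zero    = refl
        names-σ (suc t) = trans (cong (_++ namesOf (λ j → r j ≟ suc t)) (names-σ t))
                                (sym (map-++ to (keys t) _))

        status-σ : ∀ t j → status (σ t) (to j) ≡ st t j
        status-σ zero j = trans
          (update-cong nothing pending
            (trans (does-∈? (λ j → firstTime? (λ s → remaining S j s ≟ 0) 0) j) (not-completed j 0 (p≥1 j)))
            (does-∈? (λ j → r j ≟ 0) j) refl)
          (first (r j ≟ 0))
          where
          sg = does (to j ∈? namesOf (λ j → firstTime? (λ s → elapsed S j s ≟ q j) 0))
          first : Dec (r j ≡ 0) → update false (does (r j ≟ 0)) sg nothing pending ≡ st 0 j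
          first (yes r≡) = trans (update-cong {false} {s = sg} nothing pending refl (dec-true (r j ≟ 0) r≡) refl)
                                 (sym (st-fresh {0} {j} (≤-reflexive r≡) (q≥1 j)))
          first (no r≢)  = trans (update-cong {false} {s = sg} nothing pending refl (dec-false (r j ≟ 0) r≢) refl)
                                 (sym (st-pending {0} {j} (n≢0⇒n>0 r≢)))
        status-σ (suc t) j = trans
          (update-cong _ _ (does-∈? (λ j → firstTime? (λ s → remaining S j s ≟ 0) (suc t)) j)
            (does-∈? (λ j → r j ≟ suc t) j)
            (does-∈? (λ j → firstTime? (λ s → elapsed S j s ≟ q j) (suc t)) j))
          (trans (cong₂ (update (completed? j (suc t)) (does (r j ≟ suc t)) (signals? j (suc t)))
                   (trans (cong (kindFor (λ w → does (w ≟ to j))) (decide-σ t)) (kindFor-to j (choice t)))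
                   (status-σ t j))
                 (sym (status-suc t j)))

        decide-σ : ∀ t → decide (entries (names (σ t)) (status (σ t))) ≡ Maybe.map (map₁ to) (choice t)
        decide-σ t = trans (cong decide (trans (cong (λ ks → entries ks (status (σ t))) (names-σ t))
                                               (entries-to (keys t) (status-σ t))))
                           (decide-ren to (entries (keys t) (st t)))

      producedBy : ProducedBy algorithm S
      producedBy t = sym (trans (cong (Maybe.map proj₁) (decide-σ t)) (swap (choice t)))
        where
        swap : ∀ (m : Maybe (Job × Kind)) → Maybe.map proj₁ (Maybe.map (map₁ to) m) ≡ Maybe.map to (Maybe.map proj₁ m)
        swap nothing  = refl
        swap (just _) = refl

  -- Signaled against fresh jobs

  -- For steps in which only job `w` changes its contribution for the worse; the offsets `a` and `b`
  -- express gains and losses without subtraction.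
  sum-except : ∀ {n} {f g : Fin n → ℕ} {a b} w → (∀ j → j ≢ w → f j ≤ g j) →
    f w + a ≤ g w + b → sum f + a ≤ sum g + b
  sum-except {suc n} {f} {g} {a} {b} zero le lew = begin
    f zero + F + a   ≡⟨ swap (f zero) F a ⟩
    (f zero + a) + F ≤⟨ +-mono-≤ lew (sum-mono (λ j → le (suc j) λ ())) ⟩
    (g zero + b) + G ≡⟨ swap (g zero) G b ⟨
    g zero + G + b   ∎
    where
    open ≤-Reasoning
    F = sum (λ j → f (suc j))
    G = sum (λ j → g (suc j))
    swap : ∀ x y z → x + y + z ≡ (x + z) + y
    swap = solve-∀
  sum-except {suc n} {f} {g} {a} {b} (suc w) le lew = begin
    f zero + F + a   ≡⟨ +-assoc (f zero) F a ⟩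
    f zero + (F + a) ≤⟨ +-mono-≤ (le zero λ ()) (sum-except w (λ j j≢w → le (suc j) (j≢w ∘ Fin.suc-injective)) lew) ⟩
    g zero + (G + b) ≡⟨ +-assoc (g zero) G b ⟨
    g zero + G + b   ∎
    where
    open ≤-Reasoning
    F = sum (λ j → f (suc j))
    G = sum (λ j → g (suc j))

  atLeast : (Status → Maybe ℕ) → ℕ → Status → Bool
  atLeast ℓ y s = Maybe.maybe (y ≤ᵇ_) false (ℓ s)

  -- The arguments of Next are the kind given by the choice if the job is
  -- processed, the status and the next status of the job.
  data Next : Maybe Kind → Status → Status → Set where
    release  : Next nothing pending (fresh 0)
    wait     : ∀ {s} → Next nothing s s
    progress : ∀ {κ x} → Next (just κ) (fresh x) (fresh (suc x))
    signal   : ∀ {κ x} → Next (just κ) (fresh x) (signaled κ x)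
    go       : ∀ {κ κ′ x} → Next (just κ) (signaled κ′ x) (signaled κ′ x)
    done     : ∀ {κ κ′ x} → Next (just κ) (signaled κ′ x) finished

  ≤ᵇ-1 : ∀ {x y} → x ≤ y → (x ≤ᵇ y) · 1 ≡ 1
  ≤ᵇ-1 {x} {y} le = cong (_· 1) (dec-true (x ≤? y) le)

  ≤ᵇ-0 : ∀ {x y} → y < x → (x ≤ᵇ y) · 1 ≡ 0
  ≤ᵇ-0 {x} {y} gt = cong (_· 1) (dec-false (x ≤? y) (<⇒≱ gt))

  ≤ᵇ-mono : ∀ {x x′ y y′} → x′ ≤ x → y ≤ y′ → (x ≤ᵇ y) · 1 ≤ (x′ ≤ᵇ y′) · 1
  ≤ᵇ-mono {x} {y = y} x′≤x y≤y′ with x ≤ᵇ y | ≤ᵇ-reflects-≤ x y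
  ... | false | _      = z≤n
  ... | true  | ofʸ le = ≤-reflexive (sym (≤ᵇ-1 (≤-trans x′≤x (≤-trans le y≤y′))))

  module Counting (I : Instance) (q≥1 : ∀ j → 1 ≤ Instance.q I j) (q<p : ∀ j → Instance.q I j < Instance.p I j) where
    open Instance I
    open Run I q≥1 q<p

    next-of : ∀ t j {s m} → Stage t j s → Work t j m → Next m s (st (suc t) j)
    next-of t j (pending t<r) (works _ (r≤t , _) _ _ _) = contradiction r≤t (<⇒≱ t<r)
    next-of t j (pending t<r) (rests eq _) with m≤n⇒m<n∨m≡n t<r
    ... | inj₁ t+1<r = subst (Next nothing pending) (sym (st-pending t+1<r)) wait
    ... | inj₂ t+1≡r = subst (Next nothing pending)
      (sym (trans (st-fresh (≤-reflexive (sym t+1≡r)) (≤-<-trans (≤-reflexive e≡0) (q≥1 j))) (cong fresh e≡0))) release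
      where
      e≡0 = e-unreleased (suc t) j t<r
    next-of t j (fresh r≤t e<q) (rests eq _) = subst (Next nothing (fresh (e t j)))
      (sym (trans (st-fresh (m≤n⇒m≤1+n r≤t) (≤-<-trans (≤-reflexive eq) e<q)) (cong fresh eq))) wait
    next-of t j (fresh r≤t e<q) (works κ _ eq kq _) with m≤n⇒m<n∨m≡n e<q
    ... | inj₁ e+1<q = subst (Next (just κ) (fresh (e t j)))
      (sym (trans (st-fresh (m≤n⇒m≤1+n r≤t) (≤-<-trans (≤-reflexive eq) e+1<q)) (cong fresh eq))) progress
    ... | inj₂ e+1≡q = subst (Next (just κ) (fresh (e t j)))
      (sym (trans (st-signaled (m≤n⇒m≤1+n r≤t) (≤-reflexive (sym (trans eq e+1≡q))) (≤-<-trans (≤-reflexive (trans eq e+1≡q)) (q<p j)))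
        (cong₂ signaled (kq e<q) (sym (cong (_∸ 1) e+1≡q))))) signal
    next-of t j (signaled r≤t q≤e e<p) (rests eq kq) = subst (Next nothing (signaled (kind t j) (q j ∸ 1)))
      (sym (trans (st-signaled (m≤n⇒m≤1+n r≤t) (≤-trans q≤e (≤-reflexive (sym eq))) (≤-<-trans (≤-reflexive eq) e<p))
        (cong (λ κ → signaled κ (q j ∸ 1)) kq))) wait
    next-of t j (signaled r≤t q≤e e<p) (works κ _ eq _ kq) with m≤n⇒m<n∨m≡n e<p
    ... | inj₁ e+1<p = subst (Next (just κ) (signaled (kind t j) (q j ∸ 1)))
      (sym (trans (st-signaled (m≤n⇒m≤1+n r≤t) (≤-trans q≤e (e-mono t j)) (≤-<-trans (≤-reflexive eq) e+1<p))
        (cong (λ κ → signaled κ (q j ∸ 1)) (kq q≤e)))) go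
    ... | inj₂ e+1≡p = subst (Next (just κ) (signaled (kind t j) (q j ∸ 1)))
      (sym (st-finished (m≤n⇒m≤1+n r≤t) (≤-reflexive (sym (trans eq e+1≡p))))) done
    next-of t j (finished r≤t p≤e) (works _ (_ , e<p) _ _ _) = contradiction e<p (≤⇒≯ p≤e)
    next-of t j (finished r≤t p≤e) (rests eq _) = subst (Next nothing finished)
      (sym (st-finished (m≤n⇒m≤1+n r≤t) (≤-trans p≤e (e-mono t j)))) wait

    next : ∀ t j → Next (newKind t j) (st t j) (st (suc t) j)
    next t j = next-of t j (stage t j) (work t j)

    A B U : ℕ → ℕ → ℕ
    A t y = count t (atLeast guardedLevel y)
    B t y = count t (atLeast loneLevel y)
    U t y = count t (atLeast freshLevel y)

    -- In order of decreasing values, the signaled jobs form a stack in which no two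
    -- lone jobs are adjacent and in which every guarded job was pushed while a fresh
    -- job, not processed since, lay between it and the previous guarded one. Counting
    -- from the bottom of the stack makes this invariant under pushing and popping.
    record Balanced (t : ℕ) : Set where
      field
        A≤U      : ∀ y → A t y ≤ U t y
        B≤A+1    : ∀ y → B t y ≤ suc (A t y)
        B≤A      : ∀ {a x} → st t a ≡ signaled guarded x → B t x ≤ A t x
        distinct : ∀ {a b x} → st t a ≡ signaled guarded x → st t b ≡ signaled guarded x → a ≡ b

    newKind-nothing : ∀ t → choice t ≡ nothing → ∀ j → newKind t j ≡ nothing
    newKind-nothing t eq j = cong (kindFor (λ w → does (w Fin.≟ j))) eq

    newKind-other : ∀ t {w κ} → choice t ≡ just (w , κ) → ∀ j → j ≢ w → newKind t j ≡ nothing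
    newKind-other t {w} {κ} eq j j≢w = trans (cong (kindFor (λ w → does (w Fin.≟ j))) eq)
      (cong (λ b → if b then just κ else nothing) (dec-false (w Fin.≟ j) (j≢w ∘ sym)))

    newKind-chosen : ∀ t {w κ} → choice t ≡ just (w , κ) → newKind t w ≡ just κ
    newKind-chosen t {w} {κ} eq = trans (cong (kindFor (λ v → does (v Fin.≟ w))) eq)
      (cong (λ b → if b then just κ else nothing) (dec-true (w Fin.≟ w) refl))

    data SignaledLevel : (Status → Maybe ℕ) → Set where
      guardedˡ : SignaledLevel guardedLevel
      loneˡ    : SignaledLevel loneLevel

    atLeast-wait : ∀ {ℓ s s′} → SignaledLevel ℓ → ∀ y → Next nothing s s′ → atLeast ℓ y s′ ≡ atLeast ℓ y s
    atLeast-wait guardedˡ y release = refl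
    atLeast-wait loneˡ    y release = refl
    atLeast-wait _        y wait    = refl

    fresh-wait : ∀ {s s′} y → Next nothing s s′ → atLeast freshLevel y s · 1 ≤ atLeast freshLevel y s′ · 1
    fresh-wait y release = z≤n
    fresh-wait y wait    = ≤-refl

    guarded-wait : ∀ {s s′ x} → Next nothing s s′ → s′ ≡ signaled guarded x → s ≡ signaled guarded x
    guarded-wait wait eq = eq

    next-nothing : ∀ {t j} → newKind t j ≡ nothing → Next nothing (st t j) (st (suc t) j)
    next-nothing {t} {j} eq = subst (λ m → Next m (st t j) (st (suc t) j)) eq (next t j)

    module _ {t : ℕ} (bal : Balanced t) where
      open Balanced bal

      -- For steps that leave the guarded jobs as they are: losing lone jobs and gaining or raising
      -- fresh ones only helps.
      calm : (∀ y → A (suc t) y ≤ A t y) → (∀ y → A t y ≤ A (suc t) y) →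
        (∀ y → B (suc t) y ≤ B t y) → (∀ y → U t y ≤ U (suc t) y) →
        (∀ {a x} → st (suc t) a ≡ signaled guarded x → st t a ≡ signaled guarded x) → Balanced (suc t)
      calm A- A+ B- U+ before = record
        { A≤U      = λ y → ≤-trans (A- y) (≤-trans (A≤U y) (U+ y))
        ; B≤A+1    = λ y → ≤-trans (B- y) (≤-trans (B≤A+1 y) (s≤s (A+ y)))
        ; B≤A      = λ {a} {x} eq → ≤-trans (B- x) (≤-trans (B≤A (before eq)) (A+ x))
        ; distinct = λ eq eq′ → distinct (before eq) (before eq′)
        }

      idle-step : choice t ≡ nothing → Balanced (suc t)
      idle-step ch = calm
        (λ y → sum-mono (λ j → ≤-reflexive (cong (_· 1) (atLeast-wait guardedˡ y (waits j)))))
        (λ y → sum-mono (λ j → ≤-reflexive (cong (_· 1) (sym (atLeast-wait guardedˡ y (waits j))))))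
        (λ y → sum-mono (λ j → ≤-reflexive (cong (_· 1) (atLeast-wait loneˡ y (waits j)))))
        (λ y → sum-mono (λ j → fresh-wait y (waits j)))
        (λ {a} eq → guarded-wait (waits a) eq)
        where
        waits : ∀ j → Next nothing (st t j) (st (suc t) j)
        waits j = next-nothing (newKind-nothing t ch j)

      module _ {w κ} (ch : choice t ≡ just (w , κ)) where

        waits : ∀ j → j ≢ w → Next nothing (st t j) (st (suc t) j)
        waits j j≢w = next-nothing (newKind-other t ch j j≢w)

        chosen : Next (just κ) (st t w) (st (suc t) w)
        chosen = subst (λ m → Next m (st t w) (st (suc t) w)) (newKind-chosen t ch) (next t w)

        count-≤ : ∀ {ℓ} → SignaledLevel ℓ → ∀ y {s s′ a b} → st t w ≡ s → st (suc t) w ≡ s′ →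
          atLeast ℓ y s′ · 1 + a ≤ atLeast ℓ y s · 1 + b →
          count (suc t) (atLeast ℓ y) + a ≤ count t (atLeast ℓ y) + b
        count-≤ {ℓ} sl y refl refl = sum-except w (λ j j≢w → ≤-reflexive (cong (_· 1) (atLeast-wait sl y (waits j j≢w))))

        count-≥ : ∀ {ℓ} → SignaledLevel ℓ → ∀ y {s s′ a b} → st t w ≡ s → st (suc t) w ≡ s′ →
          atLeast ℓ y s · 1 + a ≤ atLeast ℓ y s′ · 1 + b →
          count t (atLeast ℓ y) + a ≤ count (suc t) (atLeast ℓ y) + b
        count-≥ {ℓ} sl y refl refl = sum-except w (λ j j≢w → ≤-reflexive (cong (_· 1) (sym (atLeast-wait sl y (waits j j≢w)))))

        U-≤ : ∀ y {s s′ a b} → st t w ≡ s → st (suc t) w ≡ s′ →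
          atLeast freshLevel y s · 1 + a ≤ atLeast freshLevel y s′ · 1 + b → U t y + a ≤ U (suc t) y + b
        U-≤ y refl refl = sum-except w (λ j j≢w → fresh-wait y (waits j j≢w))

        drop0 : ∀ {x y} → x + 0 ≤ y + 0 → x ≤ y
        drop0 {x} {y} le = ≤-trans (m≤m+n x 0) (≤-trans le (≤-reflexive (+-identityʳ y)))

        before-unless : ∀ {a x} → a ≢ w → st (suc t) a ≡ signaled guarded x → st t a ≡ signaled guarded x
        before-unless {a} a≢w = guarded-wait (waits a a≢w)

        before-if : (∀ {x} → st (suc t) w ≡ signaled guarded x → st t w ≡ signaled guarded x) →
          ∀ {a x} → st (suc t) a ≡ signaled guarded x → st t a ≡ signaled guarded x
        before-if bw {a} eq with a Fin.≟ w
        ... | yes refl = bw eq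
        ... | no a≢w   = before-unless a≢w eq

        -- The completion of a lone job is harmless wherever it sits in the stack, which is what the
        -- exception relies on; a guarded job may only be removed from the top.
        old-step : ∀ {κ′ x} → st t w ≡ signaled κ′ x → (κ′ ≡ guarded → ∀ k {y} → level (st t k) ≡ just y → x ≤ y) →
          Balanced (suc t)
        old-step {κ′} {x} st≡ least = byNext (st (suc t) w) refl (subst (λ s → Next (just κ) s (st (suc t) w)) st≡ chosen)
          where
          U+ : ∀ {s′} → st (suc t) w ≡ s′ → ∀ y → U t y ≤ U (suc t) y
          U+ st≡′ y = drop0 (U-≤ y st≡ st≡′ z≤n)
          byNext : ∀ s′ → st (suc t) w ≡ s′ → Next (just κ) (signaled κ′ x) s′ → Balanced (suc t)
          byNext _ st≡′ go = calm
            (λ y → drop0 (count-≤ guardedˡ y st≡ st≡′ ≤-refl)) (λ y → drop0 (count-≥ guardedˡ y st≡ st≡′ ≤-refl))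
            (λ y → drop0 (count-≤ loneˡ y st≡ st≡′ ≤-refl)) (U+ st≡′)
            (before-if λ eq → trans st≡ (trans (sym st≡′) eq))
          byNext _ st≡′ done = finish κ′ refl
            where
            absent : ∀ {x} → st (suc t) w ≢ signaled guarded x
            absent eq with () ← trans (sym st≡′) eq
            finish : ∀ κ″ → κ″ ≡ κ′ → Balanced (suc t)
            finish lone refl = calm
              (λ y → drop0 (count-≤ guardedˡ y st≡ st≡′ ≤-refl)) (λ y → drop0 (count-≥ guardedˡ y st≡ st≡′ ≤-refl))
              (λ y → drop0 (count-≤ loneˡ y st≡ st≡′ z≤n)) (U+ st≡′)
              (before-if λ eq → contradiction eq absent)
            finish guarded refl = record
              { A≤U      = λ y → ≤-trans (A- y) (≤-trans (A≤U y) (U+ st≡′ y))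
              ; B≤A+1    = λ y → ≤-trans (B- y) (byLevel y)
              ; B≤A      = λ {a} {z} eq → still eq
              ; distinct = λ eq eq′ → distinct (old-guarded eq) (old-guarded eq′)
              }
              where
              A- : ∀ y → A (suc t) y ≤ A t y
              A- y = drop0 (count-≤ guardedˡ y st≡ st≡′ z≤n)
              B- : ∀ y → B (suc t) y ≤ B t y
              B- y = drop0 (count-≤ loneˡ y st≡ st≡′ z≤n)
              A+ : ∀ y → A t y ≤ A (suc t) y + (y ≤ᵇ x) · 1
              A+ y = ≤-trans (m≤m+n _ 0) (count-≥ guardedˡ y st≡ st≡′ (≤-reflexive (+-identityʳ _)))
              A+> : ∀ y → x < y → A t y ≤ A (suc t) y
              A+> y x<y = ≤-trans (A+ y) (≤-reflexive (trans (cong (A (suc t) y +_) (≤ᵇ-0 x<y)) (+-identityʳ _)))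
              byLevel : ∀ y → B t y ≤ suc (A (suc t) y)
              byLevel y with y ≤? x
              ... | no y≰x  = ≤-trans (B≤A+1 y) (s≤s (A+> y (≰⇒> y≰x)))
              -- All lone values are at least `x`, so no lone job is lost by raising `y` to `x`;
              -- there `B≤A` has exactly the slack that the departure of the guarded job costs.
              ... | yes y≤x = begin
                B t y                          ≤⟨ sum-mono upper ⟩
                B t x                          ≤⟨ B≤A st≡ ⟩
                A t x                          ≤⟨ sum-mono lower ⟩
                A t y                          ≤⟨ A+ y ⟩
                A (suc t) y + (y ≤ᵇ x) · 1     ≡⟨ cong (A (suc t) y +_) (≤ᵇ-1 y≤x) ⟩
                A (suc t) y + 1                ≡⟨ +-comm _ 1 ⟩
                suc (A (suc t) y)              ∎
                where
                open ≤-Reasoning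
                lower : ∀ j → atLeast guardedLevel x (st t j) · 1 ≤ atLeast guardedLevel y (st t j) · 1
                lower j with guardedLevel (st t j)
                ... | nothing = z≤n
                ... | just _  = ≤ᵇ-mono y≤x ≤-refl
                upper : ∀ j → atLeast loneLevel y (st t j) · 1 ≤ atLeast loneLevel x (st t j) · 1
                upper j with st t j | least refl j
                ... | pending            | _  = z≤n
                ... | finished           | _  = z≤n
                ... | fresh _            | _  = z≤n
                ... | signaled guarded _ | _  = z≤n
                ... | signaled lone z    | le = ≤-trans (·-≤ (y ≤ᵇ z)) (≤-reflexive (sym (≤ᵇ-1 (le refl))))
              old-guarded : ∀ {a z} → st (suc t) a ≡ signaled guarded z → st t a ≡ signaled guarded z
              old-guarded = before-if λ eq → contradiction eq absent
              still : ∀ {a z} → st (suc t) a ≡ signaled guarded z → B (suc t) z ≤ A (suc t) z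
              still {a} {z} eq with m≤n⇒m<n∨m≡n (least refl a (cong level (old-guarded eq)))
              ... | inj₁ x<z  = ≤-trans (B- z) (≤-trans (B≤A (old-guarded eq)) (A+> z x<z))
              -- A remaining guarded job of the same value would be the completed one itself.
              ... | inj₂ refl with distinct (old-guarded eq) st≡
              ...   | refl = contradiction eq absent

        -- A guarded signal moves one job from `U` to `A`, which takes a slack of 2. A lone signal
        -- takes one job from `U` and adds one to `B`, so it needs a slack of 1 in `A≤U` and the
        -- sharper bound `B t y ≤ A t y`.
        fresh-step : ∀ {x} → st t w ≡ fresh x → (∀ k {κ y} → st t k ≡ signaled κ y → x < y) →
          (∀ y → y ≤ x → κ ≡ guarded → A t y + 2 ≤ U t y) →
          (∀ y → y ≤ x → κ ≡ lone → A t y + 1 ≤ U t y × B t y ≤ A t y) → Balanced (suc t)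
        fresh-step {x} st≡ above ifGuarded ifLone = byNext (st (suc t) w) refl (subst (λ s → Next (just κ) s (st (suc t) w)) st≡ chosen)
          where
          byNext : ∀ s′ → st (suc t) w ≡ s′ → Next (just κ) (fresh x) s′ → Balanced (suc t)
          byNext _ st≡′ progress = calm
            (λ y → drop0 (count-≤ guardedˡ y st≡ st≡′ ≤-refl)) (λ y → drop0 (count-≥ guardedˡ y st≡ st≡′ ≤-refl))
            (λ y → drop0 (count-≤ loneˡ y st≡ st≡′ ≤-refl))
            (λ y → drop0 (U-≤ y st≡ st≡′ (+-monoˡ-≤ 0 (≤ᵇ-mono (≤-refl {y}) (n≤1+n x)))))
            (before-if absent)
            where
            absent : ∀ {x} → st (suc t) w ≡ signaled guarded x → st t w ≡ signaled guarded x
            absent eq with () ← trans (sym st≡′) eq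
          byNext _ st≡′ signal = finish κ refl
            where
            U- : ∀ y → U t y ≤ U (suc t) y + (y ≤ᵇ x) · 1
            U- y = ≤-trans (m≤m+n _ 0) (U-≤ y st≡ st≡′ (≤-reflexive (+-identityʳ _)))
            U> : ∀ y → x < y → U t y ≤ U (suc t) y
            U> y x<y = ≤-trans (U- y) (≤-reflexive (trans (cong (U (suc t) y +_) (≤ᵇ-0 x<y)) (+-identityʳ _)))
            U≤ : ∀ y → U t y ≤ U (suc t) y + 1
            U≤ y = ≤-trans (U- y) (+-monoʳ-≤ (U (suc t) y) (·-≤ (y ≤ᵇ x)))
            finish : ∀ κ′ → κ′ ≡ κ → Balanced (suc t)
            finish guarded refl = record
              { A≤U      = A≤U′
              ; B≤A+1    = λ y → ≤-trans (B- y) (≤-trans (B≤A+1 y) (s≤s (≤-trans (m≤m+n _ _) (A+ y))))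
              ; B≤A      = B≤A′
              ; distinct = distinct′
              }
              where
              A- : ∀ y → A (suc t) y ≤ A t y + (y ≤ᵇ x) · 1
              A- y = ≤-trans (m≤m+n _ 0) (count-≤ guardedˡ y st≡ st≡′ (≤-reflexive (+-identityʳ _)))
              A+ : ∀ y → A t y + (y ≤ᵇ x) · 1 ≤ A (suc t) y
              A+ y = ≤-trans (count-≥ guardedˡ y {a = (y ≤ᵇ x) · 1} {b = 0} st≡ st≡′ (≤-reflexive (sym (+-identityʳ _)))) (≤-reflexive (+-identityʳ _))
              B- : ∀ y → B (suc t) y ≤ B t y
              B- y = drop0 (count-≤ loneˡ y st≡ st≡′ z≤n)
              A≤U′ : ∀ y → A (suc t) y ≤ U (suc t) y
              A≤U′ y with y ≤? x
              ... | no y≰x  = ≤-trans (A- y) (≤-trans (≤-reflexive (trans (cong (A t y +_) (≤ᵇ-0 (≰⇒> y≰x))) (+-identityʳ _)))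
                                (≤-trans (A≤U y) (U> y (≰⇒> y≰x))))
              ... | yes y≤x = +-cancelʳ-≤ 1 _ _ (begin
                A (suc t) y + 1                ≤⟨ +-monoˡ-≤ 1 (A- y) ⟩
                A t y + (y ≤ᵇ x) · 1 + 1       ≤⟨ +-monoˡ-≤ 1 (+-monoʳ-≤ (A t y) (·-≤ (y ≤ᵇ x))) ⟩
                A t y + 1 + 1                  ≡⟨ +-assoc (A t y) 1 1 ⟩
                A t y + 2                      ≤⟨ ifGuarded y y≤x refl ⟩
                U t y                          ≤⟨ U≤ y ⟩
                U (suc t) y + 1                ∎)
                where open ≤-Reasoning
              B≤A′ : ∀ {a z} → st (suc t) a ≡ signaled guarded z → B (suc t) z ≤ A (suc t) z
              B≤A′ {a} {z} eq with a Fin.≟ w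
              ... | no a≢w   = ≤-trans (B- z) (≤-trans (B≤A (before-unless a≢w eq)) (≤-trans (m≤m+n _ _) (A+ z)))
              ... | yes refl with trans (sym st≡′) eq
              -- The new guarded job itself turns `B≤A+1` into `B≤A` at its own value.
              ...   | refl = ≤-trans (B- x) (≤-trans (B≤A+1 x) (≤-trans (≤-reflexive (trans (+-comm 1 _) (cong (A t x +_) (sym (≤ᵇ-1 (≤-refl {x})))))) (A+ x)))
              distinct′ : ∀ {a b z} → st (suc t) a ≡ signaled guarded z → st (suc t) b ≡ signaled guarded z → a ≡ b
              distinct′ {a} {b} eqa eqb with a Fin.≟ w | b Fin.≟ w
              ... | yes a≡w | yes b≡w = trans a≡w (sym b≡w)
              ... | no a≢w  | no b≢w  = distinct (before-unless a≢w eqa) (before-unless b≢w eqb)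
              ... | yes refl | no b≢w with trans (sym st≡′) eqa
              ...   | refl = contradiction (above b (before-unless b≢w eqb)) (<-irrefl refl)
              distinct′ {a} {b} eqa eqb | no a≢w | yes refl with trans (sym st≡′) eqb
              ...   | refl = contradiction (above a (before-unless a≢w eqa)) (<-irrefl refl)
            finish lone refl = record
              { A≤U      = A≤U′
              ; B≤A+1    = B≤A+1′
              ; B≤A      = λ {a} {z} eq → ≤-trans (B- z) (≤-trans (≤-reflexive (trans (cong (B t z +_) (≤ᵇ-0 (above a (before eq)))) (+-identityʳ _)))
                             (≤-trans (B≤A (before eq)) (A+ z)))
              ; distinct = λ eq eq′ → distinct (before eq) (before eq′)
              }
              where
              before : ∀ {a z} → st (suc t) a ≡ signaled guarded z → st t a ≡ signaled guarded z
              before = before-if λ eq → contradiction (trans (sym st≡′) eq) λ ()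
              A- : ∀ y → A (suc t) y ≤ A t y
              A- y = drop0 (count-≤ guardedˡ y st≡ st≡′ ≤-refl)
              A+ : ∀ y → A t y ≤ A (suc t) y
              A+ y = drop0 (count-≥ guardedˡ y st≡ st≡′ ≤-refl)
              B- : ∀ y → B (suc t) y ≤ B t y + (y ≤ᵇ x) · 1
              B- y = ≤-trans (m≤m+n _ 0) (count-≤ loneˡ y st≡ st≡′ (≤-reflexive (+-identityʳ _)))
              A≤U′ : ∀ y → A (suc t) y ≤ U (suc t) y
              A≤U′ y with y ≤? x
              ... | no y≰x  = ≤-trans (A- y) (≤-trans (A≤U y) (U> y (≰⇒> y≰x)))
              ... | yes y≤x = +-cancelʳ-≤ 1 _ _ (≤-trans (+-monoˡ-≤ 1 (A- y)) (≤-trans (proj₁ (ifLone y y≤x refl)) (U≤ y)))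
              B≤A+1′ : ∀ y → B (suc t) y ≤ suc (A (suc t) y)
              B≤A+1′ y with y ≤? x
              ... | no y≰x  = ≤-trans (B- y) (≤-trans (≤-reflexive (trans (cong (B t y +_) (≤ᵇ-0 (≰⇒> y≰x))) (+-identityʳ _)))
                                (≤-trans (B≤A+1 y) (s≤s (A+ y))))
              ... | yes y≤x = ≤-trans (B- y) (≤-trans (+-mono-≤ (≤-trans (proj₂ (ifLone y y≤x refl)) (A+ y)) (·-≤ (y ≤ᵇ x))) (≤-reflexive (+-comm _ 1)))

    A-ceiling : ∀ t {a z} → Lowest guardedLevel (st t) (just (a , z)) → ∀ y → A t y ≤ A t z
    A-ceiling t {z = z} (some _ lo) y = sum-mono le
      where
      le : ∀ j → atLeast guardedLevel y (st t j) · 1 ≤ atLeast guardedLevel z (st t j) · 1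
      le j with guardedLevel (st t j) | lo j
      ... | nothing | _   = z≤n
      ... | just v  | z≤v = ≤-trans (·-≤ (y ≤ᵇ v)) (≤-reflexive (sym (≤ᵇ-1 (z≤v refl))))

    -- No guarded job lies below the lowest guarded value `z`, so `A` is maximal there and `A≤U` at
    -- `z` pays for it; the two fresh jobs below `z` come on top.
    crowd-room : ∀ t {x a} → Balanced t → (∀ k {y} → level (st t k) ≡ just y → x ≤ y) →
      Lowest guardedLevel (st t) a → 2 ≤ count t (isFreshBelow a) → ∀ y → y ≤ x → A t y + 2 ≤ U t y
    crowd-room t {x} bal least (none empty) two y y≤x = begin
      A t y + 2                       ≡⟨ cong (_+ 2) (sum-zero {f = λ j → atLeast guardedLevel y (st t j) · 1} (λ j → cong (λ m → Maybe.maybe (y ≤ᵇ_) false m · 1) (empty j))) ⟩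
      2                               ≤⟨ two ⟩
      count t (isFreshBelow {K = Job} nothing)  ≤⟨ sum-mono le ⟩
      U t y                           ∎
      where
      open ≤-Reasoning
      le : ∀ j → isFreshBelow {K = Job} nothing (st t j) · 1 ≤ atLeast freshLevel y (st t j) · 1
      le j with st t j | least j
      ... | pending      | _  = z≤n
      ... | finished     | _  = z≤n
      ... | signaled _ _ | _  = z≤n
      ... | fresh v      | le = ≤-reflexive (sym (≤ᵇ-1 (≤-trans y≤x (le refl))))
    crowd-room t {x} {just (a , z)} bal least la two y y≤x = begin
      A t y + 2                                        ≤⟨ +-mono-≤ (≤-trans (A-ceiling t la y) (Balanced.A≤U bal z)) two ⟩
      U t z + count t (isFreshBelow (just (a , z)))    ≡⟨ ∑-distrib-+ (λ j → atLeast freshLevel z (st t j) · 1) (λ j → isFreshBelow (just (a , z)) (st t j) · 1) ⟨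
      sum (λ j → atLeast freshLevel z (st t j) · 1 + isFreshBelow (just (a , z)) (st t j) · 1)
                                                       ≤⟨ sum-mono le ⟩
      U t y                                            ∎
      where
      open ≤-Reasoning
      le : ∀ j → atLeast freshLevel z (st t j) · 1 + isFreshBelow (just (a , z)) (st t j) · 1
               ≤ atLeast freshLevel y (st t j) · 1
      le j with st t j | least j
      ... | pending      | _  = z≤n
      ... | finished     | _  = z≤n
      ... | signaled _ _ | _  = z≤n
      ... | fresh v      | le = ≤-trans (≤-reflexive (split v)) (≤-reflexive (sym (≤ᵇ-1 (≤-trans y≤x (le refl)))))
        where
        split : ∀ v → (z ≤ᵇ v) · 1 + (v <ᵇ z) · 1 ≡ 1
        split v with z ≤ᵇ v | ≤ᵇ-reflects-≤ z v | v <ᵇ z | <ᵇ-reflects-< v z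
        ... | true  | _       | false | _       = refl
        ... | false | _       | true  | _       = refl
        ... | true  | ofʸ z≤v | true  | ofʸ v<z = contradiction z≤v (<⇒≱ v<z)
        ... | false | ofⁿ z≰v | false | ofⁿ v≮z = contradiction (≮⇒≥ v≮z) z≰v

    -- All guarded values exceed `x`, so `A≤U` can be taken at `suc x`, where `w` is not yet
    -- counted. No lone job lies below the lowest guarded one, so `B≤A` there covers all lone jobs;
    -- without guarded jobs there are no lone ones either.
    alone-room : ∀ t {w x a} → Balanced t → st t w ≡ fresh x →
      (∀ k {y} → level (st t k) ≡ just y → x ≤ y) → (∀ k {κ y} → st t k ≡ signaled κ y → x < y) →
      Lowest guardedLevel (st t) a → (∀ k {y} → st t k ≡ signaled lone y → y isBelow a ≡ false) →
      ∀ y → y ≤ x → A t y + 1 ≤ U t y × B t y ≤ A t y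
    alone-room t {w} {x} {a} bal st≡ least above la inactive y y≤x = room , balance a la inactive
      where
      open ≤-Reasoning
      guarded-above : ∀ j → atLeast guardedLevel y (st t j) · 1 ≤ atLeast guardedLevel (suc x) (st t j) · 1
      guarded-above j with st t j | above j
      ... | pending            | _  = z≤n
      ... | finished           | _  = z≤n
      ... | fresh _            | _  = z≤n
      ... | signaled lone _    | _  = z≤n
      ... | signaled guarded v | lt = ≤-trans (·-≤ (y ≤ᵇ v)) (≤-reflexive (sym (≤ᵇ-1 (lt refl))))
      lower : ∀ ℓ j {y y′} → y′ ≤ y → atLeast ℓ y (st t j) · 1 ≤ atLeast ℓ y′ (st t j) · 1
      lower ℓ j y′≤y with ℓ (st t j)
      ... | nothing = z≤n
      ... | just v  = ≤ᵇ-mono y′≤y ≤-refl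
      at-w : atLeast freshLevel (suc x) (st t w) · 1 + 1 ≤ atLeast freshLevel y (st t w) · 1 + 0
      at-w = begin
        atLeast freshLevel (suc x) (st t w) · 1 + 1  ≡⟨ cong (λ s → atLeast freshLevel (suc x) s · 1 + 1) st≡ ⟩
        (suc x ≤ᵇ x) · 1 + 1                         ≡⟨ cong (_+ 1) (≤ᵇ-0 {suc x} (n<1+n x)) ⟩
        1                                            ≡⟨ ≤ᵇ-1 y≤x ⟨
        (y ≤ᵇ x) · 1                                 ≡⟨ +-identityʳ _ ⟨
        (y ≤ᵇ x) · 1 + 0                             ≡⟨ cong (λ s → atLeast freshLevel y s · 1 + 0) st≡ ⟨
        atLeast freshLevel y (st t w) · 1 + 0        ∎
      room : A t y + 1 ≤ U t y
      room = begin
        A t y + 1          ≤⟨ +-monoˡ-≤ 1 (≤-trans (sum-mono guarded-above) (Balanced.A≤U bal (suc x))) ⟩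
        U t (suc x) + 1    ≤⟨ sum-except w (λ j _ → lower freshLevel j (m≤n⇒m≤1+n y≤x)) at-w ⟩
        U t y + 0          ≡⟨ +-identityʳ _ ⟩
        U t y              ∎
      balance : ∀ a → Lowest guardedLevel (st t) a → (∀ k {y} → st t k ≡ signaled lone y → y isBelow a ≡ false) → B t y ≤ A t y
      balance nothing _ inactive = ≤-trans (≤-reflexive (sum-zero no-lone)) z≤n
        where
        no-lone : ∀ j → atLeast loneLevel y (st t j) · 1 ≡ 0
        no-lone j with st t j | inactive j
        ... | pending            | _  = refl
        ... | finished           | _  = refl
        ... | fresh _            | _  = refl
        ... | signaled guarded _ | _  = refl
        ... | signaled lone _    | ina with () ← ina refl
      balance (just (a , z)) (some eqa _) inactive = begin
        B t y    ≤⟨ sum-mono lone-above ⟩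
        B t z    ≤⟨ Balanced.B≤A bal (guarded⁻ (st t a) eqa) ⟩
        A t z    ≤⟨ sum-mono (λ j → lower guardedLevel j (≤-trans y≤x (<⇒≤ (above a (guarded⁻ (st t a) eqa))))) ⟩
        A t y    ∎
        where
        lone-above : ∀ j → atLeast loneLevel y (st t j) · 1 ≤ atLeast loneLevel z (st t j) · 1
        lone-above j with st t j | inactive j
        ... | pending            | _  = z≤n
        ... | finished           | _  = z≤n
        ... | fresh _            | _  = z≤n
        ... | signaled guarded _ | _  = z≤n
        ... | signaled lone v    | ina = ≤-trans (·-≤ (y ≤ᵇ v)) (≤-reflexive (sym (≤ᵇ-1 {z} {v} (notBelow⇒≥ {x = v} {z} {a} (ina refl)))))

    balanced : ∀ t → Balanced t
    balanced zero = record
      { A≤U      = λ y → ≤-trans (≤-reflexive (sum-zero (λ j → cong (_· 1) (none-initially guardedˡ y j)))) z≤n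
      ; B≤A+1    = λ y → ≤-trans (≤-reflexive (sum-zero (λ j → cong (_· 1) (none-initially loneˡ y j)))) z≤n
      ; B≤A      = λ {a} eq → contradiction eq (no-signal₀ a)
      ; distinct = λ {a} eq → contradiction eq (no-signal₀ a)
      }
      where
      no-signal₀ : ∀ a {κ x} → st 0 a ≢ signaled κ x
      no-signal₀ a eq with st 0 a | stage 0 a
      no-signal₀ a () | _ | pending _
      no-signal₀ a () | _ | fresh _ _
      no-signal₀ a eq | _ | signaled _ q≤0 _ = contradiction (q≥1 a) (≤⇒≯ q≤0)
      no-signal₀ a () | _ | finished _ _
      none-initially : ∀ {ℓ} → SignaledLevel ℓ → ∀ y j → atLeast ℓ y (st 0 j) ≡ false
      none-initially sl y j with st 0 j | no-signal₀ j
      none-initially guardedˡ y j | pending      | _  = refl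
      none-initially guardedˡ y j | finished     | _  = refl
      none-initially guardedˡ y j | fresh _      | _  = refl
      none-initially loneˡ    y j | pending      | _  = refl
      none-initially loneˡ    y j | finished     | _  = refl
      none-initially loneˡ    y j | fresh _      | _  = refl
      none-initially _        y j | signaled _ _ | ne = contradiction refl ne
    balanced (suc t) = byChoice (choice t) refl (choice-spec t)
      where
      bal = balanced t
      byChoice : ∀ m → choice t ≡ m → Choice (st t) (λ P → number P (entries (keys t) (st t))) m → Balanced (suc t)
      byChoice _ ch (idle _)                       = idle-step bal ch
      byChoice _ ch (old st≡ least)                = old-step bal ch st≡ (λ _ → least)
      byChoice _ ch (hold st≡ _ _ _ _ _ _ _)       = old-step bal ch st≡ λ ()
      byChoice _ ch (crowd {a = a} st≡ least above la two) = fresh-step bal ch st≡ above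
        (λ y y≤x _ → crowd-room t bal least la (≤-trans two (≤-reflexive (number≡count t (isFreshBelow a) refl))) y y≤x) λ _ _ ()
      byChoice _ ch (alone st≡ least above la ina) = fresh-step bal ch st≡ above (λ _ _ ())
        λ y y≤x _ → alone-room t bal st≡ least above la ina y y≤x

    isAlive : Status → Bool
    isAlive s = is-just (level s)

    isFresh : Status → Bool
    isFresh s = is-just (freshLevel s)

    alive≤fresh : ∀ t → count t isAlive ≤ 3 * count t isFresh + 1
    alive≤fresh t = begin
      count t isAlive                    ≤⟨ sum-mono parts ⟩
      sum (λ j → u j + (a j + b j))      ≡⟨ trans (∑-distrib-+ u (λ j → a j + b j)) (cong (U t 0 +_) (∑-distrib-+ a b)) ⟩
      U t 0 + (A t 0 + B t 0)            ≤⟨ +-monoʳ-≤ (U t 0) (+-monoʳ-≤ (A t 0) (Balanced.B≤A+1 (balanced t) 0)) ⟩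
      U t 0 + (A t 0 + suc (A t 0))      ≤⟨ +-monoʳ-≤ (U t 0) (+-mono-≤ (Balanced.A≤U (balanced t) 0) (s≤s (Balanced.A≤U (balanced t) 0))) ⟩
      U t 0 + (U t 0 + suc (U t 0))      ≡⟨ three (U t 0) ⟩
      3 * U t 0 + 1                      ≤⟨ +-monoˡ-≤ 1 (*-monoʳ-≤ 3 (sum-mono fresh-parts)) ⟩
      3 * count t isFresh + 1            ∎
      where
      open ≤-Reasoning
      u a b : Job → ℕ
      u j = atLeast freshLevel 0 (st t j) · 1
      a j = atLeast guardedLevel 0 (st t j) · 1
      b j = atLeast loneLevel 0 (st t j) · 1
      three : ∀ x → x + (x + suc x) ≡ 3 * x + 1
      three = solve-∀
      parts : ∀ j → isAlive (st t j) · 1 ≤ u j + (a j + b j)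
      parts j with st t j
      ... | pending            = z≤n
      ... | finished           = z≤n
      ... | fresh _            = ≤-refl
      ... | signaled guarded _ = ≤-refl
      ... | signaled lone _    = ≤-refl
      fresh-parts : ∀ j → u j ≤ isFresh (st t j) · 1
      fresh-parts j with st t j
      ... | pending      = z≤n
      ... | finished     = z≤n
      ... | fresh _      = ≤-refl
      ... | signaled _ _ = z≤n

  is-cases : ∀ {n} (m : Maybe (Fin n)) j → (m ≡ just j × is m j ≡ true) ⊎ (m ≢ just j × is m j ≡ false)
  is-cases m j = byDec (≡-dec Fin._≟_ m (just j))
    where
    byDec : Dec (m ≡ just j) → _
    byDec (yes eq) = inj₁ (eq , dec-true (≡-dec Fin._≟_ m (just j)) eq)
    byDec (no neq) = inj₂ (neq , dec-false (≡-dec Fin._≟_ m (just j)) neq)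

  sum-is-≤1 : ∀ {n} (m : Maybe (Fin n)) → sum (λ j → is m j · 1) ≤ 1
  sum-is-≤1 {n} nothing  = ≤-trans (≤-reflexive (sum-zero {n} {λ j → is nothing j · 1} (λ _ → refl))) z≤n
  sum-is-≤1 {n} (just w) = ≤-reflexive (sum-is w (λ _ → 1))

  two-terms≤sum : ∀ {n} (f : Fin n → ℕ) u w → u ≢ w → f u + f w ≤ sum f
  two-terms≤sum f zero    zero    u≢w = contradiction refl u≢w
  two-terms≤sum f zero    (suc w) _   = +-monoʳ-≤ (f zero) (term≤sum (λ j → f (suc j)) w)
  two-terms≤sum f (suc u) zero    _   = ≤-trans (≤-reflexive (+-comm (f (suc u)) (f zero)))
    (+-monoʳ-≤ (f zero) (term≤sum (λ j → f (suc j)) u))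
  two-terms≤sum f (suc u) (suc w) u≢w = ≤-trans (two-terms≤sum (λ j → f (suc j)) u w (u≢w ∘ cong suc)) (m≤n+m _ (f zero))

  -- Comparison with an arbitrary feasible schedule

  module Elapsed (I : Instance) (T : Instance.Schedule I) (feasible : Instance.Feasible I T) where
    open Instance I

    elapsed-unreleased : ∀ t j → t ≤ r j → elapsed T j t ≡ 0
    elapsed-unreleased zero    j _   = refl
    elapsed-unreleased (suc t) j t<r with is-cases (T t) j
    ... | inj₁ (eq , _) = contradiction (proj₁ (feasible t j eq)) (<⇒≱ t<r)
    ... | inj₂ (_ , eq) = trans (elapsed-suc I T j t) (cong₂ (λ b x → b · 1 + x) eq (elapsed-unreleased t j (<⇒≤ t<r)))

    elapsed≤p : ∀ t j → elapsed T j t ≤ p j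
    elapsed≤p zero    j = z≤n
    elapsed≤p (suc t) j with is-cases (T t) j
    ... | inj₁ (eq , eq′) = ≤-trans (≤-reflexive (trans (elapsed-suc I T j t) (cong (λ b → b · 1 + elapsed T j t) eq′)))
                              (≰⇒> λ p≤e → proj₂ (feasible t j eq) (m≤n⇒m∸n≡0 p≤e))
    ... | inj₂ (_ , eq)   = ≤-trans (≤-reflexive (trans (elapsed-suc I T j t) (cong (λ b → b · 1 + elapsed T j t) eq))) (elapsed≤p t j)

  -- Windows below a threshold

  module Windows (I : Instance) (q≥1 : ∀ j → 1 ≤ Instance.q I j) (q<p : ∀ j → Instance.q I j < Instance.p I j)
    (T : Instance.Schedule I) (T-feasible : Instance.Feasible I T) where
    open Instance I
    open Run I q≥1 q<p
    open Counting I q≥1 q<p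
    open Elapsed I T T-feasible

    e* : ℕ → Job → ℕ
    e* t j = elapsed T j t

    -- Meaningful for finished jobs too, so that it is monotone in time and can be bounded on all
    -- members of a window, completed or not.
    val : ℕ → Job → ℕ
    val t j = e t j ⊓ (q j ∸ 1)

    pred<q : ∀ j → q j ∸ 1 < q j
    pred<q j = ≤-reflexive (m+[n∸m]≡n (q≥1 j))

    val-fresh : ∀ t j → e t j < q j → val t j ≡ e t j
    val-fresh t j e<q = m≤n⇒m⊓n≡m (∸-monoˡ-≤ 1 e<q)

    val-signaled : ∀ t j → q j ≤ e t j → val t j ≡ q j ∸ 1
    val-signaled t j q≤e = m≥n⇒m⊓n≡n (≤-trans (m∸n≤m (q j) 1) q≤e)

    val-mono : ∀ t j → val t j ≤ val (suc t) j
    val-mono t j = ⊓-monoˡ-≤ (q j ∸ 1) (e-mono t j)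

    val-suc : ∀ t j → val (suc t) j ≤ suc (val t j)
    val-suc t j = ≤-trans (⊓-monoˡ-≤ (q j ∸ 1) (≤-trans (≤-reflexive eq) (+-monoˡ-≤ (e t j) (·-≤ (is (S t) j))))) (bound (e t j) (q j ∸ 1))
      where
      eq : e (suc t) j ≡ is (S t) j · 1 + e t j
      eq = refl
      bound : ∀ x y → suc x ⊓ y ≤ suc (x ⊓ y)
      bound x y = ⊓-monoʳ-≤ (suc x) (n≤1+n y)

    level⇒val : ∀ t j {x} → level (st t j) ≡ just x → x ≡ val t j
    level⇒val t j eq = byStage (stage t j) eq
      where
      byStage : ∀ {s x} → Stage t j s → level s ≡ just x → x ≡ val t j
      byStage (fresh r≤t e<q)        refl = sym (val-fresh t j e<q)
      byStage (signaled r≤t q≤e e<p) refl = sym (val-signaled t j q≤e)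

    alive⇒level : ∀ t j → Alive t j → level (st t j) ≡ just (val t j)
    alive⇒level t j (r≤t , e<p) = byStage (stage t j)
      where
      byStage : ∀ {s} → Stage t j s → level s ≡ just (val t j)
      byStage (pending t<r)          = contradiction r≤t (<⇒≱ t<r)
      byStage (fresh r≤t e<q)        = cong just (sym (val-fresh t j e<q))
      byStage (signaled r≤t q≤e e<p) = cong just (sym (val-signaled t j q≤e))
      byStage (finished r≤t p≤e)     = contradiction e<p (≤⇒≯ p≤e)

    fresh⇒ : ∀ t j {x} → st t j ≡ fresh x → r j ≤ t × e t j < q j × x ≡ e t j
    fresh⇒ t j eq = byStage (stage t j) eq
      where
      byStage : ∀ {s x} → Stage t j s → s ≡ fresh x → r j ≤ t × e t j < q j × x ≡ e t j
      byStage (fresh r≤t e<q) refl = r≤t , e<q , refl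

    signaled⇒ : ∀ t j {κ x} → st t j ≡ signaled κ x → r j ≤ t × q j ≤ e t j × e t j < p j × κ ≡ kind t j × x ≡ q j ∸ 1
    signaled⇒ t j eq = byStage (stage t j) eq
      where
      byStage : ∀ {s κ x} → Stage t j s → s ≡ signaled κ x → r j ≤ t × q j ≤ e t j × e t j < p j × κ ≡ kind t j × x ≡ q j ∸ 1
      byStage (signaled r≤t q≤e e<p) refl = r≤t , q≤e , e<p , refl , refl

    -- g is a job that T may have processed while S preferred a lone job.
    record Window (t x : ℕ) (g : Maybe Job) : Set where
      field
        R      : Job → Bool
        covers : ∀ j → e t j < p j → val t j < x → R j ≡ true
        low    : ∀ j → R j ≡ true → val t j ≤ x
        ahead  : sum (λ j → (R j ∧ not (is g j)) · e* t j) ≤ sum (λ j → R j · e t j)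

    -- The processed job belongs to `R`, so the right side of `ahead` gains exactly one unit, while
    -- a single machine lets `T` gain at most one.
    keep : ∀ {t x g w κ} → choice t ≡ just (w , κ) → val t w < x → Window t x g → Window (suc t) x g
    keep {t} {x} {g} {w} {κ} ch v<x win = record
      { R      = R
      ; covers = λ j e<p v<x → covers j (≤-<-trans (e-mono t j) e<p) (≤-<-trans (val-mono t j) v<x)
      ; low    = low′
      ; ahead  = ahead′
      }
      where
      open Window win
      Rw : R w ≡ true
      Rw = covers w (proj₂ (chosen-alive t ch)) v<x
      e-eq : ∀ j → e (suc t) j ≡ is (just w) j · 1 + e t j
      e-eq j = cong (λ m → is (Maybe.map proj₁ m) j · 1 + e t j) ch
      low′ : ∀ j → R j ≡ true → val (suc t) j ≤ x
      low′ j Rj with is-cases (just w) j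
      -- A member processed at value `x - 1` reaches `x` and stays in `R`: hence `≤` in `low`
      -- against `<` in `covers`.
      ... | inj₁ (refl , _) = ≤-trans (val-suc t w) v<x
      ... | inj₂ (_ , eq)   = ≤-trans (≤-reflexive (cong (_⊓ (q j ∸ 1)) (trans (e-eq j) (cong (λ b → b · 1 + e t j) eq)))) (low j Rj)
      open ≤-Reasoning
      R′ : Job → Bool
      R′ j = R j ∧ not (is g j)
      worked : sum (λ j → R j · (is (just w) j · 1)) ≡ 1
      worked = trans (sum-cong-≗ swap) (trans (sum-is w (λ j → R j · 1)) (cong (_· 1) Rw))
        where
        swap : ∀ j → R j · (is (just w) j · 1) ≡ is (just w) j · (R j · 1)
        swap j with R j | is (just w) j
        ... | true  | _     = refl
        ... | false | true  = refl
        ... | false | false = refl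
      ahead′ : sum (λ j → R′ j · e* (suc t) j) ≤ sum (λ j → R j · e (suc t) j)
      ahead′ = begin
        sum (λ j → R′ j · e* (suc t) j)                                        ≡⟨ sum-cong-≗ (λ j → trans (cong (R′ j ·_) (elapsed-suc I T j t)) (·-+ (R′ j) (is (T t) j · 1) (e* t j))) ⟩
        sum (λ j → R′ j · (is (T t) j · 1) + R′ j · e* t j)                    ≡⟨ ∑-distrib-+ (λ j → R′ j · (is (T t) j · 1)) (λ j → R′ j · e* t j) ⟩
        sum (λ j → R′ j · (is (T t) j · 1)) + sum (λ j → R′ j · e* t j)        ≤⟨ +-mono-≤ (≤-trans (sum-mono (λ j → ·-≤ (R′ j))) (sum-is-≤1 (T t))) ahead ⟩
        1 + sum (λ j → R j · e t j)                                            ≡⟨ cong (_+ sum (λ j → R j · e t j)) worked ⟨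
        sum (λ j → R j · (is (just w) j · 1)) + sum (λ j → R j · e t j)        ≡⟨ ∑-distrib-+ (λ j → R j · (is (just w) j · 1)) (λ j → R j · e t j) ⟨
        sum (λ j → R j · (is (just w) j · 1) + R j · e t j)                    ≡⟨ sum-cong-≗ (λ j → sym (trans (cong (R j ·_) (e-eq j)) (·-+ (R j) (is (just w) j · 1) (e t j)))) ⟩
        sum (λ j → R j · e (suc t) j)                                          ∎

    -- When every alive job has value at least `x`, the window starts afresh with the jobs not yet
    -- released, on which neither schedule has worked.
    reset : ∀ {t x} → (∀ j → Alive t j → x ≤ val t j) → Window (suc t) x nothing
    reset {t} {x} high = record
      { R      = λ j → t <ᵇ r j
      ; covers = λ j e<p v<x → <⇒<ᵇ≡ (≰⇒> λ r≤t →
          <⇒≱ v<x (≤-trans (high j (r≤t , ≤-<-trans (e-mono t j) e<p)) (val-mono t j)))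
      ; low    = λ j Rj → ≤-trans (m⊓n≤m _ _) (≤-trans (≤-reflexive (e-unreleased (suc t) j (unreleased j Rj))) z≤n)
      ; ahead  = ≤-trans (≤-reflexive (sum-zero zero-term)) z≤n
      }
      where
      unreleased : ∀ j → (t <ᵇ r j) ≡ true → t < r j
      unreleased j eq with t <ᵇ r j | <ᵇ-reflects-< t (r j)
      ... | true | ofʸ lt = lt
      zero-term : ∀ j → ((t <ᵇ r j) ∧ true) · e* (suc t) j ≡ 0
      zero-term j with t <ᵇ r j | <ᵇ-reflects-< t (r j)
      ... | false | _      = refl
      ... | true  | ofʸ lt = elapsed-unreleased (suc t) j lt

    -- As `reset`, but `g` is alive below the threshold and must be in `R`. Exempting it on the side
    -- of `T` leaves that side zero, whatever `T` did to `g`.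
    only : ∀ {t x} g → val (suc t) g ≤ x → (∀ j → j ≢ g → Alive t j → x ≤ val t j) → Window (suc t) x (just g)
    only {t} {x} g vg≤x high = record
      { R      = R
      ; covers = covers
      ; low    = low
      ; ahead  = ≤-trans (≤-reflexive (sum-zero zero-term)) z≤n
      }
      where
      R : Job → Bool
      R j = (t <ᵇ r j) ∨ is (just g) j
      covers : ∀ j → e (suc t) j < p j → val (suc t) j < x → R j ≡ true
      covers j e<p v<x with is-cases (just g) j
      ... | inj₁ (_ , eq)  = trans (cong ((t <ᵇ r j) ∨_) eq) (Bool.∨-zeroʳ _)
      ... | inj₂ (neq , _) = cong (_∨ is (just g) j) (<⇒<ᵇ≡ (≰⇒> λ r≤t →
        <⇒≱ v<x (≤-trans (high j (neq ∘ cong just ∘ sym) (r≤t , ≤-<-trans (e-mono t j) e<p)) (val-mono t j))))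
      low : ∀ j → R j ≡ true → val (suc t) j ≤ x
      low j Rj with is-cases (just g) j
      ... | inj₁ (refl , _) = vg≤x
      ... | inj₂ (_ , eq) with t <ᵇ r j | <ᵇ-reflects-< t (r j)
      ...   | true  | ofʸ lt = ≤-trans (m⊓n≤m _ _) (≤-trans (≤-reflexive (e-unreleased (suc t) j lt)) z≤n)
      ...   | false | _      with () ← trans (sym eq) Rj
      zero-term : ∀ j → (R j ∧ not (is (just g) j)) · e* (suc t) j ≡ 0
      zero-term j = byValues (t <ᵇ r j) (is (just g) j) (<ᵇ-reflects-< t (r j))
        where
        byValues : ∀ a b → Reflects (t < r j) a → ((a ∨ b) ∧ not b) · e* (suc t) j ≡ 0
        byValues true  true  _        = refl
        byValues true  false (ofʸ lt) = elapsed-unreleased (suc t) j lt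
        byValues false true  _        = refl
        byValues false false _        = refl

    everything : ℕ
    everything = sum q

    val<everything : ∀ t j → val t j < everything
    val<everything t j = ≤-trans (≤-<-trans (m⊓n≤n (e t j) (q j ∸ 1)) (pred<q j)) (term≤sum q j)

    -- A threshold above the exceptional lone job at which the window is exact: a guarded value, or
    -- `everything`, above all values, if no job is guarded.
    Ceiling : ℕ → ℕ → Set
    Ceiling t y = y ≡ everything ⊎ ∃[ a ] q a ≤ e t a × e t a < p a × kind t a ≡ guarded × y ≡ q a ∸ 1

    -- For windows it only matters whether the processed job has the least value, so `old`, `crowd`
    -- and `alone` merge into `least`; `waits-for` is the exception, with `g` the job passed over.
    data Mode (t : ℕ) : Set where
      idles  : choice t ≡ nothing → (∀ j → ¬ Alive t j) → Mode t
      least  : ∀ {w κ} → choice t ≡ just (w , κ) → (∀ j → Alive t j → val t w ≤ val t j) → Mode t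
      waits-for : ∀ {b κ} g y → choice t ≡ just (b , κ) → q b ≤ e t b → e t g < q g → val t g < val t b →
        (∀ j → Alive t j → val t g ≤ val t j) → (∀ j → j ≢ g → Alive t j → val t b ≤ val t j) →
        Ceiling t y → (∀ a → q a ≤ e t a → e t a < p a → kind t a ≡ guarded → y ≤ q a ∸ 1) → val t b < y → (∀ u → u ≢ g → r u ≤ t → e t u < q u → y ≤ e t u) → Mode t

    mode : ∀ t → Mode t
    mode t = byChoice (choice t) refl (choice-spec t)
      where
      num : (Status → Bool) → ℕ
      num P = number P (entries (keys t) (st t))
      least-val : ∀ {w s x} → st t w ≡ s → level s ≡ just x → (∀ k {y} → level (st t k) ≡ just y → x ≤ y) →
        ∀ j → Alive t j → val t w ≤ val t j
      least-val eq lv lo j al = ≤-trans (≤-reflexive (sym (level⇒val t _ (trans (cong level eq) lv)))) (lo j (alive⇒level t j al))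
      byChoice : ∀ m → choice t ≡ m → Choice (st t) num m → Mode t
      byChoice _ ch (idle no-level)          = idles ch λ j al → no-level j (alive⇒level t j al)
      byChoice _ ch (old eq lo)              = least ch (least-val eq refl lo)
      byChoice _ ch (crowd eq lo _ _ _)      = least ch (least-val eq refl lo)
      byChoice _ ch (alone eq lo _ _ _)      = least ch (least-val eq refl lo)
      byChoice _ ch (hold {b} {y} {κ} {g} {x} {a} eqb lob eqg log x<y la y<a few) = byCeiling a la y<a few
        where
        vb : y ≡ val t b
        vb = level⇒val t b (cong level eqb)
        vg : x ≡ val t g
        vg = level⇒val t g (cong level eqg)
        others : ∀ z → (∀ u → u ≢ g → r u ≤ t → e t u < q u → z ≤ e t u) → y ≤ z →
          ∀ j → j ≢ g → Alive t j → val t b ≤ val t j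
        others z far y≤z j j≢g al = ≤-trans (≤-reflexive (sym vb)) (byStatus (st t j) refl)
          where
          byStatus : ∀ s → st t j ≡ s → y ≤ val t j
          byStatus pending        eq with () ← trans (sym (alive⇒level t j al)) (cong level eq)
          byStatus finished       eq with () ← trans (sym (alive⇒level t j al)) (cong level eq)
          byStatus (fresh v)      eq with fresh⇒ t j eq
          ... | r≤t , e<q , _ = ≤-trans y≤z (≤-trans (far j j≢g r≤t e<q) (≤-reflexive (sym (val-fresh t j e<q))))
          byStatus (signaled _ v) eq = ≤-trans (lob j eq) (≤-reflexive (level⇒val t j (cong level eq)))
        build : ∀ z → Ceiling t z → (∀ a → q a ≤ e t a → e t a < p a → kind t a ≡ guarded → z ≤ q a ∸ 1) → val t b < z → (∀ u → u ≢ g → r u ≤ t → e t u < q u → z ≤ e t u) → Mode t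
        build z ceil low vb<z far = waits-for g z ch (proj₁ (proj₂ (signaled⇒ t b eqb))) (proj₁ (proj₂ (fresh⇒ t g eqg)))
          (subst₂ _<_ vg vb x<y) (least-val eqg refl log) (others z far (≤-trans (≤-reflexive vb) (<⇒≤ vb<z))) ceil low vb<z far
        far-from : ∀ (m : Maybe (Job × ℕ)) → num (isFreshBelow m) < 2 → x isBelow m ≡ true →
          ∀ u → u ≢ g → r u ≤ t → e t u < q u → e t u isBelow m ≡ false
        far-from m few x<m u u≢g r≤t e<q with e t u isBelow m in eu
        ... | false = refl
        -- A second fresh job below the guarded ones would, together with `g`, have made a crowd.
        ... | true  = contradiction
          (≤-trans (≤-reflexive (sym (cong₂ (λ a b → a · 1 + b · 1)
               (trans (cong (isFreshBelow m) (st-fresh {t} {u} r≤t e<q)) eu) (trans (cong (isFreshBelow m) eqg) x<m))))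
             (two-terms≤sum (λ j → isFreshBelow m (st t j) · 1) u g u≢g))
          (<⇒≱ (≤-trans (≤-reflexive (cong suc (sym (number≡count t (isFreshBelow m) refl)))) few))
        level-of : ∀ {a} → q a ≤ e t a → e t a < p a → kind t a ≡ guarded → guardedLevel (st t a) ≡ just (q a ∸ 1)
        level-of {a} q≤e e<p κ≡ = cong guardedLevel (trans (st-signaled {t} {a} released q≤e e<p) (cong (λ κ → signaled κ (q a ∸ 1)) κ≡))
          where
          released : r a ≤ t
          released = ≮⇒≥ λ t<r → <⇒≱ (≤-trans (q≥1 a) q≤e) (≤-reflexive (e-unreleased t a (<⇒≤ t<r)))
        byCeiling : ∀ a → Lowest guardedLevel (st t) a → y isBelow a ≡ true → num (isFreshBelow a) < 2 → Mode t
        byCeiling nothing (none empty) _ few = build everything (inj₁ refl) (λ a q≤e e<p κ≡ → contradiction (trans (sym (empty a)) (level-of q≤e e<p κ≡)) λ ()) (val<everything t b)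
          λ u u≢g r≤t e<q → contradiction (far-from nothing few refl u u≢g r≤t e<q) λ ()
        byCeiling (just (a , z)) (some eqa lowest-a) y<a few with signaled⇒ t a (guarded⁻ (st t a) eqa)
        ... | _ , q≤e , e<p , κ≡ , z≡ = build z (inj₂ (a , q≤e , e<p , sym κ≡ , z≡)) (λ c q≤e e<p κ≡ → lowest-a c (level-of q≤e e<p κ≡))
          (≤-<-trans (≤-reflexive (sym vb)) y<z)
          λ u u≢g r≤t e<q → notBelow⇒≥ {x = e t u} {z} {a} (far-from (just (a , z)) few (<⇒isBelow {x = x} {z} {a} (<-trans x<y y<z)) u u≢g r≤t e<q)
          where
          y<z : y < z
          y<z = isBelow⇒< {x = y} {z} {a} y<a

    -- As no fresh job has a value between x and y, the exact window at y serves for x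
    -- as well, unless T has an unfinished job with a value in between.
    Near : ℕ → ℕ → Set
    Near t x = ∃[ g ] Window t x (just g) × ∃[ y ] x ≤ y × Window t y nothing ×
               (∀ u → e t u < q u → x < e t u → y ≤ e t u)

    -- Exactness at guarded values survives exceptions, because the lone job processed then lies
    -- below all of them; this is what supplies the second window in `Near`.
    record Windowed (t : ℕ) : Set where
      field
        window      : ∀ x → Window t x nothing ⊎ Near t x
        at-guarded  : ∀ a → q a ≤ e t a → e t a < p a → kind t a ≡ guarded → Window t (q a ∸ 1) nothing
        at-top      : Window t everything nothing

      at-ceiling : ∀ {y} → Ceiling t y → Window t y nothing
      at-ceiling (inj₁ refl) = at-top
      at-ceiling (inj₂ (a , q≤e , e<p , κ≡ , refl)) = at-guarded a q≤e e<p κ≡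

    windowed-zero : Windowed 0
    windowed-zero = record
      { window     = λ x → inj₁ (initial x)
      ; at-guarded = λ a _ _ _ → initial _
      ; at-top     = initial _
      }
      where
      initial : ∀ x → Window 0 x nothing
      initial x = record
        { R      = λ _ → true
        ; covers = λ _ _ _ → refl
        ; low    = λ _ _ → z≤n
        ; ahead  = ≤-refl
        }

    module _ {t : ℕ} (wd : Windowed t) where
      open Windowed wd

      unprocessed : ∀ {w κ} → choice t ≡ just (w , κ) → ∀ j → j ≢ w → e (suc t) j ≡ e t j × kind (suc t) j ≡ kind t j
      unprocessed ch j j≢w = byWork (work t j) (newKind-other t ch j j≢w)
        where
        byWork : ∀ {m} → Work t j m → m ≡ nothing → e (suc t) j ≡ e t j × kind (suc t) j ≡ kind t j
        byWork (rests eq kq) _ = eq , kq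

      keep-near : ∀ {x w κ} → choice t ≡ just (w , κ) → val t w < x → Near t x → Near (suc t) x
      keep-near {x} {w} ch v<x (g , win , y , x≤y , winy , gap) =
        g , keep ch v<x win , y , x≤y , keep ch (<-≤-trans v<x x≤y) winy , gap′
        where
        gap′ : ∀ u → e (suc t) u < q u → x < e (suc t) u → y ≤ e (suc t) u
        gap′ u e<q x<e with u Fin.≟ w
        -- The processed job was below `x` and rises to at most `x`, so it cannot enter the gap.
        ... | yes refl = contradiction (≤-trans (≤-reflexive (sym (val-fresh (suc t) w e<q))) (≤-trans (val-suc t w) v<x)) (<⇒≱ x<e)
        ... | no u≢w with proj₁ (unprocessed ch u u≢w)
        ...   | eq = subst (λ z → z < q u → x < z → y ≤ z) (sym eq) (gap u) e<q x<e

      keep-window : ∀ {x w κ} → choice t ≡ just (w , κ) → val t w < x → Window (suc t) x nothing ⊎ Near (suc t) x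
      keep-window {x} ch v<x with window x
      ... | inj₁ win  = inj₁ (keep ch v<x win)
      ... | inj₂ near = inj₂ (keep-near ch v<x near)

      windowed-suc : Windowed (suc t)
      windowed-suc with mode t
      ... | idles ch none-alive = record
        { window     = λ x → inj₁ anywhere
        ; at-guarded = λ a _ _ _ → anywhere
        ; at-top     = anywhere
        }
        where
        anywhere : ∀ {x} → Window (suc t) x nothing
        anywhere = reset λ j al → contradiction al (none-alive j)
      ... | least {w} ch lo = record
        { window     = window′
        ; at-guarded = at-guarded′
        ; at-top     = keep ch (val<everything t w) at-top
        }
        where
        low-window : ∀ {x} → x ≤ val t w → Window (suc t) x nothing
        low-window x≤v = reset λ j al → ≤-trans x≤v (lo j al)
        window′ : ∀ x → Window (suc t) x nothing ⊎ Near (suc t) x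
        window′ x with x ≤? val t w
        ... | yes x≤v = inj₁ (low-window x≤v)
        ... | no x≰v  = keep-window ch (≰⇒> x≰v)
        at-guarded′ : ∀ a → q a ≤ e (suc t) a → e (suc t) a < p a → kind (suc t) a ≡ guarded → Window (suc t) (q a ∸ 1) nothing
        at-guarded′ a q≤e e<p κ≡ with (q a ∸ 1) ≤? val t w
        ... | yes v≤ = low-window v≤
        ... | no v≰ with a Fin.≟ w
        ...   | no a≢w with unprocessed ch a a≢w
        ...     | eq , kq = keep ch (≰⇒> v≰) (at-guarded a (subst (q a ≤_) eq q≤e) (subst (_< p a) eq e<p) (trans (sym kq) κ≡))
        -- Even if the signal came in this very unit, the value was already `q a ∸ 1` before it:
        -- freezing the value before the triggering unit pays off here.
        at-guarded′ a q≤e e<p κ≡ | no v≰ | yes refl = contradiction (⊓-glb (∸-monoˡ-≤ 1 q≤suc) ≤-refl) v≰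
          where
          q≤suc : q a ≤ suc (e t a)
          q≤suc = ≤-trans q≤e (+-monoˡ-≤ (e t a) (·-≤ (is (S t) a)))
      ... | waits-for {b} g y ch q≤e e<q vg<vb lo others ceil low vb<y far = record
        { window     = window′
        ; at-guarded = at-guarded′
        ; at-top     = keep ch (val<everything t b) at-top
        }
        where
        g≢b : g ≢ b
        g≢b refl = <⇒≱ e<q q≤e
        val-g : val (suc t) g ≡ val t g
        val-g = cong (_⊓ (q g ∸ 1)) (proj₁ (unprocessed ch g g≢b))
        gap : ∀ {x} → val t g < x → ∀ u → e (suc t) u < q u → x < e (suc t) u → y ≤ e (suc t) u
        gap {x} vg<x u e<q′ x<e with u Fin.≟ b
        ... | yes refl = contradiction q≤e (<⇒≱ (≤-<-trans (e-mono t u) e<q′))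
        ... | no u≢b with proj₁ (unprocessed ch u u≢b) | u Fin.≟ g
        ...   | eq | yes refl = contradiction (≤-trans (≤-reflexive (trans (sym (val-fresh (suc t) g e<q′)) val-g)) (<⇒≤ vg<x)) (<⇒≱ x<e)
        ...   | eq | no u≢g = ≤-trans (far u u≢g released (subst (_< q u) eq e<q′)) (≤-reflexive (sym eq))
          where
          released : r u ≤ t
          released = ≮⇒≥ λ t<r → <⇒≱ (≤-<-trans z≤n x<e) (≤-reflexive (e-unreleased (suc t) u t<r))
        window′ : ∀ x → Window (suc t) x nothing ⊎ Near (suc t) x
        window′ x with x ≤? val t g | x ≤? val t b
        ... | yes x≤vg | _        = inj₁ (reset λ j al → ≤-trans x≤vg (lo j al))
        ... | no _     | no x≰vb  = keep-window ch (≰⇒> x≰vb)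
        -- Here `g` is the only alive job that may lie below the threshold, so the window restarts
        -- with `g` exempt, and the ceiling of the exception provides the exact one.
        ... | no x≰vg  | yes x≤vb = inj₂
          ( g , only g (≤-trans (≤-reflexive val-g) (<⇒≤ (≰⇒> x≰vg))) (λ j j≢g al → ≤-trans x≤vb (others j j≢g al))
          , y , <⇒≤ (≤-<-trans x≤vb vb<y) , keep ch vb<y (at-ceiling ceil) , gap (≰⇒> x≰vg) )
        at-guarded′ : ∀ a → q a ≤ e (suc t) a → e (suc t) a < p a → kind (suc t) a ≡ guarded → Window (suc t) (q a ∸ 1) nothing
        at-guarded′ a qa≤e e<p κ≡ with a Fin.≟ b
        ... | no a≢b with unprocessed ch a a≢b
        ...     | eq , kq = keep ch vb<v (at-guarded a (subst (q a ≤_) eq qa≤e) (subst (_< p a) eq e<p) (trans (sym kq) κ≡))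
          where
          vb<v : val t b < q a ∸ 1
          vb<v = <-≤-trans vb<y (low a (subst (q a ≤_) eq qa≤e) (subst (_< p a) eq e<p) (trans (sym kq) κ≡))
        -- The processed job cannot be guarded, since its value is below the ceiling, which bounds
        -- all guarded values from below.
        at-guarded′ a qa≤e e<p κ≡ | yes refl = contradiction
          (≤-trans (low b q≤e (≤-<-trans (e-mono t b) e<p) (trans (sym (same-kind (work t b))) κ≡)) (≤-reflexive (sym (val-signaled t b q≤e))))
          (<⇒≱ vb<y)
          where
          same-kind : ∀ {m} → Work t b m → kind (suc t) b ≡ kind t b
          same-kind (rests _ kq)     = kq
          same-kind (works _ _ _ _ kq) = kq q≤e

    windowed : ∀ t → Windowed t
    windowed zero    = windowed-zero
    windowed (suc t) = windowed-suc (windowed t)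

  -- Unfinished jobs at a fixed time

  maximum : ∀ {n} → (Fin n → ℕ) → ℕ
  maximum {zero}  f = 0
  maximum {suc n} f = f zero ⊔ maximum (λ j → f (suc j))

  term≤maximum : ∀ {n} (f : Fin n → ℕ) j → f j ≤ maximum f
  term≤maximum f zero    = m≤m⊔n _ _
  term≤maximum f (suc j) = ≤-trans (term≤maximum (λ j → f (suc j)) j) (m≤n⊔m (f zero) _)

  maximum≤ : ∀ {n} (f : Fin n → ℕ) {b} → (∀ j → f j ≤ b) → maximum f ≤ b
  maximum≤ {zero}  f le = z≤n
  maximum≤ {suc n} f le = ⊔-lub (le zero) (maximum≤ (λ j → f (suc j)) (λ j → le (suc j)))

  below-≤ : ∀ {w x} → w ≤ x → below w x ≡ w
  below-≤ {w} {x} w≤x = cong (_· w) (dec-true (w ≤? x) w≤x)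

  below-mono : ∀ w {x y} → x ≤ y → below w x ≤ below w y
  below-mono w {x} {y} x≤y with w ≤ᵇ x | ≤ᵇ-reflects-≤ w x
  ... | false | _       = z≤n
  ... | true  | ofʸ w≤x = ≤-reflexive (sym (below-≤ (≤-trans w≤x x≤y)))

  -- The fraction `m / d` is `ε`; the three hypotheses are `ε ≤ ½` and the two bounds on the
  -- thresholds, cleared of denominators and subtraction.
  module LocalBound (I : Instance) (q≥1 : ∀ j → 1 ≤ Instance.q I j) (q<p : ∀ j → Instance.q I j < Instance.p I j)
    (T : Instance.Schedule I) (T-feasible : Instance.Feasible I T)
    (m d : ℕ) (2m≤d : 2 * m ≤ d)
    (mp≤dq : ∀ j → m * Instance.p I j ≤ d * Instance.q I j)
    (dq+mp≤dp : ∀ j → d * Instance.q I j + m * Instance.p I j ≤ d * Instance.p I j)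
    (t : ℕ) where
    open Instance I
    open Run I q≥1 q<p
    open Counting I q≥1 q<p
    open Elapsed I T T-feasible
    open Windows I q≥1 q<p T T-feasible
    open Windowed (windowed t)

    m≤d : m ≤ d
    m≤d = ≤-trans (m≤n*m m 2) 2m≤d

    o u : Job → Bool
    o j = (r j ≤ᵇ t) ∧ (e* t j <ᵇ p j)
    u j = isFresh (st t j) ∧ not (o j)

    a : Job → ℕ
    a j = suc (val t j)

    -- The error caused by an exceptional job at a threshold x is charged to an o-job
    -- whose value lies above x with no u-job in between; π recovers x up to 2.
    π : Job → ℕ
    π j = suc (maximum (λ i → (u i ∧ (val t i <ᵇ val t j)) · a i))

    ∧-true : ∀ {b c} → b ∧ c ≡ true → b ≡ true × c ≡ true
    ∧-true {true} eq = refl , eq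

    isFresh⇒ : ∀ j → isFresh (st t j) ≡ true → r j ≤ t × e t j < q j
    isFresh⇒ j eq = byStatus (st t j) refl eq
      where
      byStatus : ∀ s → st t j ≡ s → isFresh s ≡ true → r j ≤ t × e t j < q j
      byStatus (fresh x) eq _ with fresh⇒ t j eq
      ... | r≤t , e<q , _ = r≤t , e<q

    u⇒fresh : ∀ j → u j ≡ true → r j ≤ t × e t j < q j
    u⇒fresh j eq = isFresh⇒ j (proj₁ (∧-true eq))

    done* : ∀ j → o j ≡ false → r j ≤ t → p j ≤ e* t j
    done* j oj r≤t = ≮⇒≥ λ e<p → contradiction
      (trans (sym (cong₂ _∧_ (dec-true (r j ≤? t) r≤t) (<⇒<ᵇ≡ e<p))) oj) λ ()

    e≤e* : ∀ j → o j ≡ false → e t j ≤ e* t j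
    e≤e* j oj with r j ≤? t
    ... | yes r≤t = ≤-trans (e≤p t j) (done* j oj r≤t)
    ... | no r≰t  = ≤-trans (≤-reflexive (e-unreleased t j (<⇒≤ (≰⇒> r≰t)))) z≤n

    a≤q : ∀ j → a j ≤ q j
    a≤q j = ≤-trans (s≤s (m⊓n≤n (e t j) (q j ∸ 1))) (pred<q j)

    -- A fresh job has `e t j` below its weight. For a signaled one the weight is `q j`, at least
    -- `ε` times the processing time, which bounds the elapsed time.
    me≤da : ∀ j → m * e t j ≤ d * a j
    me≤da j with e t j <? q j
    ... | yes e<q = *-mono-≤ m≤d (≤-trans (n≤1+n _) (≤-reflexive (cong suc (sym (val-fresh t j e<q)))))
    ... | no e≮q  = begin
      m * e t j     ≤⟨ *-monoʳ-≤ m (e≤p t j) ⟩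
      m * p j       ≤⟨ mp≤dq j ⟩
      d * q j       ≡⟨ cong (d *_) (sym (m+[n∸m]≡n (q≥1 j))) ⟩
      d * suc (q j ∸ 1) ≡⟨ cong (λ v → d * suc v) (sym (val-signaled t j (≮⇒≥ e≮q))) ⟩
      d * a j       ∎
      where open ≤-Reasoning

    -- The part of a job after its signal has length at least `ε p j`, and the weight is at most
    -- `p j`; so a fresh job has at least `ε a j` left.
    ma+de≤dp : ∀ j → e t j < q j → m * a j + d * e t j ≤ d * p j
    ma+de≤dp j e<q = begin
      m * a j + d * e t j  ≤⟨ +-mono-≤ (*-monoʳ-≤ m (≤-trans (a≤q j) (<⇒≤ (q<p j)))) (*-monoʳ-≤ d (<⇒≤ e<q)) ⟩
      m * p j + d * q j    ≡⟨ +-comm (m * p j) _ ⟩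
      d * q j + m * p j    ≤⟨ dq+mp≤dp j ⟩
      d * p j              ∎
      where open ≤-Reasoning

    small : ℕ → ℕ
    small x = sum (λ j → u j · below (a j) x)

    -- Reaches weight `x + 1`, as `Window.low` admits the value `x`, whereas `small` stops at weight
    -- `x`, as `Window.covers` needs a value below `x`.
    near : ℕ → Job → ℕ
    near x j = (o j ∧ (val t j ≤ᵇ x)) · a j

    -- The exempt job contributes `ε² a + ε e` on the left of `pointwise`; both terms are at most
    -- its weight, which is at most `x + 1`.
    error : ℕ → ℕ
    error x = 2 * (d * d) * suc x

    module _ {x : ℕ} {g : Maybe Job} (win : Window t x g) where
      open Window win

      -- Divided by `d * d`, this charges each job separately. A `u`-job is finished in `T`, so
      -- `e* ≥ p ≥ e + ε a`, and a factor `ε` gives the claim. An `o`-job pays `ε e` by its weight.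
      -- For other jobs `e ≤ e*`, and the exempt one goes to `error`.
      pointwise : ∀ j → m * m * (u j · below (a j) x) + m * d * (R j · e t j)
                      ≤ d * d * near x j + m * d * ((R j ∧ not (is g j)) · e* t j) + is g j · error x
      pointwise j = byCases (R j) refl (is g j) (u j) refl (o j) refl (a j ≤? x)
        where
        open ≤-Reasoning
        mme : m * d * e t j ≤ d * d * a j
        mme = begin
          m * d * e t j    ≡⟨ swap m d (e t j) ⟩
          d * (m * e t j)  ≤⟨ *-monoʳ-≤ d (me≤da j) ⟩
          d * (d * a j)    ≡⟨ *-assoc d d (a j) ⟨
          d * d * a j      ∎
          where
          swap : ∀ x y z → x * y * z ≡ y * (x * z)
          swap = solve-∀
        byCases : ∀ R′ → R j ≡ R′ → ∀ g′ u′ → u j ≡ u′ → ∀ o′ → o j ≡ o′ → Dec (a j ≤ x) →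
          m * m * (u′ · below (a j) x) + m * d * (R′ · e t j)
          ≤ d * d * ((o′ ∧ (val t j ≤ᵇ x)) · a j) + m * d * ((R′ ∧ not g′) · e* t j) + g′ · error x
        byCases false Rj g′ true uj o′ _ (yes a≤x) = contradiction
          (trans (sym Rj) (covers j (<-trans (proj₂ (u⇒fresh j uj)) (q<p j)) a≤x)) λ ()
        byCases false Rj g′ true uj o′ _ (no a≰x) = begin
          m * m * below (a j) x + m * d * 0 ≡⟨ cong₂ _+_ (trans (cong (λ b → m * m * (b · a j)) (dec-false (a j ≤? x) a≰x)) (*-zeroʳ (m * m))) (*-zeroʳ (m * d)) ⟩
          0                                 ≤⟨ z≤n ⟩
          _                                 ∎
        byCases false Rj g′ false uj o′ _ _ = begin
          m * m * 0 + m * d * 0             ≡⟨ cong₂ _+_ (*-zeroʳ (m * m)) (*-zeroʳ (m * d)) ⟩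
          0                                 ≤⟨ z≤n ⟩
          _                                 ∎
        byCases true Rj true u′ uj o′ _ _ = begin
          m * m * (u′ · below (a j) x) + m * d * e t j
            ≤⟨ +-mono-≤ (*-mono-≤ (*-mono-≤ m≤d m≤d) (≤-trans (·-≤ u′) (·-≤ (a j ≤ᵇ x)))) mme ⟩
          d * d * a j + d * d * a j
            ≤⟨ +-mono-≤ (*-monoʳ-≤ (d * d) (s≤s (low j Rj))) (*-monoʳ-≤ (d * d) (s≤s (low j Rj))) ⟩
          d * d * suc x + d * d * suc x
            ≡⟨ double (d * d) (suc x) ⟩
          error x
            ≤⟨ m≤n+m (error x) _ ⟩
          _ ∎
          where
          double : ∀ y z → y * z + y * z ≡ 2 * y * z
          double = solve-∀
        byCases true Rj false u′ uj true oj _ = begin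
          m * m * (u′ · below (a j) x) + m * d * e t j
            ≡⟨ cong (_+ m * d * e t j) (trans (cong (λ b → m * m * (b · below (a j) x)) u′≡false) (*-zeroʳ (m * m))) ⟩
          m * d * e t j
            ≤⟨ mme ⟩
          d * d * a j
            ≡⟨ cong (λ b → d * d * (b · a j)) (sym (dec-true (val t j ≤? x) (low j Rj))) ⟩
          d * d * ((val t j ≤ᵇ x) · a j)
            ≤⟨ m≤m+n _ _ ⟩
          d * d * ((val t j ≤ᵇ x) · a j) + m * d * e* t j
            ≡⟨ +-identityʳ _ ⟨
          _ ∎
          where
          u′≡false : u′ ≡ false
          u′≡false = trans (sym uj) (trans (cong (λ b → isFresh (st t j) ∧ not b) oj) (Bool.∧-zeroʳ _))
        byCases true Rj false true uj false oj _ = begin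
          m * m * below (a j) x + m * d * e t j
            ≤⟨ +-monoˡ-≤ (m * d * e t j) (*-monoʳ-≤ (m * m) (·-≤ (a j ≤ᵇ x))) ⟩
          m * m * a j + m * d * e t j
            ≡⟨ factor m d (a j) (e t j) ⟩
          m * (m * a j + d * e t j)
            ≤⟨ *-monoʳ-≤ m (ma+de≤dp j (proj₂ (u⇒fresh j uj))) ⟩
          m * (d * p j)
            ≤⟨ *-monoʳ-≤ m (*-monoʳ-≤ d (done* j oj (proj₁ (u⇒fresh j uj)))) ⟩
          m * (d * e* t j)
            ≡⟨ *-assoc m d (e* t j) ⟨
          m * d * e* t j
            ≤⟨ m≤n+m (m * d * e* t j) (d * d * 0) ⟩
          d * d * 0 + m * d * e* t j
            ≡⟨ +-identityʳ _ ⟨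
          _ ∎
          where
          factor : ∀ x y z w → x * x * z + x * y * w ≡ x * (x * z + y * w)
          factor = solve-∀
        byCases true Rj false false uj false oj _ = begin
          m * m * 0 + m * d * e t j   ≡⟨ cong (_+ m * d * e t j) (*-zeroʳ (m * m)) ⟩
          m * d * e t j               ≤⟨ *-monoʳ-≤ (m * d) (e≤e* j oj) ⟩
          m * d * e* t j              ≤⟨ m≤n+m (m * d * e* t j) (d * d * 0) ⟩
          d * d * 0 + m * d * e* t j  ≡⟨ +-identityʳ _ ⟨
          _                           ∎

      -- Summing `pointwise` leaves the elapsed times of both schedules on `R`, and `ahead` cancels
      -- them.
      prefix : m * m * small x ≤ d * d * sum (near x) + sum (λ j → is g j · error x)
      prefix = +-cancelʳ-≤ (m * d * sum f) _ _ (begin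
        m * m * small x + m * d * sum f
          ≡⟨ cong₂ _+_ (*-distribˡ-sum (m * m) (λ j → u j · below (a j) x)) (*-distribˡ-sum (m * d) f) ⟩
        sum (λ j → m * m * (u j · below (a j) x)) + sum (λ j → m * d * f j)
          ≡⟨ ∑-distrib-+ (λ j → m * m * (u j · below (a j) x)) (λ j → m * d * f j) ⟨
        sum (λ j → m * m * (u j · below (a j) x) + m * d * f j)
          ≤⟨ sum-mono pointwise ⟩
        sum (λ j → d * d * near x j + m * d * f* j + is g j · error x)
          ≡⟨ ∑-distrib-+ (λ j → d * d * near x j + m * d * f* j) (λ j → is g j · error x) ⟩
        sum (λ j → d * d * near x j + m * d * f* j) + sum (λ j → is g j · error x)
          ≡⟨ cong (_+ E) (∑-distrib-+ (λ j → d * d * near x j) (λ j → m * d * f* j)) ⟩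
        sum (λ j → d * d * near x j) + sum (λ j → m * d * f* j) + sum (λ j → is g j · error x)
          ≡⟨ cong (_+ E) (cong₂ _+_ (*-distribˡ-sum (d * d) (near x)) (*-distribˡ-sum (m * d) f*)) ⟨
        d * d * sum (near x) + m * d * sum f* + sum (λ j → is g j · error x)
          ≤⟨ +-monoˡ-≤ E (+-monoʳ-≤ (d * d * sum (near x)) (*-monoʳ-≤ (m * d) ahead)) ⟩
        d * d * sum (near x) + m * d * sum f + sum (λ j → is g j · error x)
          ≡⟨ swap (d * d * sum (near x)) (m * d * sum f) E ⟩
        d * d * sum (near x) + sum (λ j → is g j · error x) + m * d * sum f ∎)
        where
        open ≤-Reasoning
        E = sum (λ j → is g j · error x)
        f f* : Job → ℕ
        f j  = R j · e t j
        f* j = (R j ∧ not (is g j)) · e* t j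
        swap : ∀ x y z → x + y + z ≡ x + z + y
        swap = solve-∀

    prefix-exact : ∀ {x} → Window t x nothing → m * m * small x ≤ d * d * sum (near x)
    prefix-exact {x} win = ≤-trans (prefix win) (≤-reflexive
      (trans (cong (d * d * sum (near x) +_) (sum-zero {n} {λ j → is nothing j · error x} (λ _ → refl))) (+-identityʳ _)))

    w₁ w₂ : ℕ → Job → ℕ
    w₁ x j = o j · below (a j) (3 * x)
    w₂ x j = o j · below (π j) (3 * x)

    -- The weight `a` serves for `near`, and twice `π` for `error x`, which is `2 * suc x` up to the
    -- scaling. The threshold `3 * x` leaves room for weights up to `x + 2`, as `x ≥ 1`.
    W : ℕ → ℕ
    W x = sum (λ j → o j · (below (a j) (3 * x) + 2 * below (π j) (3 * x)))

    W-split : ∀ x → W x ≡ sum (w₁ x) + 2 * sum (w₂ x)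
    W-split x = trans
      (sum-cong-≗ (λ j → trans (·-+ (o j) (below (a j) (3 * x)) (2 * below (π j) (3 * x)))
                               (cong (w₁ x j +_) (·-* (o j) 2 (below (π j) (3 * x))))))
      (trans (∑-distrib-+ (w₁ x) (λ j → 2 * w₂ x j)) (cong (sum (w₁ x) +_) (sym (*-distribˡ-sum 2 (w₂ x)))))

    2+x≤3x : ∀ {x} → 1 ≤ x → suc (suc x) ≤ 3 * x
    2+x≤3x {suc x} _ = ≤-trans (m≤m+n (3 + x) (x + x)) (≤-reflexive (eq x))
      where
      eq : ∀ x → 3 + x + (x + x) ≡ 3 * suc x
      eq = solve-∀

    near≤w₁ : ∀ {x y} → 1 ≤ x → (∀ j → o j ≡ true → val t j ≤ y → val t j ≤ x) → ∀ j → near y j ≤ w₁ x j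
    near≤w₁ {x} {y} x≥1 pure j = byCases (o j) refl (val t j ≤? y)
      where
      byCases : ∀ o′ → o j ≡ o′ → Dec (val t j ≤ y) → (o′ ∧ (val t j ≤ᵇ y)) · a j ≤ o′ · below (a j) (3 * x)
      byCases false _  _         = z≤n
      byCases true  oj (no v≰y)  = ≤-trans (≤-reflexive (cong (_· a j) (dec-false (val t j ≤? y) v≰y))) z≤n
      byCases true  oj (yes v≤y) = ≤-trans (·-≤ (val t j ≤ᵇ y))
        (≤-reflexive (sym (below-≤ (≤-trans (s≤s (pure j oj v≤y)) (≤-trans (n≤1+n _) (2+x≤3x x≥1))))))

    small-mono : ∀ {x y} → x ≤ y → small x ≤ small y
    small-mono x≤y = sum-mono (λ j → ·-mono (u j) (below-mono (a j) x≤y))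

    -- The threshold has to be the weight of a `u`-job: this is what lets `π` recover it from below.
    prefix-bound : ∀ i → u i ≡ true → m * m * small (a i) ≤ d * d * W (a i)
    prefix-bound i ui = byWindow (window x)
      where
      open ≤-Reasoning
      x = a i
      sum-near : ∀ {y} → (∀ j → o j ≡ true → val t j ≤ y → val t j ≤ x) → d * d * sum (near y) ≤ d * d * W x
      sum-near pure = *-monoʳ-≤ (d * d) (≤-trans (sum-mono (near≤w₁ (s≤s z≤n) pure))
        (≤-trans (m≤m+n (sum (w₁ x)) _) (≤-reflexive (sym (W-split x)))))
      byWindow : Window t x nothing ⊎ Near t x → m * m * small x ≤ d * d * W x
      byWindow (inj₁ win) = ≤-trans (prefix-exact win) (sum-near (λ _ _ v≤x → v≤x))
      byWindow (inj₂ (g , win , y , x≤y , winy , gap))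
        with Fin.any? (λ j → (o j Bool.≟ true) ×-dec (x <? val t j) ×-dec (val t j ≤? y))
      -- No unfinished job of `T` has a value between `x` and `y`, so the exact window at `y` counts
      -- the same `near` jobs as one at `x` would.
      ... | no pure = ≤-trans (*-monoʳ-≤ (m * m) (small-mono x≤y)) (≤-trans (prefix-exact winy)
        (sum-near (λ j oj v≤y → ≮⇒≥ λ x<v → pure (j , oj , x<v , v≤y))))
      -- The `o`-job `j` in between pays for the error: `x + 1 ≤ π j` because of `i`, and
      -- `π j ≤ x + 2` because of the gap.
      ... | yes (j , oj , x<v , v≤y) = begin
        m * m * small x                                        ≤⟨ prefix win ⟩
        d * d * sum (near x) + sum (λ k → is (just g) k · error x)
                                                           ≡⟨ cong (d * d * sum (near x) +_) (sum-is g (λ _ → error x)) ⟩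
        d * d * sum (near x) + error x                     ≤⟨ +-mono-≤ (*-monoʳ-≤ (d * d) (sum-mono (near≤w₁ (s≤s z≤n) (λ _ _ v≤x → v≤x)))) paid ⟩
        d * d * sum (w₁ x) + d * d * (2 * sum (w₂ x))      ≡⟨ *-distribˡ-+ (d * d) (sum (w₁ x)) _ ⟨
        d * d * (sum (w₁ x) + 2 * sum (w₂ x))              ≡⟨ cong (d * d *_) (W-split x) ⟨
        d * d * W x                                        ∎
        where
        pred : Job → ℕ
        pred k = (u k ∧ (val t k <ᵇ val t j)) · a k
        x≤pred : x ≤ pred i
        x≤pred = ≤-reflexive (sym (cong₂ (λ b c → (b ∧ c) · a i) ui (<⇒<ᵇ≡ (<-trans (n<1+n _) x<v))))
        pred≤ : ∀ k → pred k ≤ suc x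
        pred≤ k = byCases (u k) refl (val t k <? val t j)
          where
          byCases : ∀ u′ → u k ≡ u′ → Dec (val t k < val t j) → (u′ ∧ (val t k <ᵇ val t j)) · a k ≤ suc x
          byCases false _  _        = z≤n
          byCases true  uk (no k≮j) = ≤-trans (≤-reflexive (cong (_· a k) (dec-false (val t k <? val t j) k≮j))) z≤n
          -- By the gap a `u`-job of value above `x` has value at least `y`, hence is not below `j`.
          byCases true  uk (yes k<j) = ≤-trans (·-≤ (val t k <ᵇ val t j)) (s≤s (≮⇒≥ λ x<k →
            <⇒≱ k<j (≤-trans v≤y (≤-trans (gap k (proj₂ (u⇒fresh k uk)) (subst (x <_) vk x<k)) (≤-reflexive (sym vk))))))
            where
            vk : val t k ≡ e t k
            vk = val-fresh t k (proj₂ (u⇒fresh k uk))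
        paid : error x ≤ d * d * (2 * sum (w₂ x))
        paid = begin
          2 * (d * d) * suc x        ≡⟨ swap (d * d) (suc x) ⟩
          d * d * (2 * suc x)        ≤⟨ *-monoʳ-≤ (d * d) (*-monoʳ-≤ 2 (s≤s (≤-trans x≤pred (term≤maximum pred i)))) ⟩
          d * d * (2 * π j)          ≡⟨ cong (λ z → d * d * (2 * z)) (trans (sym (below-≤ (≤-trans (s≤s (maximum≤ pred pred≤)) (2+x≤3x {x} (s≤s z≤n))))) (cong (_· below (π j) (3 * x)) (sym oj))) ⟩
          d * d * (2 * w₂ x j)       ≤⟨ *-monoʳ-≤ (d * d) (*-monoʳ-≤ 2 (term≤sum (w₂ x) j)) ⟩
          d * d * (2 * sum (w₂ x))   ∎
          where
          swap : ∀ y z → 2 * y * z ≡ y * (2 * z)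
          swap = solve-∀

    -- Between consecutive weights of `u`-jobs `small` is constant while `W` can only grow, so the
    -- thresholds of `prefix-bound` suffice.
    prefix-bounds : ∀ x → m * m * small x ≤ d * d * W x
    prefix-bounds zero = ≤-trans (≤-reflexive (trans (cong (m * m *_) (sum-zero empty)) (*-zeroʳ (m * m)))) z≤n
      where
      empty : ∀ j → u j · below (a j) 0 ≡ 0
      empty j with u j
      ... | true  = refl
      ... | false = refl
    prefix-bounds (suc x) with Fin.any? (λ j → (u j Bool.≟ true) ×-dec (a j ≟ suc x))
    ... | yes (i , ui , eq) = subst (λ y → m * m * small y ≤ d * d * W y) eq (prefix-bound i ui)
    ... | no absent = begin
      m * m * small (suc x) ≤⟨ *-monoʳ-≤ (m * m) (sum-mono skip) ⟩
      m * m * small x       ≤⟨ prefix-bounds x ⟩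
      d * d * W x       ≤⟨ *-monoʳ-≤ (d * d) (sum-mono (λ j → ·-mono (o j) (+-mono-≤ (below-mono (a j) 3x≤) (*-monoʳ-≤ 2 (below-mono (π j) 3x≤))))) ⟩
      d * d * W (suc x) ∎
      where
      open ≤-Reasoning
      3x≤ : 3 * x ≤ 3 * suc x
      3x≤ = *-monoʳ-≤ 3 (n≤1+n x)
      skip : ∀ j → u j · below (a j) (suc x) ≤ u j · below (a j) x
      skip j = byCases (u j) refl (a j ≤? suc x)
        where
        byCases : ∀ u′ → u j ≡ u′ → Dec (a j ≤ suc x) → u′ · below (a j) (suc x) ≤ u′ · below (a j) x
        byCases false _  _        = z≤n
        byCases true  _  (no a≰)  = ≤-trans (≤-reflexive (cong (_· a j) (dec-false (a j ≤? suc x) a≰))) z≤n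
        byCases true  uj (yes a≤) with m≤n⇒m<n∨m≡n a≤
        ... | inj₁ (s≤s a≤x) = ≤-reflexive (trans (below-≤ a≤) (sym (below-≤ a≤x)))
        ... | inj₂ a≡        = contradiction (j , uj , a≡) absent

    #o #u : ℕ
    #o = sum (λ j → o j · 1)
    #u = sum (λ j → u j · 1)

    #u≤#o : m * m * #u ≤ d * d * (9 * #o)
    #u≤#o = weights⇒numbers (m * m) (d * d) u o a a π (λ _ → s≤s z≤n) prefix-bounds

    fresh≤ : count t isFresh ≤ #u + #o
    fresh≤ = ≤-trans (sum-mono split) (≤-reflexive (∑-distrib-+ (λ j → u j · 1) (λ j → o j · 1)))
      where
      split : ∀ j → isFresh (st t j) · 1 ≤ u j · 1 + o j · 1
      split j with isFresh (st t j) | o j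
      ... | false | _     = z≤n
      ... | true  | true  = ≤-refl
      ... | true  | false = ≤-refl

    -- From the exact window above all values: an alive job that `T` has finished puts `T` ahead by
    -- at least one unit. It serves to show that without `o`-jobs nothing is alive.
    alive≤ : count t isAlive ≤ sum (λ j → o j · suc (e t j))
    alive≤ = +-cancelʳ-≤ (sum (λ j → R j · e t j)) _ _ (begin
      count t isAlive + sum (λ j → R j · e t j)
        ≡⟨ ∑-distrib-+ (λ j → isAlive (st t j) · 1) (λ j → R j · e t j) ⟨
      sum (λ j → isAlive (st t j) · 1 + R j · e t j)
        ≤⟨ sum-mono split ⟩
      sum (λ j → o j · suc (e t j) + (R j ∧ true) · e* t j)
        ≡⟨ ∑-distrib-+ (λ j → o j · suc (e t j)) (λ j → (R j ∧ true) · e* t j) ⟩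
      sum (λ j → o j · suc (e t j)) + sum (λ j → (R j ∧ true) · e* t j)
        ≤⟨ +-monoʳ-≤ (sum (λ j → o j · suc (e t j))) ahead ⟩
      sum (λ j → o j · suc (e t j)) + sum (λ j → R j · e t j) ∎)
      where
      open ≤-Reasoning
      open Window at-top
      split : ∀ j → isAlive (st t j) · 1 + R j · e t j ≤ o j · suc (e t j) + (R j ∧ true) · e* t j
      split j = byCases (level (st t j)) refl (R j) refl (o j) refl
        where
        byCases : ∀ l → level (st t j) ≡ l → ∀ R′ → R j ≡ R′ → ∀ o′ → o j ≡ o′ →
          is-just l · 1 + R′ · e t j ≤ o′ · suc (e t j) + (R′ ∧ true) · e* t j
        byCases (just _) lv false Rj o′ _ = contradiction
          (trans (sym Rj) (covers j (proj₂ (level⇒alive {t} {j} lv)) (val<everything t j))) λ ()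
        byCases (just _) lv true _ true  _  = m≤m+n _ _
        byCases (just _) lv true _ false oj with level⇒alive {t} {j} lv
        ... | r≤t , e<p = ≤-trans e<p (done* j oj r≤t)
        byCases nothing _ false _ o′    _  = z≤n
        byCases nothing _ true  _ true  _  = ≤-trans (n≤1+n _) (m≤m+n _ _)
        byCases nothing _ true  _ false oj = e≤e* j oj

    -- The constant is `3 * 9 + 1`: three alive jobs per fresh one, nine `o`-jobs per `u`-job up to
    -- `1 / ε²`, and one for the fresh `o`-jobs and the additive 1.
    local : m * m * count t isAlive ≤ 28 * (d * d) * #o
    local with #o in eq
    ... | zero = ≤-trans (≤-reflexive (trans (cong (m * m *_) (n≤0⇒n≡0 (≤-trans alive≤ (≤-reflexive (sum-zero no-o))))) (*-zeroʳ (m * m)))) z≤n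
      where
      no-o : ∀ j → o j · suc (e t j) ≡ 0
      no-o j with o j | ≤-trans (term≤sum (λ j → o j · 1) j) (≤-reflexive eq)
      ... | false | _ = refl
    ... | suc k = begin
      m * m * count t isAlive              ≤⟨ *-monoʳ-≤ (m * m) (≤-trans (alive≤fresh t) (+-monoˡ-≤ 1 (*-monoʳ-≤ 3 fresh≤))) ⟩
      -- With at least one `o`-job the additive 1 is at most their number.
      m * m * (3 * (#u + #o) + 1)          ≤⟨ *-monoʳ-≤ (m * m) (+-monoʳ-≤ (3 * (#u + #o)) (s≤s z≤n)) ⟩
      m * m * (3 * (#u + #o) + suc k)      ≡⟨ cong (λ z → m * m * (3 * (#u + z) + suc k)) eq ⟩
      m * m * (3 * (#u + suc k) + suc k)   ≡⟨ expand m #u (suc k) ⟩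
      -- The `o`-jobs have factor `4 * (m * m)`, at most `d * d` because `ε ≤ ½`.
      3 * (m * m * #u) + 2 * m * (2 * m) * suc k ≤⟨ +-mono-≤ (*-monoʳ-≤ 3 #u≤#o) (*-monoˡ-≤ (suc k) (*-mono-≤ 2m≤d 2m≤d)) ⟩
      3 * (d * d * (9 * #o)) + d * d * suc k     ≡⟨ cong (λ z → 3 * (d * d * (9 * z)) + d * d * suc k) eq ⟩
      3 * (d * d * (9 * suc k)) + d * d * suc k  ≡⟨ collect (d * d) (suc k) ⟩
      28 * (d * d) * suc k                 ∎
      where
      open ≤-Reasoning
      expand : ∀ m u o → m * m * (3 * (u + o) + o) ≡ 3 * (m * m * u) + 2 * m * (2 * m) * o
      expand = solve-∀
      collect : ∀ x o → 3 * (x * (9 * o)) + x * o ≡ 28 * x * o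
      collect = solve-∀

  -- Total flow time

  sumBelow : (ℕ → ℕ) → ℕ → ℕ
  sumBelow f zero    = 0
  sumBelow f (suc H) = f H + sumBelow f H

  sumBelow-mono : ∀ a b {f g} → (∀ t → a * f t ≤ b * g t) → ∀ H → a * sumBelow f H ≤ b * sumBelow g H
  sumBelow-mono a b le zero    = ≤-trans (≤-reflexive (*-zeroʳ a)) z≤n
  sumBelow-mono a b {f} {g} le (suc H) = begin
    a * (f H + sumBelow f H)      ≡⟨ *-distribˡ-+ a (f H) _ ⟩
    a * f H + a * sumBelow f H    ≤⟨ +-mono-≤ (le H) (sumBelow-mono a b le H) ⟩
    b * g H + b * sumBelow g H    ≡⟨ *-distribˡ-+ b (g H) _ ⟨
    b * (g H + sumBelow g H)      ∎
    where open ≤-Reasoning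

  sumBelow-cong : ∀ {f g} → (∀ t → f t ≡ g t) → ∀ H → sumBelow f H ≡ sumBelow g H
  sumBelow-cong eq zero    = refl
  sumBelow-cong eq (suc H) = cong₂ _+_ (eq H) (sumBelow-cong eq H)

  sumBelow-sum : ∀ {n} (f : ℕ → Fin n → ℕ) H → sumBelow (λ t → sum (f t)) H ≡ sum (λ j → sumBelow (λ t → f t j) H)
  sumBelow-sum {n} f zero    = sym (sum-zero {n} (λ _ → refl))
  sumBelow-sum f (suc H) = trans (cong (sum (f H) +_) (sumBelow-sum f H)) (sym (∑-distrib-+ (f H) _))

  sumBelow-interval : ∀ r c H → sumBelow (λ t → ((r ≤ᵇ t) ∧ (t <ᵇ c)) · 1) H ≡ c ⊓ H ∸ r
  sumBelow-interval r c zero    = sym (trans (cong (_∸ r) (⊓-zeroʳ c)) (0∸n≡0 r))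
  sumBelow-interval r c (suc H) = trans (cong (((r ≤ᵇ H) ∧ (H <ᵇ c)) · 1 +_) (sumBelow-interval r c H)) last
    where
    last : ((r ≤ᵇ H) ∧ (H <ᵇ c)) · 1 + (c ⊓ H ∸ r) ≡ c ⊓ suc H ∸ r
    last with r ≤ᵇ H | ≤ᵇ-reflects-≤ r H | H <ᵇ c | <ᵇ-reflects-< H c
    ... | true  | ofʸ r≤H | true  | ofʸ H<c = trans (cong (λ z → suc (z ∸ r)) (m≥n⇒m⊓n≡n (<⇒≤ H<c)))
      (trans (sym (+-∸-assoc 1 r≤H)) (cong (_∸ r) (sym (m≥n⇒m⊓n≡n H<c))))
    ... | true  | _       | false | ofⁿ H≮c = cong (_∸ r)
      (trans (m≤n⇒m⊓n≡m (≮⇒≥ H≮c)) (sym (m≤n⇒m⊓n≡m (m≤n⇒m≤1+n (≮⇒≥ H≮c)))))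
    ... | false | ofⁿ r≰H | _     | _       =
      trans (m≤n⇒m∸n≡0 (≤-trans (m⊓n≤n c H) (<⇒≤ (≰⇒> r≰H)))) (sym (m≤n⇒m∸n≡0 (≤-trans (m⊓n≤n c (suc H)) (≰⇒> r≰H))))

  search : {P : Pred ℕ 0ℓ} → Decidable P → ∀ t → (∃[ s ] FirstTime P s) ⊎ (∀ {s} → s < t → ¬ P s)
  search P? zero = inj₂ λ ()
  search {P} P? (suc t) with search P? t
  ... | inj₁ found = inj₁ found
  ... | inj₂ absent with P? t
  ...   | yes Pt = inj₁ (t , Pt , absent)
  ...   | no ¬Pt = inj₂ λ { (s≤s s≤t) Ps → case-≤ (m≤n⇒m<n∨m≡n s≤t) Ps }
    where
    case-≤ : ∀ {s} → s < t ⊎ s ≡ t → ¬ P s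
    case-≤ (inj₁ s<t)  = absent s<t
    case-≤ (inj₂ refl) = ¬Pt

  module FlowTime (I : Instance) (T : Instance.Schedule I) (T-feasible : Instance.Feasible I T) where
    open Instance I
    open Elapsed I T T-feasible

    waiting : ℕ → Job → ℕ
    waiting t j = ((r j ≤ᵇ t) ∧ (elapsed T j t <ᵇ p j)) · 1

    elapsed-mono : ∀ {s t} j → s ≤ t → elapsed T j s ≤ elapsed T j t
    elapsed-mono {t = zero}  j z≤n = ≤-refl
    elapsed-mono {t = suc t} j s≤t with m≤n⇒m<n∨m≡n s≤t
    ... | inj₂ refl      = ≤-refl
    ... | inj₁ (s≤s s≤t) = ≤-trans (elapsed-mono j s≤t) (≤-trans (m≤n+m _ _) (≤-reflexive (sym (elapsed-suc I T j t))))

    module _ (c : Job → ℕ) (completes : ∀ j → IsCompletionTime T j (c j)) where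

      unfinished≡ : ∀ t j → (elapsed T j t <ᵇ p j) ≡ (t <ᵇ c j)
      unfinished≡ t j with t <? c j
      ... | yes t<c = trans (<⇒<ᵇ≡ {elapsed T j t} {p j} (≰⇒> λ p≤e → proj₂ (completes j) t<c (m≤n⇒m∸n≡0 p≤e))) (sym (<⇒<ᵇ≡ t<c))
      ... | no t≮c  = trans (≥⇒<ᵇ≡ {elapsed T j t} {p j} (≤-trans (m∸n≡0⇒m≤n (proj₁ (completes j))) (elapsed-mono j (≮⇒≥ t≮c)))) (sym (≥⇒<ᵇ≡ (≮⇒≥ t≮c)))

      -- A job adds one to its flow time in each unit between release and completion, so total flow
      -- time is the number of waiting jobs summed over time. This turns a bound at every time into
      -- a competitive ratio.
      total-flow : ∀ H → (∀ j → c j ≤ H) → sumBelow (λ t → sum (waiting t)) H ≡ sum (λ j → c j ∸ r j)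
      total-flow H c≤H = trans (sumBelow-sum waiting H) (sum-cong-≗ λ j → trans
        (sumBelow-cong (λ t → cong (λ b → ((r j ≤ᵇ t) ∧ b) · 1) (unfinished≡ t j)) H)
        (trans (sumBelow-interval (r j) (c j) H) (cong (_∸ r j) (m≤n⇒m⊓n≡m (c≤H j)))))

  module Flow (I : Instance) (q≥1 : ∀ j → 1 ≤ Instance.q I j) (q<p : ∀ j → Instance.q I j < Instance.p I j) where
    open Instance I
    open Run I q≥1 q<p
    open Counting I q≥1 q<p

    module W = Windows I q≥1 q<p S feasible

    e-worked : ∀ t {w κ} → choice t ≡ just (w , κ) → sum (e (suc t)) ≡ suc (sum (e t))
    e-worked t {w} ch = trans (sum-cong-≗ (λ j → cong (λ m → is (Maybe.map proj₁ m) j · 1 + e t j) ch))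
      (trans (∑-distrib-+ (λ j → is (just w) j · 1) (e t)) (cong (_+ sum (e t)) (sum-is w (λ _ → 1))))

    -- From time `sum r` on all jobs are released, so an idle unit means that all are finished, and
    -- any other unit adds one to the total work, which never exceeds `sum p`.
    progress-or-done : ∀ k → let t = sum r + k in (∀ j → p j ≤ e t j) ⊎ k ≤ sum (e t)
    progress-or-done zero    = inj₂ z≤n
    progress-or-done (suc k) rewrite +-suc (sum r) k with progress-or-done k | W.mode (sum r + k)
    ... | inj₁ all-done | _ = inj₁ λ j → ≤-trans (all-done j) (e-mono (sum r + k) j)
    ... | inj₂ _  | W.idles _ absent = inj₁ λ j → ≤-trans
      (≮⇒≥ λ e<p → absent j (≤-trans (term≤sum r j) (m≤m+n (sum r) k) , e<p)) (e-mono (sum r + k) j)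
    ... | inj₂ le | W.least ch _ = inj₂ (≤-trans (s≤s le) (≤-reflexive (sym (e-worked (sum r + k) ch))))
    ... | inj₂ le | W.waits-for _ _ ch _ _ _ _ _ _ _ _ _ = inj₂ (≤-trans (s≤s le) (≤-reflexive (sym (e-worked (sum r + k) ch))))

    horizon : ℕ
    horizon = sum r + suc (sum p)

    all-done : ∀ j → p j ≤ e horizon j
    all-done with progress-or-done (suc (sum p))
    ... | inj₁ finished-all = finished-all
    ... | inj₂ le   = contradiction (≤-trans le (sum-mono (e≤p horizon))) (<-irrefl refl)

    completion : ∀ j → ∃[ c ] IsCompletionTime S j c
    completion j with search (λ t → remaining S j t ≟ 0) (suc horizon)
    ... | inj₁ found = found
    ... | inj₂ absent  = contradiction (m≤n⇒m∸n≡0 (≤-trans (all-done j) (≤-reflexive (sym (elapsed≡e j horizon))))) (absent ≤-refl)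

    c : Job → ℕ
    c j = proj₁ (completion j)

    F : ℕ
    F = sum (λ j → c j ∸ r j)

    isTotalFlowTime : IsTotalFlowTime S F
    isTotalFlowTime = c , (λ j → proj₂ (completion j)) , refl

    module _ (m d : ℕ) (2m≤d : 2 * m ≤ d)
      (mp≤dq : ∀ j → m * p j ≤ d * q j) (dq+mp≤dp : ∀ j → d * q j + m * p j ≤ d * p j)
      (T : Schedule) (T-feasible : Feasible T) where

      competitive : ∀ {w} → IsTotalFlowTime T w → m * m * F ≤ 28 * (d * d) * w
      competitive (c* , completes* , refl) = begin
        m * m * F                                               ≡⟨ cong (m * m *_) (ALG.total-flow c (λ j → proj₂ (completion j)) H c≤H) ⟨
        m * m * sumBelow (λ t → sum (ALG.waiting t)) H          ≤⟨ sumBelow-mono (m * m) (28 * (d * d)) locally H ⟩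
        28 * (d * d) * sumBelow (λ t → sum (OPT.waiting t)) H   ≡⟨ cong (28 * (d * d) *_) (OPT.total-flow c* completes* H c*≤H) ⟩
        28 * (d * d) * sum (λ j → c* j ∸ r j)                   ∎
        where
        open ≤-Reasoning
        module ALG = FlowTime I S feasible
        module OPT = FlowTime I T T-feasible
        H : ℕ
        H = sum c + sum c*
        c≤H : ∀ j → c j ≤ H
        c≤H j = ≤-trans (term≤sum c j) (m≤m+n _ _)
        c*≤H : ∀ j → c* j ≤ H
        c*≤H j = ≤-trans (term≤sum c* j) (m≤n+m _ (sum c))
        waiting≤alive : ∀ t j → ALG.waiting t j ≤ isAlive (st t j) · 1
        waiting≤alive t j with r j ≤ᵇ t | ≤ᵇ-reflects-≤ (r j) t | elapsed S j t <ᵇ p j | <ᵇ-reflects-< (elapsed S j t) (p j)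
        ... | false | _       | _     | _       = z≤n
        ... | true  | _       | false | _       = z≤n
        ... | true  | ofʸ r≤t | true  | ofʸ e<p = ≤-reflexive (sym (cong (λ l → is-just l · 1)
          (W.alive⇒level t j (r≤t , subst (_< p j) (elapsed≡e j t) e<p))))
        locally : ∀ t → m * m * sum (ALG.waiting t) ≤ 28 * (d * d) * sum (OPT.waiting t)
        locally t = ≤-trans (*-monoʳ-≤ (m * m) (sum-mono (waiting≤alive t)))
          (LocalBound.local I q≥1 q<p T T-feasible m d 2m≤d mp≤dq dq+mp≤dp t)

open Scheduling using (algorithm; module Run; module Flow)
open import Data.Integer.Base using (+_)
open import Data.Rational using (ℚ; mkℚ; 0ℚ; 1ℚ; ½; _≤_; _<_; _*_; _+_; _-_; -_; 1/_; Positive; NonZero; positive; toℚᵘ)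

-- Rational bounds

toℚᵘ-fromℕ : ∀ k → toℚᵘ (fromℕ k) ≃ mkℚᵘ (+ k) 0
toℚᵘ-fromℕ k = ℚ.toℚᵘ-fromℚᵘ (mkℚᵘ (+ k) 0)

mkℚᵘ-≤ : ∀ {a b k l} → mkℚᵘ (+ a) k ℚᵘ.≤ mkℚᵘ (+ b) l → a ℕ.* ℕ.suc l ℕ.≤ b ℕ.* ℕ.suc k
mkℚᵘ-≤ {a} {b} {k} {l} (ℚᵘ.*≤* le) = ℤ.drop‿+≤+ (subst₂ ℤ._≤_ (sym (ℤ.pos-* a (ℕ.suc l))) (sym (ℤ.pos-* b (ℕ.suc k))) le)

≤-mkℚᵘ : ∀ {a b k l} → a ℕ.* ℕ.suc l ℕ.≤ b ℕ.* ℕ.suc k → mkℚᵘ (+ a) k ℚᵘ.≤ mkℚᵘ (+ b) l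
≤-mkℚᵘ {a} {b} {k} {l} le = ℚᵘ.*≤* (subst₂ ℤ._≤_ (ℤ.pos-* a (ℕ.suc l)) (ℤ.pos-* b (ℕ.suc k)) (ℤ.+≤+ le))

-- The denominator is suc k, as in mkℚᵘ.
record IsFraction (x : ℚ) (a k : ℕ) : Set where
  constructor fraction
  field eq : toℚᵘ x ≃ mkℚᵘ (+ a) k
open IsFraction

fromℕ-fraction : ∀ k → IsFraction (fromℕ k) k 0
fromℕ-fraction k = fraction (toℚᵘ-fromℕ k)

-- The term `l + k * suc l` is the predecessor of `suc k * suc l`; fractions need not be in lowest
-- terms, so denominators simply multiply.
*-fraction : ∀ {x y a b k l} → IsFraction x a k → IsFraction y b l → IsFraction (x * y) (a ℕ.* b) (l ℕ.+ k ℕ.* ℕ.suc l)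
*-fraction {x} {y} {a} {b} {k} {l} (fraction p) (fraction q) = fraction (ℚᵘ.≃-trans (ℚ.toℚᵘ-homo-* x y)
  (ℚᵘ.≃-trans (ℚᵘ.*-cong p q) (ℚᵘ.≃-reflexive (cong (λ z → mkℚᵘ z _) (sym (ℤ.pos-* a b))))))

+-fraction : ∀ {x y a b k l} → IsFraction x a k → IsFraction y b l →
  IsFraction (x + y) (a ℕ.* ℕ.suc l ℕ.+ b ℕ.* ℕ.suc k) (l ℕ.+ k ℕ.* ℕ.suc l)
+-fraction {x} {y} {a} {b} {k} {l} (fraction p) (fraction q) = fraction (ℚᵘ.≃-trans (ℚ.toℚᵘ-homo-+ x y)
  (ℚᵘ.≃-trans (ℚᵘ.+-cong p q) (ℚᵘ.≃-reflexive (cong (λ z → mkℚᵘ z _)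
    (sym (trans (ℤ.pos-+ (a ℕ.* ℕ.suc l) (b ℕ.* ℕ.suc k)) (cong₂ ℤ._+_ (ℤ.pos-* a (ℕ.suc l)) (ℤ.pos-* b (ℕ.suc k)))))))))

fraction-≤ : ∀ {x y a b k l} → IsFraction x a k → IsFraction y b l → x ≤ y → a ℕ.* ℕ.suc l ℕ.≤ b ℕ.* ℕ.suc k
fraction-≤ (fraction p) (fraction q) le =
  mkℚᵘ-≤ (ℚᵘ.≤-respˡ-≃ p (ℚᵘ.≤-respʳ-≃ q (ℚ.toℚᵘ-mono-≤ le)))

≤-fraction : ∀ {x y a b k l} → IsFraction x a k → IsFraction y b l → a ℕ.* ℕ.suc l ℕ.≤ b ℕ.* ℕ.suc k → x ≤ y
≤-fraction (fraction p) (fraction q) le =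
  ℚ.toℚᵘ-cancel-≤ (ℚᵘ.≤-respˡ-≃ (ℚᵘ.≃-sym p) (ℚᵘ.≤-respʳ-≃ (ℚᵘ.≃-sym q) (≤-mkℚᵘ le)))

positive-fraction : ∀ {ε} → 0ℚ < ε → ∃[ m ] ∃[ k ] 1 ℕ.≤ m × IsFraction ε m k
positive-fraction {ε} 0<ε = byForm ε (positive 0<ε)
  where
  byForm : ∀ ε → Positive ε → ∃[ m ] ∃[ k ] 1 ℕ.≤ m × IsFraction ε m k
  byForm (mkℚ (+ ℕ.suc m) k _) _ = ℕ.suc m , k , ℕ.s≤s ℕ.z≤n , fraction ℚᵘ.≃-refl

module Bounds {ε : ℚ} {m k : ℕ} (m≥1 : 1 ℕ.≤ m) (ε≡ : IsFraction ε m k) where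

  d : ℕ
  d = ℕ.suc k

  2m≤d : ε ≤ ½ → 2 ℕ.* m ℕ.≤ d
  2m≤d ε≤½ = ℕ.≤-trans (ℕ.≤-reflexive (ℕ.*-comm 2 m))
    (ℕ.≤-trans (fraction-≤ ε≡ (fraction {½} {1} {1} ℚᵘ.≃-refl) ε≤½) (ℕ.≤-reflexive (ℕ.*-identityˡ d)))

  module _ (p q : ℕ) where

    mp≤dq : ε * fromℕ p ≤ fromℕ q → m ℕ.* p ℕ.≤ d ℕ.* q
    mp≤dq le = ℕ.≤-trans (ℕ.≤-reflexive (sym (ℕ.*-identityʳ (m ℕ.* p))))
      (ℕ.≤-trans (fraction-≤ (*-fraction ε≡ (fromℕ-fraction p)) (fromℕ-fraction q) le)
        (ℕ.≤-reflexive (eq₁ q k)))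
      where
      eq₁ : ∀ q k → q ℕ.* ℕ.suc (0 ℕ.+ k ℕ.* 1) ≡ ℕ.suc k ℕ.* q
      eq₁ = solve-∀

    dq+mp≤dp : fromℕ q ≤ (1ℚ - ε) * fromℕ p → d ℕ.* q ℕ.+ m ℕ.* p ℕ.≤ d ℕ.* p
    dq+mp≤dp le = ℕ.≤-trans (ℕ.≤-reflexive (eq₁ q m p k))
      (ℕ.≤-trans (fraction-≤ (+-fraction (fromℕ-fraction q) (*-fraction ε≡ (fromℕ-fraction p))) (fromℕ-fraction p) sum≤)
        (ℕ.≤-reflexive (eq₂ p k)))
      where
      eq₁ : ∀ q m p k → ℕ.suc k ℕ.* q ℕ.+ m ℕ.* p ≡ (q ℕ.* ℕ.suc (0 ℕ.+ k ℕ.* 1) ℕ.+ m ℕ.* p ℕ.* 1) ℕ.* 1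
      eq₁ = solve-∀
      eq₂ : ∀ p k → p ℕ.* ℕ.suc ((0 ℕ.+ k ℕ.* 1) ℕ.+ 0) ≡ ℕ.suc k ℕ.* p
      eq₂ = solve-∀
      -- Moving `ε p` to the left removes the subtraction before passing to natural numbers.
      sum≤ : fromℕ q + ε * fromℕ p ≤ fromℕ p
      sum≤ = begin
        fromℕ q + ε * fromℕ p                   ≤⟨ ℚ.+-monoˡ-≤ (ε * fromℕ p) le ⟩
        (1ℚ - ε) * fromℕ p + ε * fromℕ p        ≡⟨ ℚ.*-distribʳ-+ (fromℕ p) (1ℚ - ε) ε ⟨
        (1ℚ - ε + ε) * fromℕ p                  ≡⟨ cong (_* fromℕ p) (trans (ℚ.+-assoc 1ℚ (- ε) ε) (trans (cong (λ z → 1ℚ + z) (ℚ.+-inverseˡ ε)) (ℚ.+-identityʳ 1ℚ))) ⟩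
        1ℚ * fromℕ p                            ≡⟨ ℚ.*-identityˡ (fromℕ p) ⟩
        fromℕ p                                 ∎
        where open ℚ.≤-Reasoning

    q≥1 : ε * fromℕ p ≤ fromℕ q → 1 ℕ.≤ p → 1 ℕ.≤ q
    q≥1 le p≥1 = ℕ.n≢0⇒n>0 λ { refl → ℕ.<⇒≱ (ℕ.*-mono-≤ m≥1 p≥1) (ℕ.≤-trans (mp≤dq le) (ℕ.≤-reflexive (ℕ.*-zeroʳ d))) }

    q<p : fromℕ q ≤ (1ℚ - ε) * fromℕ p → 1 ℕ.≤ p → q ℕ.< p
    q<p le p≥1 = ℕ.*-cancelˡ-< d q p (ℕ.<-≤-trans
      (ℕ.≤-trans (ℕ.≤-reflexive (ℕ.+-comm 1 (d ℕ.* q))) (ℕ.+-monoʳ-≤ (d ℕ.* q) (ℕ.*-mono-≤ m≥1 p≥1)))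
      (dq+mp≤dp le))

  ratio-bound : ∀ (0<ε : 0ℚ < ε) C F v → m ℕ.* m ℕ.* F ℕ.≤ C ℕ.* (d ℕ.* d) ℕ.* v →
    fromℕ F ≤ ratio (fromℕ C) ε 0<ε * fromℕ v
  ratio-bound 0<ε C F v le = begin
    fromℕ F                              ≡⟨ ℚ.*-identityʳ (fromℕ F) ⟨
    fromℕ F * 1ℚ                         ≡⟨ cong (fromℕ F *_) (ℚ.*-inverseʳ (ε * ε)) ⟨
    fromℕ F * (ε * ε * 1/ε²)             ≡⟨ ℚ.*-assoc (fromℕ F) (ε * ε) 1/ε² ⟨
    fromℕ F * (ε * ε) * 1/ε²             ≤⟨ ℚ.*-monoʳ-≤-nonNeg 1/ε² {{ℚ.pos⇒nonNeg 1/ε² {{ℚ.1/pos⇒pos (ε * ε)}}}} cleared ⟩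
    fromℕ C * fromℕ v * 1/ε²             ≡⟨ ℚ.*-assoc (fromℕ C) (fromℕ v) 1/ε² ⟩
    fromℕ C * (fromℕ v * 1/ε²)           ≡⟨ cong (fromℕ C *_) (ℚ.*-comm (fromℕ v) 1/ε²) ⟩
    fromℕ C * (1/ε² * fromℕ v)           ≡⟨ ℚ.*-assoc (fromℕ C) 1/ε² (fromℕ v) ⟨
    fromℕ C * 1/ε² * fromℕ v             ∎
    where
    open ℚ.≤-Reasoning
    instance
      ε>0 : Positive ε
      ε>0 = positive 0<ε
      ε²>0 : Positive (ε * ε)
      ε²>0 = ℚ.pos*pos⇒pos ε ε
      ε²≠0 : NonZero (ε * ε)
      ε²≠0 = ℚ.pos⇒nonZero (ε * ε)
    1/ε² : ℚ
    1/ε² = 1/ (ε * ε)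
    cleared : fromℕ F * (ε * ε) ≤ fromℕ C * fromℕ v
    cleared = ≤-fraction (*-fraction (fromℕ-fraction F) (*-fraction ε≡ ε≡)) (*-fraction (fromℕ-fraction C) (fromℕ-fraction v))
      (ℕ.≤-trans (ℕ.≤-reflexive (eq₁ F m)) (ℕ.≤-trans le (ℕ.≤-reflexive (eq₂ C k v))))
      where
      eq₁ : ∀ F m → F ℕ.* (m ℕ.* m) ℕ.* 1 ≡ m ℕ.* m ℕ.* F
      eq₁ = solve-∀
      eq₂ : ∀ C k v → C ℕ.* (ℕ.suc k ℕ.* ℕ.suc k) ℕ.* v ≡ C ℕ.* v ℕ.* ℕ.suc ((k ℕ.+ k ℕ.* ℕ.suc k) ℕ.+ 0)
      eq₂ = solve-∀

-- The guarantee for a given `ε`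

module Guarantee {ε : ℚ} {m k : ℕ} (m≥1 : 1 ℕ.≤ m) (ε≡ : IsFraction ε m k)
  (I : Instance) (signaling : Instance.EpsSignaling I ε) where
  open Instance I
  private module ε = Bounds m≥1 ε≡

  1≤q : ∀ j → 1 ℕ.≤ q j
  1≤q j = ε.q≥1 (p j) (q j) (proj₁ (signaling j)) (p≥1 j)

  q<p : ∀ j → q j ℕ.< p j
  q<p j = ε.q<p (p j) (q j) (proj₂ (signaling j)) (p≥1 j)

  open Run I 1≤q q<p using (S; feasible; producedBy) public
  open Flow I 1≤q q<p using (F; isTotalFlowTime; competitive) public

  F-bound : (0<ε : 0ℚ < ε) → ε ≤ ½ → ∀ opt → IsOPT opt → fromℕ F ≤ ratio (fromℕ 28) ε 0<ε * fromℕ opt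
  F-bound 0<ε ε≤½ opt ((T , T-feasible , flow) , _) = ε.ratio-bound 0<ε 28 F opt
    (competitive m ε.d (ε.2m≤d ε≤½)
      (λ j → ε.mp≤dq (p j) (q j) (proj₁ (signaling j)))
      (λ j → ε.dq+mp≤dp (p j) (q j) (proj₂ (signaling j)))
      T T-feasible flow)

theorem1p1 : ∃[ C ] 0ℚ < C ×
    (∃[ A ] ((ε : ℚ) (0<ε : 0ℚ < ε) → ε ≤ ½ →
    (I : Instance) → Instance.EpsSignaling I ε →
    (name : Instance.Job I ↣ ℕ) →
    ∃[ S ] Online.ProducedBy I name A S ×
    Instance.Feasible I S ×
    (∃[ F ] Instance.IsTotalFlowTime I S F ×
    (∀ opt → Instance.IsOPT I opt → fromℕ F ≤ ratio C ε 0<ε * fromℕ opt))))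
theorem1p1 = fromℕ 28 , ℚ.positive⁻¹ (fromℕ 28) , algorithm , λ ε 0<ε ε≤½ I signaling name →
  let (m , k , m≥1 , ε≡) = positive-fraction 0<ε
      module G = Guarantee m≥1 ε≡ I signaling
  in G.S , G.producedBy name , G.feasible , G.F , G.isTotalFlowTime , G.F-bound 0<ε ε≤½
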